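{- Let $p$ be an odd prime and let $C_k=\binom{2k}{k}/(k+1)$ denote the $k$-th Catalan number. (i) If $p\equiv 3\pmod 4$, then $$\sum_{k=0}^{(p-1)/2}\frac{\binom{2k}kC_k}{8^k}\equiv-2\sum_{k=0}^{(p-1)/2}\frac{k\binom{2k}k^2}{8^k}\equiv-\frac12\sum_{k=0}^{(p-1)/2}\frac{\binom{2k}kC_k}{(-16)^k}\equiv4\sum_{k=0}^{(p-1)/2}\frac{k\binom{2k}k^2}{(-16)^k}\equiv\frac{(-1)^{(p+1)/4}}2\binom{(p+1)/2}{(p+1)/4}\pmod{p}$$ and $$\sum_{k=0}^{(p-1)/2}\frac{\binom{2k}k^2}{8^k}\equiv-\sum_{k=0}^{(p-1)/2}\frac{\binom{2k}k^2}{(-16)^k}\equiv\frac{2p(-1)^{(p+1)/4}}{\binom{(p+1)/2}{(p+1)/4}}\pmod{p^2}.$$ (ii) For every $d\in\{0,1,\ldots,(p-1)/2\}$ with $d\equiv (p+1)/2\pmod 2$, $$\sum_{k=0}^{(p-1)/2}\frac{\binom{2k}k\binom{2k}{k+d}}{8^k}\equiv0\pmod p.$$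
   Context: For rational numbers $a,b$ whose denominators are not divisible by $p$, $a\equiv b\pmod{p^m}$ means $(a-b)/p^m$ has denominator not divisible by $p$. -}

module Defs where

open import Data.Nat as ℕ using (ℕ; zero; suc; _^_; _∸_)
open import Data.Nat.Divisibility using (_∣_)
open import Data.Nat.Combinatorics using (_C_)
open import Data.Integer as ℤ using (+_)
open import Data.Rational as ℚ using (ℚ; ↧ₙ_; 0ℚ; 1ℚ)
open import Relation.Nullary using (¬_)

⟦_⟧ : ℕ → ℚ
⟦ n ⟧ = (+ n) ℚ./ 1

_^ℚ_ : ℚ → ℕ → ℚ
q ^ℚ zero  = 1ℚ
q ^ℚ suc n = q ℚ.* (q ^ℚ n)

-- division of a rational by a natural number (d = 0 never occurs below;
-- we set q / 0 = 0 only to make the operation total)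
infixl 7 _÷ℕ_
_÷ℕ_ : ℚ → ℕ → ℚ
q ÷ℕ zero  = 0ℚ
q ÷ℕ suc d = q ℚ.* ((+ 1) ℚ./ suc d)

Σ[0≤k≤_]_ : ℕ → (ℕ → ℚ) → ℚ
Σ[0≤k≤ zero  ] f = f 0
Σ[0≤k≤ suc n ] f = (Σ[0≤k≤ n ] f) ℚ.+ f (suc n)

binom : ℕ → ℕ → ℚ
binom n k = ⟦ n C k ⟧

catalan : ℕ → ℚ
catalan k = binom (2 ℕ.* k) k ÷ℕ suc k

infix 4 _≡_[mod_^_]
_≡_[mod_^_] : ℚ → ℚ → ℕ → ℕ → Set
a ≡ b [mod p ^ m ] = ¬ (p ∣ ↧ₙ ((a ℚ.- b) ÷ℕ (p ^ m)))

{-# OPTIONS --safe #-}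
module Submission where

-- Write p = 2n + 1. Since 4 (n - k) (n + k + 1) = p² - (2k + 1)², modulo p² the summand C(2k,k)² /
-- (-16)ᵏ is the coefficient F n k = C(n,k) C(n+k,n) of xᵏ in Pₙ(1 + 2x), with Pₙ the Legendre
-- polynomial; replacing -16 by 8 evaluates at x = -2 instead of x = 1. For odd n the reflection
-- Pₙ(-x) = -Pₙ(x), together with its derivative and its integral, relates the sums at x = -2 and x
-- = 1. Modulo p, F n k ≡ (-1)ᵏ C(n,k)², so the sums weighted by k and by 1/(k+1) are coefficients
-- of (1 - x)ʳ (1 + x)ʳ⁺¹ = (1 - x²)ʳ (1 + x). Modulo p², Pₙ(3) is the coefficient of xⁿ in (1 +
-- x)ⁿ (1 - x)⁻ⁿ⁻¹ = (1 - x²)ⁿ (1 - x)⁻ᵖ, that is p Σⱼ (-1)ʲ C(n,j) / (n - 2j) over 2j < n, which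
-- partial fractions and 2ᵖ⁻¹ ≡ 1 evaluate. In (ii) the summands, read from the top, are modulo p
-- proportional to the coefficients of Pₙ₋ₔ at its centre of symmetry, and n - d is odd.

open import Defs
open import Data.Nat as ℕ using (ℕ; zero; suc; _^_; _∸_; _/_; _%_; _≤_; _<_; z≤n; s≤s; _!)
import Data.Nat.Properties as ℕₚ
open import Data.Nat.Combinatorics using (_C_; nCk+nC[k+1]≡[n+1]C[k+1]; k>n⇒nCk≡0; nCk≡nC[n∸k]; nCn≡1)
open import Data.Nat.Coprimality using (sym; 1-coprimeTo)
open import Data.Nat.Divisibility using (_∣_; divides; ∣-trans; >⇒∤; ∣1⇒≡1)
open import Data.Nat.DivMod using (m≡m%n+[m/n]*n; m*n/n≡m)
open import Data.Nat.Primality using (Prime; euclidsLemma; ¬prime[1]; prime⇒nonZero)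
open import Data.Integer as ℤ using (+_; -[1+_])
import Data.Integer.Properties as ℤₚ
open import Data.Rational as ℚ using (ℚ; 0ℚ; 1ℚ; mkℚ; _+_; _*_; -_; _-_; ↧_; ↧ₙ_)
import Data.Rational.Properties as ℚₚ
open import Data.Product using (_×_; _,_)
open import Data.Sum using (inj₁; inj₂)
open import Relation.Nullary using (¬_; yes; no; contradiction)
open import Relation.Nullary.Decidable.Core using (dec⇒maybe)
open import Relation.Binary.Bundles using (Setoid)
open import Relation.Binary.Definitions using (tri<; tri≈; tri>)
open import Relation.Binary.PropositionalEquality using (_≡_; _≢_; refl; cong; cong₂; subst; module ≡-Reasoning) renaming (sym to ≡-sym; trans to ≡-trans)
import Relation.Binary.Reasoning.Setoid as SetoidReasoning
open import Tactic.RingSolver using (solve-∀)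
open import Tactic.RingSolver.Core.AlmostCommutativeRing using (AlmostCommutativeRing; fromCommutativeRing)

-- With Q(x) = Pₙ(1 + 2x) the reflection reads Q(-1 - x) = (-1)ⁿ Q(x): it exchanges -2 with 1 and -1
-- with 0, and fixes -1/2. As 1/8 = (-2)/(-16), this ties the two bases together; for the Catalan
-- sums it leaves the integral over [0, 1], because the one over [-1, 0] vanishes. Polynomials are
-- represented by coefficient sequences, and evaluation, differentiation and integration by the
-- values f k that a linear functional takes on xᵏ. Substituting 1 + x for x replaces f by its
-- binomial transform, so one identity for arbitrary f serves every point and every weight. Products
-- of powers of 1 + x and 1 - x become powers of commuting shift operators. Termwise congruences are
-- mostly proved by comparing first-order recurrences; each induction step cancels a factor that
-- must be a unit modulo p, which is where the ranges k ≤ n matter. For the value modulo p², an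
-- explicit factor p is split off first, after which the cofactor is needed only modulo p.

ℚ-ring : AlmostCommutativeRing _ _
ℚ-ring = fromCommutativeRing ℚₚ.+-*-commutativeRing (λ x → dec⇒maybe (0ℚ ℚₚ.≟ x))

m1 : ℚ
m1 = -[1+ 0 ] ℚ./ 1

-- The embedding of ℕ in ℚ

-- The division in `⟦ a ⟧` normalises through a gcd that is stuck on a variable; the canonical form
-- exposes numerator and denominator.
⟦⟧-mkℚ : ∀ a → ⟦ a ⟧ ≡ mkℚ (+ a) 0 (sym (1-coprimeTo a))
⟦⟧-mkℚ a = ℚₚ.↥p/↧p≡p (mkℚ (+ a) 0 (sym (1-coprimeTo a)))

⟦⟧-+ : ∀ a b → ⟦ a ℕ.+ b ⟧ ≡ ⟦ a ⟧ + ⟦ b ⟧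
⟦⟧-+ a b rewrite ⟦⟧-mkℚ a | ⟦⟧-mkℚ b =
  cong (λ z → z ℚ./ 1) (≡-sym (cong₂ ℤ._+_ (ℤₚ.*-identityʳ (+ a)) (ℤₚ.*-identityʳ (+ b))))

⟦⟧-* : ∀ a b → ⟦ a ℕ.* b ⟧ ≡ ⟦ a ⟧ * ⟦ b ⟧
⟦⟧-* a b rewrite ⟦⟧-mkℚ a | ⟦⟧-mkℚ b = cong (λ z → z ℚ./ 1) (ℤₚ.pos-* a b)

⟦⟧-suc : ∀ a → ⟦ suc a ⟧ ≡ 1ℚ + ⟦ a ⟧
⟦⟧-suc = ⟦⟧-+ 1

⟦⟧-∸ : ∀ {a b} → b ≤ a → ⟦ a ∸ b ⟧ ≡ ⟦ a ⟧ - ⟦ b ⟧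
⟦⟧-∸ {a} {b} b≤a = ≡-trans (lemma ⟦ a ∸ b ⟧ ⟦ b ⟧)
  (cong (_- ⟦ b ⟧) (≡-trans (≡-sym (⟦⟧-+ (a ∸ b) b)) (cong ⟦_⟧ (ℕₚ.m∸n+n≡m b≤a))))
  where
  lemma : ∀ x y → x ≡ (x + y) - y
  lemma = solve-∀ ℚ-ring

-- Reciprocals of natural numbers and powers

recip : ℕ → ℚ
recip d = 1ℚ ÷ℕ d

÷ℕ-recip : ∀ q d → q ÷ℕ d ≡ q * recip d
÷ℕ-recip q zero    = ≡-sym (ℚₚ.*-zeroʳ q)
÷ℕ-recip q (suc d) = cong (q *_) (≡-sym (ℚₚ.*-identityˡ _))

recip-inverse : ∀ d → ⟦ suc d ⟧ * recip (suc d) ≡ 1ℚ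
recip-inverse d rewrite ℚₚ.*-identityˡ ((+ 1) ℚ./ suc d) | ⟦⟧-mkℚ (suc d)
  | ℚₚ.↥p/↧p≡p (mkℚ (+ 1) d (1-coprimeTo (suc d))) =
  ℚₚ.*-inverseʳ (mkℚ (+ suc d) 0 (sym (1-coprimeTo (suc d))))

recip-inverse′ : ∀ d → .{{ℕ.NonZero d}} → ⟦ d ⟧ * recip d ≡ 1ℚ
recip-inverse′ (suc d) = recip-inverse d

*-cancel-invertible : ∀ u v {a b} → u * v ≡ 1ℚ → u * a ≡ u * b → a ≡ b
*-cancel-invertible u v {a} {b} uv≡1 eq = begin
  a           ≡⟨ ℚₚ.*-identityˡ a ⟨
  1ℚ * a      ≡⟨ cong (_* a) uv≡1 ⟨
  u * v * a   ≡⟨ swap u v a ⟩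
  v * (u * a) ≡⟨ cong (v *_) eq ⟩
  v * (u * b) ≡⟨ swap u v b ⟨
  u * v * b   ≡⟨ cong (_* b) uv≡1 ⟩
  1ℚ * b      ≡⟨ ℚₚ.*-identityˡ b ⟩
  b           ∎
  where
  open ≡-Reasoning
  swap : ∀ x y z → x * y * z ≡ y * (x * z)
  swap = solve-∀ ℚ-ring

*-cancel-suc : ∀ d {a b} → ⟦ suc d ⟧ * a ≡ ⟦ suc d ⟧ * b → a ≡ b
*-cancel-suc d = *-cancel-invertible ⟦ suc d ⟧ (recip (suc d)) (recip-inverse d)

recip-unique : ∀ d .{{_ : ℕ.NonZero d}} v → ⟦ d ⟧ * v ≡ 1ℚ → v ≡ recip d
recip-unique (suc d) v eq = *-cancel-suc d (≡-trans eq (≡-sym (recip-inverse d)))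

recip-* : ∀ a b .{{_ : ℕ.NonZero a}} .{{_ : ℕ.NonZero b}} → recip (a ℕ.* b) ≡ recip a * recip b
recip-* (suc a) (suc b) = ≡-sym (recip-unique (suc a ℕ.* suc b) (recip (suc a) * recip (suc b)) (begin
  ⟦ suc a ℕ.* suc b ⟧ * (recip (suc a) * recip (suc b))     ≡⟨ cong (_* (recip (suc a) * recip (suc b))) (⟦⟧-* (suc a) (suc b)) ⟩
  ⟦ suc a ⟧ * ⟦ suc b ⟧ * (recip (suc a) * recip (suc b))   ≡⟨ swap ⟦ suc a ⟧ ⟦ suc b ⟧ (recip (suc a)) (recip (suc b)) ⟩
  (⟦ suc a ⟧ * recip (suc a)) * (⟦ suc b ⟧ * recip (suc b)) ≡⟨ cong₂ _*_ (recip-inverse a) (recip-inverse b) ⟩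
  1ℚ                                                         ∎))
  where
  open ≡-Reasoning
  swap : ∀ x y z w → x * y * (z * w) ≡ (x * z) * (y * w)
  swap = solve-∀ ℚ-ring

recip-^ : ∀ a .{{_ : ℕ.NonZero a}} k → recip (a ^ k) ≡ recip a ^ℚ k
recip-^ a zero    = refl
recip-^ a {{a≢0}} (suc k) = ≡-trans (recip-* a (a ^ k) {{a≢0}} {{ℕₚ.m^n≢0 a k}}) (cong (recip a *_) (recip-^ a k))

^ℚ-+ : ∀ x a b → x ^ℚ (a ℕ.+ b) ≡ x ^ℚ a * x ^ℚ b
^ℚ-+ x zero    b = ≡-sym (ℚₚ.*-identityˡ (x ^ℚ b))
^ℚ-+ x (suc a) b = ≡-trans (cong (x *_) (^ℚ-+ x a b)) (≡-sym (ℚₚ.*-assoc x (x ^ℚ a) (x ^ℚ b)))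

^ℚ-* : ∀ x y k → (x * y) ^ℚ k ≡ x ^ℚ k * y ^ℚ k
^ℚ-* x y zero    = refl
^ℚ-* x y (suc k) = ≡-trans (cong ((x * y) *_) (^ℚ-* x y k)) (swap x y (x ^ℚ k) (y ^ℚ k))
  where
  swap : ∀ x y z w → x * y * (z * w) ≡ (x * z) * (y * w)
  swap = solve-∀ ℚ-ring

1^ℚ : ∀ k → 1ℚ ^ℚ k ≡ 1ℚ
1^ℚ zero    = refl
1^ℚ (suc k) = ≡-trans (ℚₚ.*-identityˡ (1ℚ ^ℚ k)) (1^ℚ k)

m1^-involutive : ∀ k → m1 ^ℚ k * m1 ^ℚ k ≡ 1ℚ
m1^-involutive k = ≡-trans (≡-sym (^ℚ-* m1 m1 k)) (1^ℚ k)

m1^-double : ∀ k → m1 ^ℚ (2 ℕ.* k) ≡ 1ℚ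
m1^-double k rewrite ℕₚ.+-identityʳ k = ≡-trans (^ℚ-+ m1 k k) (m1^-involutive k)

-- Binomial coefficients

binom-zero : ∀ n → binom n 0 ≡ 1ℚ
binom-zero n = cong ⟦_⟧ (≡-trans (nCk≡nC[n∸k] {0} {n} z≤n) (nCn≡1 n))

binom-diag : ∀ n → binom n n ≡ 1ℚ
binom-diag n = cong ⟦_⟧ (nCn≡1 n)

binom-over : ∀ {n k} → n < k → binom n k ≡ 0ℚ
binom-over n<k = cong ⟦_⟧ (k>n⇒nCk≡0 n<k)

binom-sym : ∀ {n k} → k ≤ n → binom n k ≡ binom n (n ∸ k)
binom-sym k≤n = cong ⟦_⟧ (nCk≡nC[n∸k] k≤n)

binom-sym-+ : ∀ a b → binom (a ℕ.+ b) a ≡ binom (a ℕ.+ b) b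
binom-sym-+ a b = ≡-trans (binom-sym (ℕₚ.m≤m+n a b)) (cong (binom (a ℕ.+ b)) (ℕₚ.m+n∸m≡n a b))

pascal : ∀ n k → binom (suc n) (suc k) ≡ binom n k + binom n (suc k)
pascal n k = ≡-trans (cong ⟦_⟧ (≡-sym (nCk+nC[k+1]≡[n+1]C[k+1] n k))) (⟦⟧-+ (n C k) (n C suc k))

absorption : ∀ n k → ⟦ suc k ⟧ * binom (suc n) (suc k) ≡ ⟦ suc n ⟧ * binom n k
absorption zero zero    = refl
absorption zero (suc k) rewrite binom-over {1} {suc (suc k)} (s≤s (s≤s z≤n)) | binom-over {0} {suc k} (s≤s z≤n) =
  ≡-trans (ℚₚ.*-zeroʳ ⟦ suc (suc k) ⟧) (≡-sym (ℚₚ.*-zeroʳ ⟦ 1 ⟧))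
absorption (suc n) zero = begin
  ⟦ 1 ⟧ * binom (suc (suc n)) 1                    ≡⟨ cong (⟦ 1 ⟧ *_) (pascal (suc n) 0) ⟩
  ⟦ 1 ⟧ * (binom (suc n) 0 + binom (suc n) 1)      ≡⟨ ℚₚ.*-distribˡ-+ ⟦ 1 ⟧ (binom (suc n) 0) (binom (suc n) 1) ⟩
  ⟦ 1 ⟧ * binom (suc n) 0 + ⟦ 1 ⟧ * binom (suc n) 1 ≡⟨ cong₂ _+_ (cong (⟦ 1 ⟧ *_) (binom-zero (suc n))) (absorption n 0) ⟩
  1ℚ + ⟦ suc n ⟧ * binom n 0                        ≡⟨ cong (λ b → 1ℚ + ⟦ suc n ⟧ * b) (binom-zero n) ⟩
  1ℚ + ⟦ suc n ⟧ * 1ℚ                               ≡⟨ lemma ⟦ suc n ⟧ ⟩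
  (1ℚ + ⟦ suc n ⟧) * 1ℚ                             ≡⟨ cong₂ _*_ (⟦⟧-suc (suc n)) (binom-zero (suc n)) ⟨
  ⟦ suc (suc n) ⟧ * binom (suc n) 0                 ∎
  where
  open ≡-Reasoning
  lemma : ∀ x → 1ℚ + x * 1ℚ ≡ (1ℚ + x) * 1ℚ
  lemma = solve-∀ ℚ-ring
absorption (suc n) (suc k) = begin
  ⟦ suc (suc k) ⟧ * binom (suc (suc n)) (suc (suc k))
    ≡⟨ cong (⟦ suc (suc k) ⟧ *_) (pascal (suc n) (suc k)) ⟩
  ⟦ suc (suc k) ⟧ * (x + y)
    ≡⟨ ℚₚ.*-distribˡ-+ ⟦ suc (suc k) ⟧ x y ⟩
  ⟦ suc (suc k) ⟧ * x + ⟦ suc (suc k) ⟧ * y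
    ≡⟨ cong₂ (λ s t → s * x + t) (⟦⟧-suc (suc k)) (absorption n (suc k)) ⟩
  (1ℚ + ⟦ suc k ⟧) * x + ⟦ suc n ⟧ * binom n (suc k)
    ≡⟨ expand ⟦ suc k ⟧ x (⟦ suc n ⟧ * binom n (suc k)) ⟩
  x + (⟦ suc k ⟧ * x + ⟦ suc n ⟧ * binom n (suc k))
    ≡⟨ cong (λ t → x + (t + ⟦ suc n ⟧ * binom n (suc k))) (absorption n k) ⟩
  x + (⟦ suc n ⟧ * binom n k + ⟦ suc n ⟧ * binom n (suc k))
    ≡⟨ cong (λ t → x + t) (ℚₚ.*-distribˡ-+ ⟦ suc n ⟧ (binom n k) (binom n (suc k))) ⟨
  x + ⟦ suc n ⟧ * (binom n k + binom n (suc k))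
    ≡⟨ cong (λ t → x + ⟦ suc n ⟧ * t) (pascal n k) ⟨
  x + ⟦ suc n ⟧ * x
    ≡⟨ factor ⟦ suc n ⟧ x ⟩
  (1ℚ + ⟦ suc n ⟧) * x
    ≡⟨ cong (_* x) (⟦⟧-suc (suc n)) ⟨
  ⟦ suc (suc n) ⟧ * x ∎
  where
  open ≡-Reasoning
  x y : ℚ
  x = binom (suc n) (suc k)
  y = binom (suc n) (suc (suc k))
  expand : ∀ s x t → (1ℚ + s) * x + t ≡ x + (s * x + t)
  expand = solve-∀ ℚ-ring
  factor : ∀ s x → x + s * x ≡ (1ℚ + s) * x
  factor = solve-∀ ℚ-ring

binom-lower : ∀ n k → ⟦ suc k ⟧ * binom n (suc k) ≡ (⟦ n ⟧ - ⟦ k ⟧) * binom n k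
binom-lower n k = begin
  ⟦ suc k ⟧ * binom n (suc k)
    ≡⟨ lemma₁ ⟦ suc k ⟧ (binom n k) (binom n (suc k)) ⟩
  ⟦ suc k ⟧ * (binom n k + binom n (suc k)) - ⟦ suc k ⟧ * binom n k
    ≡⟨ cong (λ t → ⟦ suc k ⟧ * t - ⟦ suc k ⟧ * binom n k) (pascal n k) ⟨
  ⟦ suc k ⟧ * binom (suc n) (suc k) - ⟦ suc k ⟧ * binom n k
    ≡⟨ cong (_- ⟦ suc k ⟧ * binom n k) (absorption n k) ⟩
  ⟦ suc n ⟧ * binom n k - ⟦ suc k ⟧ * binom n k
    ≡⟨ cong₂ (λ s t → s * binom n k - t * binom n k) (⟦⟧-suc n) (⟦⟧-suc k) ⟩
  (1ℚ + ⟦ n ⟧) * binom n k - (1ℚ + ⟦ k ⟧) * binom n k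
    ≡⟨ lemma₂ ⟦ n ⟧ ⟦ k ⟧ (binom n k) ⟩
  (⟦ n ⟧ - ⟦ k ⟧) * binom n k ∎
  where
  open ≡-Reasoning
  lemma₁ : ∀ s x y → s * y ≡ s * (x + y) - s * x
  lemma₁ = solve-∀ ℚ-ring
  lemma₂ : ∀ n k b → (1ℚ + n) * b - (1ℚ + k) * b ≡ (n - k) * b
  lemma₂ = solve-∀ ℚ-ring

binom-upper : ∀ n k → (⟦ suc n ⟧ - ⟦ k ⟧) * binom (suc n) k ≡ ⟦ suc n ⟧ * binom n k
binom-upper n k = ≡-trans (≡-sym (binom-lower (suc n) k)) (absorption n k)

-- Finite sums

Σ-cong : ∀ n {f g : ℕ → ℚ} → (∀ k → k ≤ n → f k ≡ g k) → Σ[0≤k≤ n ] f ≡ Σ[0≤k≤ n ] g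
Σ-cong zero    eq = eq 0 z≤n
Σ-cong (suc n) eq = cong₂ _+_ (Σ-cong n (λ k k≤n → eq k (ℕₚ.m≤n⇒m≤1+n k≤n))) (eq (suc n) ℕₚ.≤-refl)

Σ-distribˡ : ∀ n c f → c * Σ[0≤k≤ n ] f ≡ Σ[0≤k≤ n ] (λ k → c * f k)
Σ-distribˡ zero    c f = refl
Σ-distribˡ (suc n) c f = ≡-trans (ℚₚ.*-distribˡ-+ c (Σ[0≤k≤ n ] f) (f (suc n)))
  (cong (_+ c * f (suc n)) (Σ-distribˡ n c f))

Σ-+ : ∀ n f g → Σ[0≤k≤ n ] (λ k → f k + g k) ≡ Σ[0≤k≤ n ] f + Σ[0≤k≤ n ] g
Σ-+ zero    f g = refl
Σ-+ (suc n) f g = ≡-trans (cong (_+ (f (suc n) + g (suc n))) (Σ-+ n f g))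
  (interchange (Σ[0≤k≤ n ] f) (Σ[0≤k≤ n ] g) (f (suc n)) (g (suc n)))
  where
  interchange : ∀ x y z w → x + y + (z + w) ≡ x + z + (y + w)
  interchange = solve-∀ ℚ-ring

Σ-swap : ∀ n m (f : ℕ → ℕ → ℚ) →
  Σ[0≤k≤ n ] (λ i → Σ[0≤k≤ m ] (f i)) ≡ Σ[0≤k≤ m ] (λ j → Σ[0≤k≤ n ] (λ i → f i j))
Σ-swap zero    m f = refl
Σ-swap (suc n) m f = ≡-trans (cong (_+ Σ[0≤k≤ m ] (f (suc n))) (Σ-swap n m f))
  (≡-sym (Σ-+ m (λ j → Σ[0≤k≤ n ] (λ i → f i j)) (f (suc n))))

Σ-head : ∀ n f → Σ[0≤k≤ suc n ] f ≡ f 0 + Σ[0≤k≤ n ] (λ k → f (suc k))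
Σ-head zero    f = refl
Σ-head (suc n) f = ≡-trans (cong (_+ f (suc (suc n))) (Σ-head n f))
  (ℚₚ.+-assoc (f 0) (Σ[0≤k≤ n ] (λ k → f (suc k))) (f (suc (suc n))))

Σ-reverse : ∀ n f → Σ[0≤k≤ n ] f ≡ Σ[0≤k≤ n ] (λ k → f (n ∸ k))
Σ-reverse zero    f = refl
Σ-reverse (suc n) f = begin
  Σ[0≤k≤ n ] f + f (suc n)                       ≡⟨ cong (_+ f (suc n)) (Σ-reverse n f) ⟩
  Σ[0≤k≤ n ] (λ k → f (n ∸ k)) + f (suc n)       ≡⟨ ℚₚ.+-comm (Σ[0≤k≤ n ] (λ k → f (n ∸ k))) (f (suc n)) ⟩
  f (suc n) + Σ[0≤k≤ n ] (λ k → f (n ∸ k))       ≡⟨ Σ-head n (λ k → f (suc n ∸ k)) ⟨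
  Σ[0≤k≤ suc n ] (λ k → f (suc n ∸ k))           ∎
  where open ≡-Reasoning

Σ-zero : ∀ n {f : ℕ → ℚ} → (∀ k → k ≤ n → f k ≡ 0ℚ) → Σ[0≤k≤ n ] f ≡ 0ℚ
Σ-zero zero    eq = eq 0 z≤n
Σ-zero (suc n) eq = ≡-trans (cong₂ _+_ (Σ-zero n (λ k k≤n → eq k (ℕₚ.m≤n⇒m≤1+n k≤n))) (eq (suc n) ℕₚ.≤-refl)) refl

Σ-truncate : ∀ n m f → (∀ k → n < k → f k ≡ 0ℚ) → Σ[0≤k≤ m ℕ.+ n ] f ≡ Σ[0≤k≤ n ] f
Σ-truncate n zero    f eq = refl
Σ-truncate n (suc m) f eq = ≡-trans (cong₂ _+_ (Σ-truncate n m f eq) (eq (suc (m ℕ.+ n)) (s≤s (ℕₚ.m≤n+m n m))))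
  (ℚₚ.+-identityʳ (Σ[0≤k≤ n ] f))

Σ-drop : ∀ j r f → (∀ k → k < j → f k ≡ 0ℚ) → Σ[0≤k≤ j ℕ.+ r ] f ≡ Σ[0≤k≤ r ] (λ i → f (j ℕ.+ i))
Σ-drop zero    r f eq = refl
Σ-drop (suc j) r f eq = begin
  Σ[0≤k≤ suc (j ℕ.+ r) ] f                         ≡⟨ Σ-head (j ℕ.+ r) f ⟩
  f 0 + Σ[0≤k≤ j ℕ.+ r ] (λ k → f (suc k))         ≡⟨ cong₂ _+_ (eq 0 (s≤s z≤n)) (Σ-drop j r (λ k → f (suc k)) (λ k k<j → eq (suc k) (s≤s k<j))) ⟩
  0ℚ + Σ[0≤k≤ r ] (λ i → f (suc j ℕ.+ i))          ≡⟨ ℚₚ.+-identityˡ (Σ[0≤k≤ r ] (λ i → f (suc j ℕ.+ i))) ⟩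
  Σ[0≤k≤ r ] (λ i → f (suc j ℕ.+ i))               ∎
  where open ≡-Reasoning

Σ-single : ∀ n j f → j ≤ n → (∀ k → k ≢ j → f k ≡ 0ℚ) → Σ[0≤k≤ n ] f ≡ f j
Σ-single zero    zero    f z≤n eq = refl
Σ-single (suc n) j f j≤n eq with j ℕ.≟ suc n
... | yes refl = ≡-trans (cong (_+ f (suc n)) (Σ-zero n (λ k k≤n → eq k (ℕₚ.<⇒≢ (s≤s k≤n))))) (ℚₚ.+-identityˡ (f (suc n)))
... | no j≢1+n = ≡-trans (cong₂ _+_ (Σ-single n j f (ℕ.s≤s⁻¹ (ℕₚ.≤∧≢⇒< j≤n j≢1+n)) eq) (eq (suc n) (λ e → j≢1+n (≡-sym e))))
  (ℚₚ.+-identityʳ (f j))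

Σ-fold : ∀ m f → Σ[0≤k≤ suc (m ℕ.+ m) ] f ≡ Σ[0≤k≤ m ] f + Σ[0≤k≤ m ] (λ j → f (suc (m ℕ.+ m) ∸ j))
Σ-fold m f = split m m f
  where
  open ≡-Reasoning
  -- The two half-lengths are decoupled, because peeling off `f 0` shortens only the first half.
  split : ∀ a b f → Σ[0≤k≤ suc (a ℕ.+ b) ] f ≡ Σ[0≤k≤ a ] f + Σ[0≤k≤ b ] (λ j → f (suc (a ℕ.+ b) ∸ j))
  split zero    b f = ≡-trans (Σ-head b f) (cong (λ t → f 0 + t) (Σ-reverse′ b f))
    where
    Σ-reverse′ : ∀ b f → Σ[0≤k≤ b ] (λ k → f (suc k)) ≡ Σ[0≤k≤ b ] (λ j → f (suc b ∸ j))
    Σ-reverse′ b f = ≡-trans (Σ-reverse b (λ k → f (suc k)))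
      (Σ-cong b (λ k k≤b → cong f (≡-sym (ℕₚ.+-∸-assoc 1 k≤b))))
  split (suc a) b f = begin
    Σ[0≤k≤ suc (suc a ℕ.+ b) ] f
      ≡⟨ Σ-head (suc (a ℕ.+ b)) f ⟩
    f 0 + Σ[0≤k≤ suc (a ℕ.+ b) ] (λ k → f (suc k))
      ≡⟨ cong (λ t → f 0 + t) (split a b (λ k → f (suc k))) ⟩
    f 0 + (Σ[0≤k≤ a ] (λ k → f (suc k)) + Σ[0≤k≤ b ] (λ j → f (suc (suc (a ℕ.+ b) ∸ j))))
      ≡⟨ ℚₚ.+-assoc (f 0) (Σ[0≤k≤ a ] (λ k → f (suc k))) (Σ[0≤k≤ b ] (λ j → f (suc (suc (a ℕ.+ b) ∸ j)))) ⟨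
    f 0 + Σ[0≤k≤ a ] (λ k → f (suc k)) + Σ[0≤k≤ b ] (λ j → f (suc (suc (a ℕ.+ b) ∸ j)))
      ≡⟨ cong₂ _+_ (Σ-head a f) (Σ-cong b (λ j j≤b → cong f (ℕₚ.+-∸-assoc 1 (ℕₚ.≤-trans j≤b (ℕₚ.m≤n⇒m≤1+n (ℕₚ.m≤n+m b a)))))) ⟨
    Σ[0≤k≤ suc a ] f + Σ[0≤k≤ b ] (λ j → f (suc (suc a ℕ.+ b) ∸ j)) ∎

-- Powers of the difference operator 1 + c Sˢ, where S is the shift g ↦ g ∘ suc

E : ℚ → ℕ → ℕ → (ℕ → ℚ) → ℕ → ℚ
E c s zero    g i = g i
E c s (suc r) g i = E c s r g i + c * E c s r g (s ℕ.+ i)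

-- The binomial theorem for the operator 1 + c Sˢ. Adding the vanishing term at r + 1 aligns the two
-- sums for Pascal's rule.
E-expand : ∀ c s r g i → E c s r g i ≡ Σ[0≤k≤ r ] (λ k → binom r k * (c ^ℚ k * g (k ℕ.* s ℕ.+ i)))
E-expand c s zero g i = lemma (g i)
  where
  lemma : ∀ x → x ≡ 1ℚ * (1ℚ * x)
  lemma = solve-∀ ℚ-ring
E-expand c s (suc r) g i = begin
  E c s r g i + c * E c s r g (s ℕ.+ i)
    ≡⟨ cong₂ (λ x y → x + c * y) (E-expand c s r g i) (E-expand c s r g (s ℕ.+ i)) ⟩
  Σ[0≤k≤ r ] T + c * Σ[0≤k≤ r ] (λ k → binom r k * (c ^ℚ k * g (k ℕ.* s ℕ.+ (s ℕ.+ i))))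
    ≡⟨ cong (λ x → Σ[0≤k≤ r ] T + x) (≡-trans (Σ-distribˡ r c _) (Σ-cong r shift)) ⟩
  Σ[0≤k≤ r ] T + Σ[0≤k≤ r ] U
    ≡⟨ cong (_+ Σ[0≤k≤ r ] U) (≡-sym (Σ-truncate r 1 T T-over)) ⟩
  Σ[0≤k≤ suc r ] T + Σ[0≤k≤ r ] U
    ≡⟨ cong (_+ Σ[0≤k≤ r ] U) (Σ-head r T) ⟩
  T 0 + Σ[0≤k≤ r ] (λ k → T (suc k)) + Σ[0≤k≤ r ] U
    ≡⟨ ℚₚ.+-assoc (T 0) (Σ[0≤k≤ r ] (λ k → T (suc k))) (Σ[0≤k≤ r ] U) ⟩
  T 0 + (Σ[0≤k≤ r ] (λ k → T (suc k)) + Σ[0≤k≤ r ] U)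
    ≡⟨ cong (λ x → T 0 + x) (Σ-+ r (λ k → T (suc k)) U) ⟨
  T 0 + Σ[0≤k≤ r ] (λ k → T (suc k) + U k)
    ≡⟨ cong₂ _+_ (cong (_* (1ℚ * g i)) (≡-trans (binom-zero r) (≡-sym (binom-zero (suc r)))))
                 (Σ-cong r (λ k _ → step k)) ⟩
  V 0 + Σ[0≤k≤ r ] (λ k → V (suc k))
    ≡⟨ Σ-head r V ⟨
  Σ[0≤k≤ suc r ] V ∎
  where
  open ≡-Reasoning
  T U V : ℕ → ℚ
  T k = binom r k * (c ^ℚ k * g (k ℕ.* s ℕ.+ i))
  U k = binom r k * (c ^ℚ suc k * g (suc k ℕ.* s ℕ.+ i))
  V k = binom (suc r) k * (c ^ℚ k * g (k ℕ.* s ℕ.+ i))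
  rearrange : ∀ c b x y → c * (b * (x * y)) ≡ b * (c * x * y)
  rearrange = solve-∀ ℚ-ring
  index : ∀ k → k ℕ.* s ℕ.+ (s ℕ.+ i) ≡ suc k ℕ.* s ℕ.+ i
  index k = ≡-trans (≡-sym (ℕₚ.+-assoc (k ℕ.* s) s i)) (cong (ℕ._+ i) (ℕₚ.+-comm (k ℕ.* s) s))
  shift : ∀ k → k ≤ r → c * (binom r k * (c ^ℚ k * g (k ℕ.* s ℕ.+ (s ℕ.+ i)))) ≡ U k
  shift k _ = ≡-trans (rearrange c (binom r k) (c ^ℚ k) (g (k ℕ.* s ℕ.+ (s ℕ.+ i))))
    (cong (λ t → binom r k * (c * c ^ℚ k * g t)) (index k))
  T-over : ∀ k → r < k → T k ≡ 0ℚ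
  T-over k r<k = ≡-trans (cong (_* (c ^ℚ k * g (k ℕ.* s ℕ.+ i))) (binom-over r<k)) (ℚₚ.*-zeroˡ (c ^ℚ k * g (k ℕ.* s ℕ.+ i)))
  step : ∀ k → T (suc k) + U k ≡ V (suc k)
  step k = begin
    binom r (suc k) * z + binom r k * z ≡⟨ ℚₚ.*-distribʳ-+ z (binom r (suc k)) (binom r k) ⟨
    (binom r (suc k) + binom r k) * z   ≡⟨ cong (_* z) (ℚₚ.+-comm (binom r (suc k)) (binom r k)) ⟩
    (binom r k + binom r (suc k)) * z   ≡⟨ cong (_* z) (pascal r k) ⟨
    binom (suc r) (suc k) * z           ∎
    where
    z : ℚ
    z = c ^ℚ suc k * g (suc k ℕ.* s ℕ.+ i)

-- Polynomials in S commute: a factor 1 + d S applied first may be moved to the outside.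
E-+-shift : ∀ c d r g i →
  E c 1 r (λ i → g i + d * g (suc i)) i ≡ E c 1 r g i + d * E c 1 r g (suc i)
E-+-shift c d zero    g i = refl
E-+-shift c d (suc r) g i = ≡-trans
  (cong₂ (λ x y → x + c * y) (E-+-shift c d r g i) (E-+-shift c d r g (suc i)))
  (lemma c d (E c 1 r g i) (E c 1 r g (suc i)) (E c 1 r g (suc (suc i))))
  where
  lemma : ∀ c d x y z → x + d * y + c * (y + d * z) ≡ x + c * y + d * (y + c * z)
  lemma = solve-∀ ℚ-ring

-- (1 - c S)(1 + c S) = 1 - c² S², used r times; commutation brings one factor of each kind together
-- at every step.
E-difference-of-squares : ∀ c r g i → E (- c) 1 r (E c 1 r g) i ≡ E (- (c * c)) 2 r g i
E-difference-of-squares c zero    g i = refl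
E-difference-of-squares c (suc r) g i = begin
  E (- c) 1 r (E c 1 (suc r) g) i + (- c) * E (- c) 1 r (E c 1 (suc r) g) (suc i)
    ≡⟨ cong₂ (λ x y → x + (- c) * y) (E-+-shift (- c) c r G i) (E-+-shift (- c) c r G (suc i)) ⟩
  X i + c * X (suc i) + (- c) * (X (suc i) + c * X (suc (suc i)))
    ≡⟨ lemma c (X i) (X (suc i)) (X (suc (suc i))) ⟩
  X i + (- (c * c)) * X (suc (suc i))
    ≡⟨ cong₂ (λ x y → x + (- (c * c)) * y) (E-difference-of-squares c r g i) (E-difference-of-squares c r g (suc (suc i))) ⟩
  E (- (c * c)) 2 (suc r) g i ∎
  where
  open ≡-Reasoning
  G X : ℕ → ℚ
  G = E c 1 r g
  X = E (- c) 1 r G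
  lemma : ∀ c x y z → x + c * y + (- c) * (y + c * z) ≡ x + (- (c * c)) * z
  lemma = solve-∀ ℚ-ring

-- The coefficient of x^(N - i) in Σ aₖ xᵏ, zero for i > N, so that the shift acts as multiplication by x.
down : (ℕ → ℚ) → ℕ → ℕ → ℚ
down a N       zero    = a N
down a zero    (suc i) = 0ℚ
down a (suc N) (suc i) = down a N i

down-≤ : ∀ a N i → i ≤ N → down a N i ≡ a (N ∸ i)
down-≤ a N       zero    _         = refl
down-≤ a (suc N) (suc i) (s≤s i≤N) = down-≤ a N i i≤N

down-> : ∀ a N i → N < i → down a N i ≡ 0ℚ
down-> a zero    (suc i) _         = refl
down-> a (suc N) (suc i) (s≤s N<i) = down-> a N i N<i

-- The hypotheses say that a = (1 + c x) b as power series, and on `down` multiplication by x is the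
-- shift.
down-step : ∀ c a b → a 0 ≡ b 0 → (∀ N → a (suc N) ≡ b (suc N) + c * b N) →
  ∀ N i → down a N i ≡ down b N i + c * down b N (suc i)
down-step c a b eq₀ eq zero    zero    = ≡-trans eq₀ (lemma (b 0) c)
  where
  lemma : ∀ x c → x ≡ x + c * 0ℚ
  lemma = solve-∀ ℚ-ring
down-step c a b eq₀ eq (suc N) zero    = eq N
down-step c a b eq₀ eq zero    (suc i) = lemma c
  where
  lemma : ∀ c → 0ℚ ≡ 0ℚ + c * 0ℚ
  lemma = solve-∀ ℚ-ring
down-step c a b eq₀ eq (suc N) (suc i) = down-step c a b eq₀ eq N i

-- (1 + x)^(r + y) = (1 + x)ʳ (1 + x)ʸ, one factor at a time by Pascal's rule.
down-binom : ∀ y r N i → down (binom (r ℕ.+ y)) N i ≡ E 1ℚ 1 r (down (binom y) N) i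
down-binom y zero    N i = refl
down-binom y (suc r) N i = ≡-trans
  (down-step 1ℚ (binom (suc r ℕ.+ y)) (binom (r ℕ.+ y))
    (≡-trans (binom-zero (suc r ℕ.+ y)) (≡-sym (binom-zero (r ℕ.+ y)))) step N i)
  (cong₂ (λ u v → u + 1ℚ * v) (down-binom y r N i) (down-binom y r N (suc i)))
  where
  lemma : ∀ u v → u + v ≡ v + 1ℚ * u
  lemma = solve-∀ ℚ-ring
  step : ∀ N → binom (suc r ℕ.+ y) (suc N) ≡ binom (r ℕ.+ y) (suc N) + 1ℚ * binom (r ℕ.+ y) N
  step N = ≡-trans (pascal (r ℕ.+ y) N) (lemma (binom (r ℕ.+ y) N) (binom (r ℕ.+ y) (suc N)))

-- The coefficients of (1 - x)^(-y-1).
negbinom : ℕ → ℕ → ℚ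
negbinom y k = binom (y ℕ.+ k) y

-- (1 - x)^(-y-1) = (1 - x)ʳ (1 - x)^(-r-y-1). Each factor 1 - x raises y by one, so the induction
-- hypothesis is taken at y + 1.
down-negbinom : ∀ y r N i → down (negbinom y) N i ≡ E m1 1 r (down (negbinom (r ℕ.+ y)) N) i
down-negbinom y zero    N i = refl
down-negbinom y (suc r) N i = begin
  down (negbinom y) N i
    ≡⟨ down-step m1 (negbinom y) (negbinom (suc y)) start step N i ⟩
  down (negbinom (suc y)) N i + m1 * down (negbinom (suc y)) N (suc i)
    ≡⟨ cong₂ (λ u v → u + m1 * v) (down-negbinom (suc y) r N i) (down-negbinom (suc y) r N (suc i)) ⟩
  E m1 1 (suc r) (down (negbinom (r ℕ.+ suc y)) N) i
    ≡⟨ cong (λ t → E m1 1 (suc r) (down (negbinom t) N) i) (ℕₚ.+-suc r y) ⟩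
  E m1 1 (suc r) (down (negbinom (suc r ℕ.+ y)) N) i ∎
  where
  open ≡-Reasoning
  start : negbinom y 0 ≡ negbinom (suc y) 0
  start rewrite ℕₚ.+-identityʳ y = ≡-trans (binom-diag y) (≡-sym (binom-diag (suc y)))
  lemma : ∀ u v → u ≡ u + v + m1 * v
  lemma = solve-∀ ℚ-ring
  step : ∀ N → negbinom y (suc N) ≡ negbinom (suc y) (suc N) + m1 * negbinom (suc y) N
  step N = begin
    binom (y ℕ.+ suc N) y
      ≡⟨ lemma (binom (y ℕ.+ suc N) y) (binom (y ℕ.+ suc N) (suc y)) ⟩
    binom (y ℕ.+ suc N) y + binom (y ℕ.+ suc N) (suc y) + m1 * binom (y ℕ.+ suc N) (suc y)
      ≡⟨ cong₂ (λ u t → u + m1 * binom t (suc y)) (≡-sym (pascal (y ℕ.+ suc N) y)) (ℕₚ.+-suc y N) ⟩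
    negbinom (suc y) (suc N) + m1 * negbinom (suc y) N ∎

-- Coefficients of the shifted Legendre polynomial and their reflection

trinomial-revision : ∀ j r i →
  binom (j ℕ.+ r) (j ℕ.+ i) * binom (j ℕ.+ i) j ≡ binom (j ℕ.+ r) j * binom r i
trinomial-revision zero    r i = ≡-trans (ℚₚ.*-comm (binom r i) (binom i 0))
  (cong (_* binom r i) (≡-trans (binom-zero i) (≡-sym (binom-zero r))))
trinomial-revision (suc j) r i = *-cancel-suc j (begin
  ⟦ suc j ⟧ * (A′ * B′)             ≡⟨ lemma₁ ⟦ suc j ⟧ A′ B′ ⟩
  A′ * (⟦ suc j ⟧ * B′)             ≡⟨ cong (A′ *_) (absorption (j ℕ.+ i) j) ⟩
  A′ * (⟦ suc (j ℕ.+ i) ⟧ * b)      ≡⟨ lemma₂ ⟦ suc (j ℕ.+ i) ⟧ A′ b ⟩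
  ⟦ suc (j ℕ.+ i) ⟧ * A′ * b        ≡⟨ cong (_* b) (absorption (j ℕ.+ r) (j ℕ.+ i)) ⟩
  ⟦ suc (j ℕ.+ r) ⟧ * a * b         ≡⟨ ℚₚ.*-assoc ⟦ suc (j ℕ.+ r) ⟧ a b ⟩
  ⟦ suc (j ℕ.+ r) ⟧ * (a * b)       ≡⟨ cong (⟦ suc (j ℕ.+ r) ⟧ *_) (trinomial-revision j r i) ⟩
  ⟦ suc (j ℕ.+ r) ⟧ * (c * d)       ≡⟨ ℚₚ.*-assoc ⟦ suc (j ℕ.+ r) ⟧ c d ⟨
  ⟦ suc (j ℕ.+ r) ⟧ * c * d         ≡⟨ cong (_* d) (absorption (j ℕ.+ r) j) ⟨
  ⟦ suc j ⟧ * C′ * d                ≡⟨ ℚₚ.*-assoc ⟦ suc j ⟧ C′ d ⟩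
  ⟦ suc j ⟧ * (C′ * d)              ∎)
  where
  open ≡-Reasoning
  A′ B′ C′ a b c d : ℚ
  A′ = binom (suc (j ℕ.+ r)) (suc (j ℕ.+ i))
  B′ = binom (suc (j ℕ.+ i)) (suc j)
  C′ = binom (suc (j ℕ.+ r)) (suc j)
  a = binom (j ℕ.+ r) (j ℕ.+ i)
  b = binom (j ℕ.+ i) j
  c = binom (j ℕ.+ r) j
  d = binom r i
  lemma₁ : ∀ x y z → x * (y * z) ≡ y * (x * z)
  lemma₁ = solve-∀ ℚ-ring
  lemma₂ : ∀ x y z → y * (x * z) ≡ x * y * z
  lemma₂ = solve-∀ ℚ-ring

-- By Pascal's rule each factor 1 - S decreases the lower index by one and changes the sign.
E-binom : ∀ M s r i → E m1 1 r (λ i → binom (M ℕ.+ i) (r ℕ.+ s)) i ≡ m1 ^ℚ r * binom (M ℕ.+ i) s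
E-binom M s zero    i = ≡-sym (ℚₚ.*-identityˡ (binom (M ℕ.+ i) s))
E-binom M s (suc r) i = begin
  E m1 1 (suc r) (λ i → binom (M ℕ.+ i) (suc r ℕ.+ s)) i
    ≡⟨ cong (λ t → E m1 1 (suc r) (λ i → binom (M ℕ.+ i) t) i) (ℕₚ.+-suc r s) ⟨
  E m1 1 (suc r) (λ i → binom (M ℕ.+ i) (r ℕ.+ suc s)) i
    ≡⟨ cong₂ (λ x y → x + m1 * y) (E-binom M (suc s) r i) (E-binom M (suc s) r (suc i)) ⟩
  m1 ^ℚ r * binom (M ℕ.+ i) (suc s) + m1 * (m1 ^ℚ r * binom (M ℕ.+ suc i) (suc s))
    ≡⟨ cong (λ t → m1 ^ℚ r * binom (M ℕ.+ i) (suc s) + m1 * (m1 ^ℚ r * t))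
         (≡-trans (cong (λ t → binom t (suc s)) (ℕₚ.+-suc M i)) (pascal (M ℕ.+ i) s)) ⟩
  m1 ^ℚ r * binom (M ℕ.+ i) (suc s) + m1 * (m1 ^ℚ r * (binom (M ℕ.+ i) s + binom (M ℕ.+ i) (suc s)))
    ≡⟨ lemma (m1 ^ℚ r) (binom (M ℕ.+ i) s) (binom (M ℕ.+ i) (suc s)) ⟩
  m1 ^ℚ suc r * binom (M ℕ.+ i) s ∎
  where
  open ≡-Reasoning
  lemma : ∀ x a b → x * b + m1 * (x * (a + b)) ≡ m1 * x * a
  lemma = solve-∀ ℚ-ring

-- The coefficients of the shifted Legendre polynomial: Σ F n k xᵏ = Pₙ(1 + 2x).
F : ℕ → ℕ → ℚ
F n k = binom n k * negbinom n k

F-over : ∀ {n k} → n < k → F n k ≡ 0ℚ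
F-over {n} {k} n<k = ≡-trans (cong (_* negbinom n k) (binom-over n<k)) (ℚₚ.*-zeroˡ (negbinom n k))

negbinom-suc : ∀ n k → ⟦ suc k ⟧ * negbinom n (suc k) ≡ ⟦ suc (n ℕ.+ k) ⟧ * negbinom n k
negbinom-suc n k = begin
  ⟦ suc k ⟧ * binom (n ℕ.+ suc k) n                     ≡⟨ cong (λ t → ⟦ suc k ⟧ * binom t n) (ℕₚ.+-suc n k) ⟩
  ⟦ suc k ⟧ * binom (suc (n ℕ.+ k)) n                   ≡⟨ cong (_* binom (suc (n ℕ.+ k)) n) difference ⟨
  (⟦ suc (n ℕ.+ k) ⟧ - ⟦ n ⟧) * binom (suc (n ℕ.+ k)) n ≡⟨ binom-upper (n ℕ.+ k) n ⟩
  ⟦ suc (n ℕ.+ k) ⟧ * binom (n ℕ.+ k) n                 ∎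
  where
  open ≡-Reasoning
  difference : ⟦ suc (n ℕ.+ k) ⟧ - ⟦ n ⟧ ≡ ⟦ suc k ⟧
  difference = ≡-trans (≡-sym (⟦⟧-∸ (ℕₚ.m≤n⇒m≤1+n (ℕₚ.m≤m+n n k))))
    (cong ⟦_⟧ (≡-trans (cong (_∸ n) (≡-sym (ℕₚ.+-suc n k))) (ℕₚ.m+n∸m≡n n (suc k))))

F-suc : ∀ n k → ⟦ suc k ⟧ * ⟦ suc k ⟧ * F n (suc k) ≡ (⟦ n ⟧ - ⟦ k ⟧) * ⟦ suc (n ℕ.+ k) ⟧ * F n k
F-suc n k = begin
  ⟦ suc k ⟧ * ⟦ suc k ⟧ * (binom n (suc k) * negbinom n (suc k))
    ≡⟨ interchange ⟦ suc k ⟧ ⟦ suc k ⟧ (binom n (suc k)) (negbinom n (suc k)) ⟩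
  (⟦ suc k ⟧ * binom n (suc k)) * (⟦ suc k ⟧ * negbinom n (suc k))
    ≡⟨ cong₂ _*_ (binom-lower n k) (negbinom-suc n k) ⟩
  ((⟦ n ⟧ - ⟦ k ⟧) * binom n k) * (⟦ suc (n ℕ.+ k) ⟧ * negbinom n k)
    ≡⟨ interchange (⟦ n ⟧ - ⟦ k ⟧) ⟦ suc (n ℕ.+ k) ⟧ (binom n k) (negbinom n k) ⟨
  (⟦ n ⟧ - ⟦ k ⟧) * ⟦ suc (n ℕ.+ k) ⟧ * F n k ∎
  where
  open ≡-Reasoning
  interchange : ∀ x y z w → x * y * (z * w) ≡ (x * z) * (y * w)
  interchange = solve-∀ ℚ-ring

-- The left side is the coefficient of xʲ in Q(-1 - x), where Q(x) = Pₙ(1 + 2x). Trinomial revision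
-- takes C(n,j) out of the sum, and what remains is an r-th difference of binomial coefficients.
Σ-F-binom : ∀ j r → let n = j ℕ.+ r in
  Σ[0≤k≤ n ] (λ k → m1 ^ℚ k * F n k * binom k j) ≡ m1 ^ℚ n * F n j
Σ-F-binom j r = begin
  Σ[0≤k≤ n ] (λ k → m1 ^ℚ k * F n k * binom k j)
    ≡⟨ Σ-drop j r _ (λ k k<j → ≡-trans (cong (λ t → m1 ^ℚ k * F n k * t) (binom-over k<j)) (ℚₚ.*-zeroʳ (m1 ^ℚ k * F n k))) ⟩
  Σ[0≤k≤ r ] (λ i → m1 ^ℚ (j ℕ.+ i) * F n (j ℕ.+ i) * binom (j ℕ.+ i) j)
    ≡⟨ Σ-cong r (λ i _ → term i) ⟩
  Σ[0≤k≤ r ] (λ i → m1 ^ℚ j * binom n j * (binom r i * (m1 ^ℚ i * binom (n ℕ.+ (i ℕ.* 1 ℕ.+ j)) (r ℕ.+ j))))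
    ≡⟨ Σ-distribˡ r (m1 ^ℚ j * binom n j) _ ⟨
  m1 ^ℚ j * binom n j * Σ[0≤k≤ r ] (λ i → binom r i * (m1 ^ℚ i * binom (n ℕ.+ (i ℕ.* 1 ℕ.+ j)) (r ℕ.+ j)))
    ≡⟨ cong (m1 ^ℚ j * binom n j *_) (E-expand m1 1 r (λ i → binom (n ℕ.+ i) (r ℕ.+ j)) j) ⟨
  m1 ^ℚ j * binom n j * E m1 1 r (λ i → binom (n ℕ.+ i) (r ℕ.+ j)) j
    ≡⟨ cong (m1 ^ℚ j * binom n j *_) (E-binom n j r j) ⟩
  m1 ^ℚ j * binom n j * (m1 ^ℚ r * binom (n ℕ.+ j) j)
    ≡⟨ interchange (m1 ^ℚ j) (binom n j) (m1 ^ℚ r) (binom (n ℕ.+ j) j) ⟩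
  m1 ^ℚ j * m1 ^ℚ r * (binom n j * binom (n ℕ.+ j) j)
    ≡⟨ cong₂ (λ x y → x * (binom n j * y)) (^ℚ-+ m1 j r) (binom-sym-+ n j) ⟨
  m1 ^ℚ n * F n j ∎
  where
  open ≡-Reasoning
  n : ℕ
  n = j ℕ.+ r
  interchange : ∀ x y z w → x * y * (z * w) ≡ x * z * (y * w)
  interchange = solve-∀ ℚ-ring
  lemma₁ : ∀ x y z w → x * (y * z) * w ≡ x * (y * w) * z
  lemma₁ = solve-∀ ℚ-ring
  lemma₂ : ∀ x y z u v → x * y * (z * u) * v ≡ x * z * (u * (y * v))
  lemma₂ = solve-∀ ℚ-ring
  term : ∀ i → m1 ^ℚ (j ℕ.+ i) * F n (j ℕ.+ i) * binom (j ℕ.+ i) j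
    ≡ m1 ^ℚ j * binom n j * (binom r i * (m1 ^ℚ i * binom (n ℕ.+ (i ℕ.* 1 ℕ.+ j)) (r ℕ.+ j)))
  term i = begin
    m1 ^ℚ (j ℕ.+ i) * (binom n (j ℕ.+ i) * negbinom n (j ℕ.+ i)) * binom (j ℕ.+ i) j
      ≡⟨ lemma₁ (m1 ^ℚ (j ℕ.+ i)) (binom n (j ℕ.+ i)) (negbinom n (j ℕ.+ i)) (binom (j ℕ.+ i) j) ⟩
    m1 ^ℚ (j ℕ.+ i) * (binom n (j ℕ.+ i) * binom (j ℕ.+ i) j) * negbinom n (j ℕ.+ i)
      ≡⟨ cong₂ (λ x y → x * y * negbinom n (j ℕ.+ i)) (^ℚ-+ m1 j i) (trinomial-revision j r i) ⟩
    m1 ^ℚ j * m1 ^ℚ i * (binom n j * binom r i) * binom (n ℕ.+ (j ℕ.+ i)) n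
      ≡⟨ lemma₂ (m1 ^ℚ j) (m1 ^ℚ i) (binom n j) (binom r i) (binom (n ℕ.+ (j ℕ.+ i)) n) ⟩
    m1 ^ℚ j * binom n j * (binom r i * (m1 ^ℚ i * binom (n ℕ.+ (j ℕ.+ i)) n))
      ≡⟨ cong₂ (λ s t → m1 ^ℚ j * binom n j * (binom r i * (m1 ^ℚ i * binom (n ℕ.+ s) t)))
           (≡-trans (ℕₚ.+-comm j i) (cong (ℕ._+ j) (≡-sym (ℕₚ.*-identityʳ i)))) (ℕₚ.+-comm j r) ⟩
    m1 ^ℚ j * binom n j * (binom r i * (m1 ^ℚ i * binom (n ℕ.+ (i ℕ.* 1 ℕ.+ j)) (r ℕ.+ j))) ∎

-- If f k is the value of a linear functional on xᵏ, this is its value on (1 + x)ᵏ.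
binomialTransform : (ℕ → ℚ) → ℕ → ℚ
binomialTransform f k = E 1ℚ 1 k f 0

binomialTransform-Σ : ∀ f k n → k ≤ n → binomialTransform f k ≡ Σ[0≤k≤ n ] (λ j → binom k j * f j)
binomialTransform-Σ f k n k≤n = begin
  E 1ℚ 1 k f 0
    ≡⟨ E-expand 1ℚ 1 k f 0 ⟩
  Σ[0≤k≤ k ] (λ j → binom k j * (1ℚ ^ℚ j * f (j ℕ.* 1 ℕ.+ 0)))
    ≡⟨ Σ-cong k (λ j _ → cong (binom k j *_) (≡-trans (cong₂ (λ u v → u * f v) (1^ℚ j)
         (≡-trans (ℕₚ.+-identityʳ (j ℕ.* 1)) (ℕₚ.*-identityʳ j))) (ℚₚ.*-identityˡ (f j)))) ⟩
  Σ[0≤k≤ k ] (λ j → binom k j * f j)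
    ≡⟨ Σ-truncate k (n ∸ k) (λ j → binom k j * f j) (λ j k<j → ≡-trans (cong (_* f j) (binom-over k<j)) (ℚₚ.*-zeroˡ (f j))) ⟨
  Σ[0≤k≤ n ∸ k ℕ.+ k ] (λ j → binom k j * f j)
    ≡⟨ cong (λ t → Σ[0≤k≤ t ] (λ j → binom k j * f j)) (ℕₚ.m∸n+n≡m k≤n) ⟩
  Σ[0≤k≤ n ] (λ j → binom k j * f j) ∎
  where open ≡-Reasoning

-- The reflection Pₙ(-x) = (-1)ⁿ Pₙ(x), as a statement about linear functionals on polynomials.
reflection : ∀ n f →
  Σ[0≤k≤ n ] (λ k → m1 ^ℚ k * F n k * binomialTransform f k) ≡ m1 ^ℚ n * Σ[0≤k≤ n ] (λ j → F n j * f j)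
reflection n f = begin
  Σ[0≤k≤ n ] (λ k → m1 ^ℚ k * F n k * binomialTransform f k)
    ≡⟨ Σ-cong n (λ k k≤n → ≡-trans (cong (m1 ^ℚ k * F n k *_) (binomialTransform-Σ f k n k≤n)) (Σ-distribˡ n (m1 ^ℚ k * F n k) _)) ⟩
  Σ[0≤k≤ n ] (λ k → Σ[0≤k≤ n ] (λ j → m1 ^ℚ k * F n k * (binom k j * f j)))
    ≡⟨ Σ-swap n n _ ⟩
  Σ[0≤k≤ n ] (λ j → Σ[0≤k≤ n ] (λ k → m1 ^ℚ k * F n k * (binom k j * f j)))
    ≡⟨ Σ-cong n inner ⟩
  Σ[0≤k≤ n ] (λ j → m1 ^ℚ n * (F n j * f j))
    ≡⟨ Σ-distribˡ n (m1 ^ℚ n) _ ⟨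
  m1 ^ℚ n * Σ[0≤k≤ n ] (λ j → F n j * f j) ∎
  where
  open ≡-Reasoning
  lemma₁ : ∀ x y z → x * (y * z) ≡ z * (x * y)
  lemma₁ = solve-∀ ℚ-ring
  lemma₂ : ∀ x y z → z * (x * y) ≡ x * (y * z)
  lemma₂ = solve-∀ ℚ-ring
  column : ∀ j → j ≤ n → Σ[0≤k≤ n ] (λ k → m1 ^ℚ k * F n k * binom k j) ≡ m1 ^ℚ n * F n j
  column j j≤n = subst (λ n → Σ[0≤k≤ n ] (λ k → m1 ^ℚ k * F n k * binom k j) ≡ m1 ^ℚ n * F n j)
    (ℕₚ.m+[n∸m]≡n j≤n) (Σ-F-binom j (n ∸ j))
  inner : ∀ j → j ≤ n → Σ[0≤k≤ n ] (λ k → m1 ^ℚ k * F n k * (binom k j * f j)) ≡ m1 ^ℚ n * (F n j * f j)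
  inner j j≤n = begin
    Σ[0≤k≤ n ] (λ k → m1 ^ℚ k * F n k * (binom k j * f j))
      ≡⟨ Σ-cong n (λ k _ → lemma₁ (m1 ^ℚ k * F n k) (binom k j) (f j)) ⟩
    Σ[0≤k≤ n ] (λ k → f j * (m1 ^ℚ k * F n k * binom k j))
      ≡⟨ Σ-distribˡ n (f j) _ ⟨
    f j * Σ[0≤k≤ n ] (λ k → m1 ^ℚ k * F n k * binom k j)
      ≡⟨ cong (f j *_) (column j j≤n) ⟩
    f j * (m1 ^ℚ n * F n j)
      ≡⟨ lemma₂ (m1 ^ℚ n) (F n j) (f j) ⟩
    m1 ^ℚ n * (F n j * f j) ∎

E-power : ∀ x k i → E 1ℚ 1 k (x ^ℚ_) i ≡ x ^ℚ i * (1ℚ + x) ^ℚ k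
E-power x zero    i = ≡-sym (ℚₚ.*-identityʳ (x ^ℚ i))
E-power x (suc k) i = ≡-trans (cong₂ (λ u v → u + 1ℚ * v) (E-power x k i) (E-power x k (suc i)))
  (lemma x (x ^ℚ i) ((1ℚ + x) ^ℚ k))
  where
  lemma : ∀ x y z → y * z + 1ℚ * (x * y * z) ≡ y * ((1ℚ + x) * z)
  lemma = solve-∀ ℚ-ring

binomialTransform-power : ∀ x k → binomialTransform (x ^ℚ_) k ≡ (1ℚ + x) ^ℚ k
binomialTransform-power x k = ≡-trans (E-power x k 0) (ℚₚ.*-identityˡ ((1ℚ + x) ^ℚ k))

-- The derivative of xⁱ (1 + x)ᵏ at 1 is (k + 2i) 2ᵏ⁻¹; doubling avoids the exponent k - 1. The
-- induction on k shifts i, hence the general i.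
E-id : ∀ k i → ⟦ 2 ⟧ * E 1ℚ 1 k ⟦_⟧ i ≡ (⟦ k ⟧ + ⟦ 2 ⟧ * ⟦ i ⟧) * ⟦ 2 ⟧ ^ℚ k
E-id zero    i = lemma ⟦ i ⟧
  where
  lemma : ∀ x → ⟦ 2 ⟧ * x ≡ (0ℚ + ⟦ 2 ⟧ * x) * 1ℚ
  lemma = solve-∀ ℚ-ring
E-id (suc k) i = begin
  ⟦ 2 ⟧ * (x + 1ℚ * y)                                        ≡⟨ lemma₁ x y ⟩
  ⟦ 2 ⟧ * x + ⟦ 2 ⟧ * y                                       ≡⟨ cong₂ _+_ (E-id k i) (E-id k (suc i)) ⟩
  (⟦ k ⟧ + ⟦ 2 ⟧ * ⟦ i ⟧) * z + (⟦ k ⟧ + ⟦ 2 ⟧ * ⟦ suc i ⟧) * z ≡⟨ cong (λ t → (⟦ k ⟧ + ⟦ 2 ⟧ * ⟦ i ⟧) * z + (⟦ k ⟧ + ⟦ 2 ⟧ * t) * z) (⟦⟧-suc i) ⟩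
  (⟦ k ⟧ + ⟦ 2 ⟧ * ⟦ i ⟧) * z + (⟦ k ⟧ + ⟦ 2 ⟧ * (1ℚ + ⟦ i ⟧)) * z ≡⟨ lemma₂ ⟦ k ⟧ ⟦ i ⟧ z ⟩
  (1ℚ + ⟦ k ⟧ + ⟦ 2 ⟧ * ⟦ i ⟧) * (⟦ 2 ⟧ * z)                  ≡⟨ cong (λ t → (t + ⟦ 2 ⟧ * ⟦ i ⟧) * (⟦ 2 ⟧ * z)) (⟦⟧-suc k) ⟨
  (⟦ suc k ⟧ + ⟦ 2 ⟧ * ⟦ i ⟧) * (⟦ 2 ⟧ * z)                   ∎
  where
  open ≡-Reasoning
  x y z : ℚ
  x = E 1ℚ 1 k ⟦_⟧ i
  y = E 1ℚ 1 k ⟦_⟧ (suc i)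
  z = ⟦ 2 ⟧ ^ℚ k
  lemma₁ : ∀ x y → ⟦ 2 ⟧ * (x + 1ℚ * y) ≡ ⟦ 2 ⟧ * x + ⟦ 2 ⟧ * y
  lemma₁ = solve-∀ ℚ-ring
  lemma₂ : ∀ k i z → (k + ⟦ 2 ⟧ * i) * z + (k + ⟦ 2 ⟧ * (1ℚ + i)) * z ≡ (1ℚ + k + ⟦ 2 ⟧ * i) * (⟦ 2 ⟧ * z)
  lemma₂ = solve-∀ ℚ-ring

binomialTransform-id : ∀ k → ⟦ 2 ⟧ * binomialTransform ⟦_⟧ k ≡ ⟦ k ⟧ * ⟦ 2 ⟧ ^ℚ k
binomialTransform-id k = ≡-trans (E-id k 0) (cong (_* ⟦ 2 ⟧ ^ℚ k) (lemma ⟦ k ⟧))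
  where
  lemma : ∀ x → x + ⟦ 2 ⟧ * ⟦ 0 ⟧ ≡ x
  lemma = solve-∀ ℚ-ring

-- x times the functional is integration over [0, x], since x · xʲ / (j + 1) is the integral of tʲ.
-- The right side is k + 1 times the integral of (1 + t)ᵏ.
binomialTransform-recip : ∀ x k →
  ⟦ suc k ⟧ * (x * binomialTransform (λ j → recip (suc j) * x ^ℚ j) k) ≡ (1ℚ + x) ^ℚ suc k - 1ℚ
binomialTransform-recip x k = begin
  ⟦ suc k ⟧ * (x * binomialTransform f k)
    ≡⟨ cong (λ t → ⟦ suc k ⟧ * (x * t)) (binomialTransform-Σ f k k ℕₚ.≤-refl) ⟩
  ⟦ suc k ⟧ * (x * Σ[0≤k≤ k ] (λ j → binom k j * f j))
    ≡⟨ ℚₚ.*-assoc ⟦ suc k ⟧ x (Σ[0≤k≤ k ] (λ j → binom k j * f j)) ⟨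
  ⟦ suc k ⟧ * x * Σ[0≤k≤ k ] (λ j → binom k j * f j)
    ≡⟨ Σ-distribˡ k (⟦ suc k ⟧ * x) _ ⟩
  Σ[0≤k≤ k ] (λ j → ⟦ suc k ⟧ * x * (binom k j * f j))
    ≡⟨ Σ-cong k (λ j _ → term j) ⟩
  Σ[0≤k≤ k ] (λ j → binom (suc k) (suc j) * x ^ℚ suc j)
    ≡⟨ lemma₀ (Σ[0≤k≤ k ] (λ j → binom (suc k) (suc j) * x ^ℚ suc j)) ⟩
  1ℚ * 1ℚ + Σ[0≤k≤ k ] (λ j → binom (suc k) (suc j) * x ^ℚ suc j) - 1ℚ
    ≡⟨ cong (λ t → t * 1ℚ + Σ[0≤k≤ k ] (λ j → binom (suc k) (suc j) * x ^ℚ suc j) - 1ℚ) (binom-zero (suc k)) ⟨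
  binom (suc k) 0 * 1ℚ + Σ[0≤k≤ k ] (λ j → binom (suc k) (suc j) * x ^ℚ suc j) - 1ℚ
    ≡⟨ cong (_- 1ℚ) (Σ-head k (λ j → binom (suc k) j * x ^ℚ j)) ⟨
  Σ[0≤k≤ suc k ] (λ j → binom (suc k) j * x ^ℚ j) - 1ℚ
    ≡⟨ cong (_- 1ℚ) (binomialTransform-Σ (x ^ℚ_) (suc k) (suc k) ℕₚ.≤-refl) ⟨
  binomialTransform (x ^ℚ_) (suc k) - 1ℚ
    ≡⟨ cong (_- 1ℚ) (binomialTransform-power x (suc k)) ⟩
  (1ℚ + x) ^ℚ suc k - 1ℚ ∎
  where
  open ≡-Reasoning
  f : ℕ → ℚ
  f j = recip (suc j) * x ^ℚ j
  lemma₀ : ∀ s → s ≡ 1ℚ * 1ℚ + s - 1ℚ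
  lemma₀ = solve-∀ ℚ-ring
  lemma₁ : ∀ s x b r y → s * x * (b * (r * y)) ≡ s * b * r * (x * y)
  lemma₁ = solve-∀ ℚ-ring
  lemma₂ : ∀ t b r y → t * b * r * y ≡ t * r * (b * y)
  lemma₂ = solve-∀ ℚ-ring
  term : ∀ j → ⟦ suc k ⟧ * x * (binom k j * f j) ≡ binom (suc k) (suc j) * x ^ℚ suc j
  term j = begin
    ⟦ suc k ⟧ * x * (binom k j * (recip (suc j) * x ^ℚ j))
      ≡⟨ lemma₁ ⟦ suc k ⟧ x (binom k j) (recip (suc j)) (x ^ℚ j) ⟩
    ⟦ suc k ⟧ * binom k j * recip (suc j) * x ^ℚ suc j
      ≡⟨ cong (λ t → t * recip (suc j) * x ^ℚ suc j) (absorption k j) ⟨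
    ⟦ suc j ⟧ * binom (suc k) (suc j) * recip (suc j) * x ^ℚ suc j
      ≡⟨ lemma₂ ⟦ suc j ⟧ (binom (suc k) (suc j)) (recip (suc j)) (x ^ℚ suc j) ⟩
    ⟦ suc j ⟧ * recip (suc j) * (binom (suc k) (suc j) * x ^ℚ suc j)
      ≡⟨ cong (_* (binom (suc k) (suc j) * x ^ℚ suc j)) (recip-inverse j) ⟩
    1ℚ * (binom (suc k) (suc j) * x ^ℚ suc j)
      ≡⟨ ℚₚ.*-identityˡ (binom (suc k) (suc j) * x ^ℚ suc j) ⟩
    binom (suc k) (suc j) * x ^ℚ suc j ∎

-- The coefficient of xʳ in (1 - x)ʳ (1 + x)ʳ⁺¹ = (1 - x²)ʳ (1 + x).
Σ-alternating-adjacent : ∀ m r → m ℕ.* 2 ≤ r → r ≤ suc (m ℕ.* 2) →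
  Σ[0≤k≤ r ] (λ k → binom r k * (m1 ^ℚ k * binom (suc r) (suc k))) ≡ binom r m * m1 ^ℚ m
Σ-alternating-adjacent m r 2m≤r r≤2m+1 = begin
  Σ[0≤k≤ r ] (λ k → binom r k * (m1 ^ℚ k * binom (suc r) (suc k)))
    ≡⟨ Σ-cong r (λ k k≤r → cong (λ t → binom r k * (m1 ^ℚ k * t)) (entry k k≤r)) ⟩
  Σ[0≤k≤ r ] (λ k → binom r k * (m1 ^ℚ k * E 1ℚ 1 r (down (binom 1) r) (k ℕ.* 1 ℕ.+ 0)))
    ≡⟨ E-expand m1 1 r (E 1ℚ 1 r (down (binom 1) r)) 0 ⟨
  E m1 1 r (E 1ℚ 1 r (down (binom 1) r)) 0
    ≡⟨ E-difference-of-squares 1ℚ r (down (binom 1) r) 0 ⟩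
  E m1 2 r (down (binom 1) r) 0
    ≡⟨ E-expand m1 2 r (down (binom 1) r) 0 ⟩
  Σ[0≤k≤ r ] T
    -- The coefficient of x^(r - 2k) in 1 + x is nonzero only for r - 2k equal to 0 or 1, and the
    -- bounds on r then force k = m.
    ≡⟨ Σ-single r m T (ℕₚ.≤-trans (ℕₚ.m≤m*n m 2) 2m≤r) (λ k k≢m → ≡-trans (cong (λ t → binom r k * (m1 ^ℚ k * t)) (off k k≢m)) (lemma₀ (binom r k) (m1 ^ℚ k))) ⟩
  T m
    ≡⟨ cong (λ t → binom r m * (m1 ^ℚ m * t)) on ⟩
  binom r m * (m1 ^ℚ m * 1ℚ)
    ≡⟨ cong (binom r m *_) (ℚₚ.*-identityʳ (m1 ^ℚ m)) ⟩
  binom r m * m1 ^ℚ m ∎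
  where
  open ≡-Reasoning
  T : ℕ → ℚ
  T k = binom r k * (m1 ^ℚ k * down (binom 1) r (k ℕ.* 2 ℕ.+ 0))
  lemma₀ : ∀ x y → x * (y * 0ℚ) ≡ 0ℚ
  lemma₀ = solve-∀ ℚ-ring
  entry : ∀ k → k ≤ r → binom (suc r) (suc k) ≡ E 1ℚ 1 r (down (binom 1) r) (k ℕ.* 1 ℕ.+ 0)
  entry k k≤r = begin
    binom (suc r) (suc k)                        ≡⟨ binom-sym (s≤s k≤r) ⟩
    binom (suc r) (r ∸ k)                        ≡⟨ down-≤ (binom (suc r)) r k k≤r ⟨
    down (binom (suc r)) r k                     ≡⟨ cong (λ t → down (binom t) r k) (ℕₚ.+-comm 1 r) ⟩
    down (binom (r ℕ.+ 1)) r k                   ≡⟨ down-binom 1 r r k ⟩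
    E 1ℚ 1 r (down (binom 1) r) k                ≡⟨ cong (E 1ℚ 1 r (down (binom 1) r)) (≡-trans (ℕₚ.+-identityʳ (k ℕ.* 1)) (ℕₚ.*-identityʳ k)) ⟨
    E 1ℚ 1 r (down (binom 1) r) (k ℕ.* 1 ℕ.+ 0)  ∎
  at : ∀ k → k ℕ.* 2 ≤ r → down (binom 1) r (k ℕ.* 2 ℕ.+ 0) ≡ binom 1 (r ∸ k ℕ.* 2)
  at k 2k≤r = ≡-trans (cong (down (binom 1) r) (ℕₚ.+-identityʳ (k ℕ.* 2))) (down-≤ (binom 1) r (k ℕ.* 2) 2k≤r)
  small : ∀ t → t ≤ 1 → binom 1 t ≡ 1ℚ
  small zero          _ = refl
  small (suc zero)    _ = refl
  small (suc (suc t)) (s≤s ())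
  on : down (binom 1) r (m ℕ.* 2 ℕ.+ 0) ≡ 1ℚ
  on = ≡-trans (at m 2m≤r) (small (r ∸ m ℕ.* 2) (ℕₚ.m≤n+o⇒m∸n≤o r (m ℕ.* 2) (subst (r ≤_) (ℕₚ.+-comm 1 (m ℕ.* 2)) r≤2m+1)))
  off : ∀ k → k ≢ m → down (binom 1) r (k ℕ.* 2 ℕ.+ 0) ≡ 0ℚ
  off k k≢m with ℕₚ.<-cmp k m
  ... | tri≈ _ k≡m _ = contradiction k≡m k≢m
  ... | tri< k<m _ _ = ≡-trans (at k (ℕₚ.≤-trans (ℕₚ.m≤n+m (k ℕ.* 2) 2) 2k+2≤r))
    (binom-over (ℕₚ.m+n≤o⇒m≤o∸n 2 2k+2≤r))
    where
    2k+2≤r : 2 ℕ.+ k ℕ.* 2 ≤ r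
    2k+2≤r = ℕₚ.≤-trans (ℕₚ.*-monoˡ-≤ 2 k<m) 2m≤r
  ... | tri> _ _ m<k = down-> (binom 1) r (k ℕ.* 2 ℕ.+ 0)
    (subst (r <_) (≡-sym (ℕₚ.+-identityʳ (k ℕ.* 2))) (ℕₚ.≤-trans (s≤s r≤2m+1) (ℕₚ.*-monoˡ-≤ 2 m<k)))

-- Σₖ F n k is the coefficient of xⁿ in (1 + x)ⁿ (1 - x)⁻ⁿ⁻¹ = (1 - x²)ⁿ (1 - x)⁻²ⁿ⁻¹.
Σ-F : ∀ n → Σ[0≤k≤ n ] (F n) ≡
  Σ[0≤k≤ n ] (λ j → binom n j * (m1 ^ℚ j * down (negbinom (n ℕ.+ n)) n (j ℕ.* 2 ℕ.+ 0)))
Σ-F n = begin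
  Σ[0≤k≤ n ] (F n)
    ≡⟨ Σ-reverse n (F n) ⟩
  Σ[0≤k≤ n ] (λ i → F n (n ∸ i))
    ≡⟨ Σ-cong n entry ⟩
  Σ[0≤k≤ n ] (λ i → binom n i * (1ℚ ^ℚ i * G (i ℕ.* 1 ℕ.+ 0)))
    ≡⟨ E-expand 1ℚ 1 n G 0 ⟨
  E 1ℚ 1 n G 0
    -- Taken at c = -1, so that the outer operator is 1 + S and the inner one 1 - S.
    ≡⟨ E-difference-of-squares m1 n (down (negbinom (n ℕ.+ n)) n) 0 ⟩
  E m1 2 n (down (negbinom (n ℕ.+ n)) n) 0
    ≡⟨ E-expand m1 2 n (down (negbinom (n ℕ.+ n)) n) 0 ⟩
  Σ[0≤k≤ n ] (λ j → binom n j * (m1 ^ℚ j * down (negbinom (n ℕ.+ n)) n (j ℕ.* 2 ℕ.+ 0))) ∎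
  where
  open ≡-Reasoning
  G : ℕ → ℚ
  G = E m1 1 n (down (negbinom (n ℕ.+ n)) n)
  entry : ∀ i → i ≤ n → F n (n ∸ i) ≡ binom n i * (1ℚ ^ℚ i * G (i ℕ.* 1 ℕ.+ 0))
  entry i i≤n = cong₂ _*_ (≡-sym (binom-sym i≤n)) (begin
    negbinom n (n ∸ i)             ≡⟨ down-≤ (negbinom n) n i i≤n ⟨
    down (negbinom n) n i          ≡⟨ down-negbinom n n n i ⟩
    G i                            ≡⟨ cong G (≡-trans (ℕₚ.+-identityʳ (i ℕ.* 1)) (ℕₚ.*-identityʳ i)) ⟨
    G (i ℕ.* 1 ℕ.+ 0)              ≡⟨ ℚₚ.*-identityˡ (G (i ℕ.* 1 ℕ.+ 0)) ⟨
    1ℚ * G (i ℕ.* 1 ℕ.+ 0)         ≡⟨ cong (_* G (i ℕ.* 1 ℕ.+ 0)) (1^ℚ i) ⟨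
    1ℚ ^ℚ i * G (i ℕ.* 1 ℕ.+ 0)    ∎)

m2 : ℚ
m2 = - ⟦ 2 ⟧

-- Partial fractions

-- The product x (x - 2) ... (x - 2r), which has r + 1 factors.
descend2 : ℕ → ℚ → ℚ
descend2 zero    x = x
descend2 (suc r) x = x * descend2 r (x - ⟦ 2 ⟧)

descend2-last : ∀ r x → descend2 (suc r) x ≡ descend2 r x * (x - ⟦ 2 ⟧ * ⟦ suc r ⟧)
descend2-last zero    x = lemma x
  where
  lemma : ∀ x → x * (x - ⟦ 2 ⟧) ≡ x * (x - ⟦ 2 ⟧ * 1ℚ)
  lemma = solve-∀ ℚ-ring
descend2-last (suc r) x = begin
  x * descend2 (suc r) (x - ⟦ 2 ⟧)
    ≡⟨ cong (x *_) (descend2-last r (x - ⟦ 2 ⟧)) ⟩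
  x * (descend2 r (x - ⟦ 2 ⟧) * (x - ⟦ 2 ⟧ - ⟦ 2 ⟧ * ⟦ suc r ⟧))
    ≡⟨ lemma x (descend2 r (x - ⟦ 2 ⟧)) ⟦ suc r ⟧ ⟩
  x * descend2 r (x - ⟦ 2 ⟧) * (x - ⟦ 2 ⟧ * (1ℚ + ⟦ suc r ⟧))
    ≡⟨ cong (λ t → x * descend2 r (x - ⟦ 2 ⟧) * (x - ⟦ 2 ⟧ * t)) (⟦⟧-suc (suc r)) ⟨
  x * descend2 r (x - ⟦ 2 ⟧) * (x - ⟦ 2 ⟧ * ⟦ suc (suc r) ⟧) ∎
  where
  open ≡-Reasoning
  lemma : ∀ x d s → x * (d * (x - ⟦ 2 ⟧ - ⟦ 2 ⟧ * s)) ≡ x * d * (x - ⟦ 2 ⟧ * (1ℚ + s))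
  lemma = solve-∀ ℚ-ring

-- The partial fraction expansion of r! (-2)ʳ / (y (y - 2) ... (y - 2r)), with y = x - 2i. In the
-- induction the two differences, at i and i + 1, have the same numerator; over the common
-- denominator they contribute the factors y - 2(r + 1) and -y, whose sum is -2(r + 1).
E-reciprocal : ∀ x v → (∀ i → v i * (x - ⟦ 2 ⟧ * ⟦ i ⟧) ≡ 1ℚ) → ∀ r i →
  E m1 1 r v i * descend2 r (x - ⟦ 2 ⟧ * ⟦ i ⟧) ≡ ⟦ r ! ⟧ * m2 ^ℚ r
E-reciprocal x v inv zero    i = inv i
E-reciprocal x v inv (suc r) i = begin
  (e₀ + m1 * e₁) * (y * descend2 r (y - ⟦ 2 ⟧))
    ≡⟨ lemma₁ e₀ e₁ (y * descend2 r (y - ⟦ 2 ⟧)) ⟩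
  e₀ * (y * descend2 r (y - ⟦ 2 ⟧)) + m1 * (e₁ * (y * descend2 r (y - ⟦ 2 ⟧)))
    ≡⟨ cong₂ (λ s t → e₀ * s + m1 * (e₁ * (y * descend2 r t))) (descend2-last r y) next ⟩
  e₀ * (descend2 r y * (y - ⟦ 2 ⟧ * ⟦ suc r ⟧)) + m1 * (e₁ * (y * descend2 r (x - ⟦ 2 ⟧ * ⟦ suc i ⟧)))
    ≡⟨ lemma₂ e₀ e₁ y (descend2 r y) (descend2 r (x - ⟦ 2 ⟧ * ⟦ suc i ⟧)) ⟦ suc r ⟧ ⟩
  e₀ * descend2 r y * (y - ⟦ 2 ⟧ * ⟦ suc r ⟧) + m1 * (y * (e₁ * descend2 r (x - ⟦ 2 ⟧ * ⟦ suc i ⟧)))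
    ≡⟨ cong₂ (λ s t → s * (y - ⟦ 2 ⟧ * ⟦ suc r ⟧) + m1 * (y * t)) (E-reciprocal x v inv r i) (E-reciprocal x v inv r (suc i)) ⟩
  (⟦ r ! ⟧ * m2 ^ℚ r) * (y - ⟦ 2 ⟧ * ⟦ suc r ⟧) + m1 * (y * (⟦ r ! ⟧ * m2 ^ℚ r))
    ≡⟨ lemma₃ ⟦ r ! ⟧ (m2 ^ℚ r) y ⟦ suc r ⟧ ⟩
  ⟦ suc r ⟧ * ⟦ r ! ⟧ * m2 ^ℚ suc r
    ≡⟨ cong (_* m2 ^ℚ suc r) (⟦⟧-* (suc r) (r !)) ⟨
  ⟦ suc r ! ⟧ * m2 ^ℚ suc r ∎
  where
  open ≡-Reasoning
  y e₀ e₁ : ℚ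
  y = x - ⟦ 2 ⟧ * ⟦ i ⟧
  e₀ = E m1 1 r v i
  e₁ = E m1 1 r v (suc i)
  lemma₀ : ∀ x i → x - ⟦ 2 ⟧ * i - ⟦ 2 ⟧ ≡ x - ⟦ 2 ⟧ * (1ℚ + i)
  lemma₀ = solve-∀ ℚ-ring
  next : y - ⟦ 2 ⟧ ≡ x - ⟦ 2 ⟧ * ⟦ suc i ⟧
  next = ≡-trans (lemma₀ x ⟦ i ⟧) (cong (λ t → x - ⟦ 2 ⟧ * t) (≡-sym (⟦⟧-suc i)))
  lemma₁ : ∀ a b c → (a + m1 * b) * c ≡ a * c + m1 * (b * c)
  lemma₁ = solve-∀ ℚ-ring
  lemma₂ : ∀ a b y d d′ s → a * (d * (y - ⟦ 2 ⟧ * s)) + m1 * (b * (y * d′)) ≡ a * d * (y - ⟦ 2 ⟧ * s) + m1 * (y * (b * d′))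
  lemma₂ = solve-∀ ℚ-ring
  lemma₃ : ∀ f z y s → (f * z) * (y - ⟦ 2 ⟧ * s) + m1 * (y * (f * z)) ≡ s * f * (m2 * z)
  lemma₃ = solve-∀ ℚ-ring

-- 1 / (n - 2j) for n ≠ 2j: one of the two summands is recip 0 = 0.
gapRecip : ℕ → ℕ → ℚ
gapRecip n j = recip (n ∸ 2 ℕ.* j) - recip (2 ℕ.* j ∸ n)

gapRecip-inverse : ∀ n j → n ≢ 2 ℕ.* j → gapRecip n j * (⟦ n ⟧ - ⟦ 2 ⟧ * ⟦ j ⟧) ≡ 1ℚ
gapRecip-inverse n j n≢2j with ℕₚ.<-cmp n (2 ℕ.* j)
... | tri≈ _ n≡2j _ = contradiction n≡2j n≢2j
... | tri< n<2j _ _ = begin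
  (recip (n ∸ 2 ℕ.* j) - r) * (⟦ n ⟧ - ⟦ 2 ⟧ * ⟦ j ⟧)
    ≡⟨ cong₂ (λ s t → (recip s - r) * (⟦ n ⟧ - t)) (ℕₚ.m≤n⇒m∸n≡0 (ℕₚ.<⇒≤ n<2j)) (≡-sym (⟦⟧-* 2 j)) ⟩
  (0ℚ - r) * (⟦ n ⟧ - ⟦ 2 ℕ.* j ⟧)
    ≡⟨ lemma r ⟦ n ⟧ ⟦ 2 ℕ.* j ⟧ ⟩
  (⟦ 2 ℕ.* j ⟧ - ⟦ n ⟧) * r
    ≡⟨ cong (_* r) (⟦⟧-∸ (ℕₚ.<⇒≤ n<2j)) ⟨
  ⟦ 2 ℕ.* j ∸ n ⟧ * r
    ≡⟨ recip-inverse′ (2 ℕ.* j ∸ n) {{ℕ.>-nonZero (ℕₚ.m<n⇒0<n∸m n<2j)}} ⟩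
  1ℚ ∎
  where
  open ≡-Reasoning
  r : ℚ
  r = recip (2 ℕ.* j ∸ n)
  lemma : ∀ r x y → (0ℚ - r) * (x - y) ≡ (y - x) * r
  lemma = solve-∀ ℚ-ring
... | tri> _ _ 2j<n = begin
  (r - recip (2 ℕ.* j ∸ n)) * (⟦ n ⟧ - ⟦ 2 ⟧ * ⟦ j ⟧)
    ≡⟨ cong₂ (λ s t → (r - recip s) * (⟦ n ⟧ - t)) (ℕₚ.m≤n⇒m∸n≡0 (ℕₚ.<⇒≤ 2j<n)) (≡-sym (⟦⟧-* 2 j)) ⟩
  (r - 0ℚ) * (⟦ n ⟧ - ⟦ 2 ℕ.* j ⟧)
    ≡⟨ lemma r ⟦ n ⟧ ⟦ 2 ℕ.* j ⟧ ⟩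
  (⟦ n ⟧ - ⟦ 2 ℕ.* j ⟧) * r
    ≡⟨ cong (_* r) (⟦⟧-∸ (ℕₚ.<⇒≤ 2j<n)) ⟨
  ⟦ n ∸ 2 ℕ.* j ⟧ * r
    ≡⟨ recip-inverse′ (n ∸ 2 ℕ.* j) {{ℕ.>-nonZero (ℕₚ.m<n⇒0<n∸m 2j<n)}} ⟩
  1ℚ ∎
  where
  open ≡-Reasoning
  r : ℚ
  r = recip (n ∸ 2 ℕ.* j)
  lemma : ∀ r x y → (r - 0ℚ) * (x - y) ≡ (x - y) * r
  lemma = solve-∀ ℚ-ring

gapRecip-reflect : ∀ n j → j ≤ n → gapRecip n (n ∸ j) ≡ - gapRecip n j
gapRecip-reflect n j j≤n = subst (λ n → gapRecip n (n ∸ j) ≡ - gapRecip n j) (ℕₚ.m+[n∸m]≡n j≤n) (core (n ∸ j))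
  where
  lemma : ∀ x y → x - y ≡ - (y - x)
  lemma = solve-∀ ℚ-ring
  double : ∀ t → 2 ℕ.* t ≡ t ℕ.+ t
  double t = cong (t ℕ.+_) (ℕₚ.+-identityʳ t)
  cancelʳ : ∀ a b t → a ℕ.+ t ∸ (b ℕ.+ t) ≡ a ∸ b
  cancelʳ a b t = ≡-trans (cong₂ _∸_ (ℕₚ.+-comm a t) (ℕₚ.+-comm b t)) (ℕₚ.[m+n]∸[m+o]≡n∸o t a b)
  above : ∀ t → j ℕ.+ t ∸ 2 ℕ.* t ≡ 2 ℕ.* j ∸ (j ℕ.+ t)
  above t rewrite double t | double j = ≡-trans (cancelʳ j t t) (≡-sym (ℕₚ.[m+n]∸[m+o]≡n∸o j j t))
  below : ∀ t → 2 ℕ.* t ∸ (j ℕ.+ t) ≡ j ℕ.+ t ∸ 2 ℕ.* j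
  below t rewrite double t | double j = ≡-trans (cancelʳ t j t) (≡-sym (ℕₚ.[m+n]∸[m+o]≡n∸o j t j))
  core : ∀ t → gapRecip (j ℕ.+ t) (j ℕ.+ t ∸ j) ≡ - gapRecip (j ℕ.+ t) j
  core t rewrite ℕₚ.m+n∸m≡n j t = ≡-trans (cong₂ (λ a b → recip a - recip b) (above t) (below t))
    (lemma (recip (2 ℕ.* j ∸ (j ℕ.+ t))) (recip (j ℕ.+ t ∸ 2 ℕ.* j)))

-- Central binomial coefficients

central : ℕ → ℚ
central k = binom (2 ℕ.* k) k

-- The rational difference k + 1 - d keeps this true for d > k, where both sides are 0. The case d =
-- 0 gives the central recurrence, general d the one for (ii).
binom-double-suc : ∀ k d →
  (⟦ suc (k ℕ.+ d) ⟧ * (⟦ suc k ⟧ - ⟦ d ⟧)) * binom (2 ℕ.* suc k) (suc k ℕ.+ d)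
    ≡ (⟦ 2 ⟧ * ⟦ suc k ⟧ * ⟦ suc (2 ℕ.* k) ⟧) * binom (2 ℕ.* k) (k ℕ.+ d)
binom-double-suc k d = begin
  (s * (⟦ suc k ⟧ - ⟦ d ⟧)) * binom (2 ℕ.* suc k) (suc a)
    ≡⟨ cong (λ t → (s * (⟦ suc k ⟧ - ⟦ d ⟧)) * binom t (suc a)) (ℕₚ.*-suc 2 k) ⟩
  (s * (⟦ suc k ⟧ - ⟦ d ⟧)) * binom (suc (suc M)) (suc a)
    ≡⟨ lemma₁ s (⟦ suc k ⟧ - ⟦ d ⟧) (binom (suc (suc M)) (suc a)) ⟩
  (⟦ suc k ⟧ - ⟦ d ⟧) * (s * binom (suc (suc M)) (suc a))
    ≡⟨ cong₂ _*_ gap (absorption (suc M) a) ⟩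
  (⟦ suc M ⟧ - ⟦ a ⟧) * (⟦ suc (suc M) ⟧ * binom (suc M) a)
    ≡⟨ lemma₂ (⟦ suc M ⟧ - ⟦ a ⟧) ⟦ suc (suc M) ⟧ (binom (suc M) a) ⟩
  ⟦ suc (suc M) ⟧ * ((⟦ suc M ⟧ - ⟦ a ⟧) * binom (suc M) a)
    ≡⟨ cong₂ _*_ (≡-trans (cong ⟦_⟧ (≡-sym (ℕₚ.*-suc 2 k))) (⟦⟧-* 2 (suc k))) (binom-upper M a) ⟩
  ⟦ 2 ⟧ * ⟦ suc k ⟧ * (⟦ suc M ⟧ * binom M a)
    ≡⟨ ℚₚ.*-assoc (⟦ 2 ⟧ * ⟦ suc k ⟧) ⟦ suc M ⟧ (binom M a) ⟨
  (⟦ 2 ⟧ * ⟦ suc k ⟧ * ⟦ suc M ⟧) * binom M a ∎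
  where
  open ≡-Reasoning
  M a : ℕ
  M = 2 ℕ.* k
  a = k ℕ.+ d
  s : ℚ
  s = ⟦ suc (k ℕ.+ d) ⟧
  lemma₁ : ∀ x y z → (x * y) * z ≡ y * (x * z)
  lemma₁ = solve-∀ ℚ-ring
  lemma₂ : ∀ x y z → x * (y * z) ≡ y * (x * z)
  lemma₂ = solve-∀ ℚ-ring
  lemma₃ : ∀ k d → 1ℚ + k - d ≡ 1ℚ + ⟦ 2 ⟧ * k - (k + d)
  lemma₃ = solve-∀ ℚ-ring
  gap : ⟦ suc k ⟧ - ⟦ d ⟧ ≡ ⟦ suc M ⟧ - ⟦ a ⟧
  gap = begin
    ⟦ suc k ⟧ - ⟦ d ⟧                        ≡⟨ cong (_- ⟦ d ⟧) (⟦⟧-suc k) ⟩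
    1ℚ + ⟦ k ⟧ - ⟦ d ⟧                       ≡⟨ lemma₃ ⟦ k ⟧ ⟦ d ⟧ ⟩
    1ℚ + ⟦ 2 ⟧ * ⟦ k ⟧ - (⟦ k ⟧ + ⟦ d ⟧)     ≡⟨ cong₂ (λ x y → 1ℚ + x - y) (⟦⟧-* 2 k) (⟦⟧-+ k d) ⟨
    1ℚ + ⟦ M ⟧ - ⟦ a ⟧                       ≡⟨ cong (_- ⟦ a ⟧) (⟦⟧-suc M) ⟨
    ⟦ suc M ⟧ - ⟦ a ⟧                        ∎

central-suc : ∀ k → ⟦ suc k ⟧ * central (suc k) ≡ ⟦ 2 ⟧ * ⟦ suc (2 ℕ.* k) ⟧ * central k
central-suc k = *-cancel-suc k (begin
  ⟦ suc k ⟧ * (⟦ suc k ⟧ * central (suc k))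
    ≡⟨ cong₂ (λ s t → ⟦ suc s ⟧ * (⟦ suc k ⟧ * binom (2 ℕ.* suc k) (suc t))) (≡-sym (ℕₚ.+-identityʳ k)) (≡-sym (ℕₚ.+-identityʳ k)) ⟩
  ⟦ suc (k ℕ.+ 0) ⟧ * (⟦ suc k ⟧ * binom (2 ℕ.* suc k) (suc k ℕ.+ 0))
    ≡⟨ lemma₁ ⟦ suc (k ℕ.+ 0) ⟧ ⟦ suc k ⟧ (binom (2 ℕ.* suc k) (suc k ℕ.+ 0)) ⟩
  (⟦ suc (k ℕ.+ 0) ⟧ * (⟦ suc k ⟧ - ⟦ 0 ⟧)) * binom (2 ℕ.* suc k) (suc k ℕ.+ 0)
    ≡⟨ binom-double-suc k 0 ⟩
  (⟦ 2 ⟧ * ⟦ suc k ⟧ * ⟦ suc (2 ℕ.* k) ⟧) * binom (2 ℕ.* k) (k ℕ.+ 0)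
    ≡⟨ cong (λ t → (⟦ 2 ⟧ * ⟦ suc k ⟧ * ⟦ suc (2 ℕ.* k) ⟧) * binom (2 ℕ.* k) t) (ℕₚ.+-identityʳ k) ⟩
  (⟦ 2 ⟧ * ⟦ suc k ⟧ * ⟦ suc (2 ℕ.* k) ⟧) * central k
    ≡⟨ lemma₂ ⟦ suc k ⟧ ⟦ suc (2 ℕ.* k) ⟧ (central k) ⟩
  ⟦ suc k ⟧ * (⟦ 2 ⟧ * ⟦ suc (2 ℕ.* k) ⟧ * central k) ∎)
  where
  open ≡-Reasoning
  lemma₁ : ∀ s t x → s * (t * x) ≡ (s * (t - 0ℚ)) * x
  lemma₁ = solve-∀ ℚ-ring
  lemma₂ : ∀ s t x → (⟦ 2 ⟧ * s * t) * x ≡ s * (⟦ 2 ⟧ * t * x)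
  lemma₂ = solve-∀ ℚ-ring

m16 : ℚ
m16 = - ⟦ 16 ⟧

-- For n = 2m + 1 the product n (n - 2) ... (-n) runs over the odd numbers from n down to -n.
-- Passing from n to n + 2 adds the factors n + 2 and -(n + 2) at the two ends.
descend2-central : ∀ m → let n = suc (2 ℕ.* m) in
  descend2 n ⟦ n ⟧ * (⟦ 2 ⟧ * m16 ^ℚ m) ≡ ⟦ n ! ⟧ * m2 ^ℚ n * (⟦ n ⟧ * central m)
descend2-central zero    = refl
descend2-central (suc m) = subst
  (λ t → descend2 (suc t) ⟦ suc t ⟧ * (⟦ 2 ⟧ * m16 ^ℚ suc m) ≡ ⟦ suc t ! ⟧ * m2 ^ℚ suc t * (⟦ suc t ⟧ * central (suc m)))
  (≡-sym (ℕₚ.*-suc 2 m)) (begin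
  ⟦ n+2 ⟧ * descend2 (suc n) (⟦ n+2 ⟧ - ⟦ 2 ⟧) * (⟦ 2 ⟧ * (m16 * x))
    ≡⟨ cong (λ t → ⟦ n+2 ⟧ * descend2 (suc n) t * (⟦ 2 ⟧ * (m16 * x))) (⟦⟧-∸ {n+2} {2} (s≤s (s≤s z≤n))) ⟨
  ⟦ n+2 ⟧ * descend2 (suc n) ⟦ n ⟧ * (⟦ 2 ⟧ * (m16 * x))
    ≡⟨ cong (λ t → ⟦ n+2 ⟧ * t * (⟦ 2 ⟧ * (m16 * x))) (descend2-last n ⟦ n ⟧) ⟩
  ⟦ n+2 ⟧ * (D * (⟦ n ⟧ - ⟦ 2 ⟧ * ⟦ suc n ⟧)) * (⟦ 2 ⟧ * (m16 * x))
    ≡⟨ cong₂ (λ s t → s * (D * (⟦ n ⟧ - ⟦ 2 ⟧ * t)) * (⟦ 2 ⟧ * (m16 * x))) (⟦⟧-+ 2 n) (⟦⟧-suc n) ⟩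
  (⟦ 2 ⟧ + ⟦ n ⟧) * (D * (⟦ n ⟧ - ⟦ 2 ⟧ * (1ℚ + ⟦ n ⟧))) * (⟦ 2 ⟧ * (m16 * x))
    ≡⟨ lemma₁ ⟦ n ⟧ D x ⟩
  ⟦ 16 ⟧ * ((⟦ 2 ⟧ + ⟦ n ⟧) * (⟦ 2 ⟧ + ⟦ n ⟧)) * (D * (⟦ 2 ⟧ * x))
    ≡⟨ cong (λ t → ⟦ 16 ⟧ * ((⟦ 2 ⟧ + ⟦ n ⟧) * (⟦ 2 ⟧ + ⟦ n ⟧)) * t) (descend2-central m) ⟩
  ⟦ 16 ⟧ * ((⟦ 2 ⟧ + ⟦ n ⟧) * (⟦ 2 ⟧ + ⟦ n ⟧)) * (⟦ n ! ⟧ * z * (⟦ n ⟧ * central m))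
    ≡⟨ lemma₂ ⟦ n ⟧ ⟦ n ! ⟧ z (central m) ⟩
  ⟦ 8 ⟧ * ((⟦ 2 ⟧ + ⟦ n ⟧) * (⟦ 2 ⟧ + ⟦ n ⟧)) * (⟦ n ! ⟧ * z) * (⟦ 2 ⟧ * ⟦ n ⟧ * central m)
    ≡⟨ cong (⟦ 8 ⟧ * ((⟦ 2 ⟧ + ⟦ n ⟧) * (⟦ 2 ⟧ + ⟦ n ⟧)) * (⟦ n ! ⟧ * z) *_) (central-suc m) ⟨
  ⟦ 8 ⟧ * ((⟦ 2 ⟧ + ⟦ n ⟧) * (⟦ 2 ⟧ + ⟦ n ⟧)) * (⟦ n ! ⟧ * z) * (⟦ suc m ⟧ * c)
    ≡⟨ lemma₃ (⟦ 2 ⟧ + ⟦ n ⟧) ⟦ n ! ⟧ z ⟦ suc m ⟧ c ⟩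
  (⟦ 2 ⟧ + ⟦ n ⟧) * (⟦ 2 ⟧ * ⟦ suc m ⟧ * ⟦ n ! ⟧) * (m2 * (m2 * z)) * ((⟦ 2 ⟧ + ⟦ n ⟧) * c)
    ≡⟨ cong₂ (λ s t → s * (t * ⟦ n ! ⟧) * (m2 * (m2 * z)) * (s * c)) (⟦⟧-+ 2 n) (≡-trans (cong ⟦_⟧ (≡-sym (ℕₚ.*-suc 2 m))) (⟦⟧-* 2 (suc m))) ⟨
  ⟦ n+2 ⟧ * (⟦ suc n ⟧ * ⟦ n ! ⟧) * (m2 * (m2 * z)) * (⟦ n+2 ⟧ * c)
    ≡⟨ cong (λ t → ⟦ n+2 ⟧ * t * (m2 * (m2 * z)) * (⟦ n+2 ⟧ * c)) (⟦⟧-* (suc n) (n !)) ⟨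
  ⟦ n+2 ⟧ * ⟦ suc n ! ⟧ * (m2 * (m2 * z)) * (⟦ n+2 ⟧ * c)
    ≡⟨ cong (λ t → t * (m2 * (m2 * z)) * (⟦ n+2 ⟧ * c)) (⟦⟧-* n+2 (suc n !)) ⟨
  ⟦ n+2 ! ⟧ * (m2 * (m2 * z)) * (⟦ n+2 ⟧ * c) ∎)
  where
  open ≡-Reasoning
  n n+2 : ℕ
  n = suc (2 ℕ.* m)
  n+2 = suc (suc n)
  x D z c : ℚ
  x = m16 ^ℚ m
  D = descend2 n ⟦ n ⟧
  z = m2 ^ℚ n
  c = central (suc m)
  lemma₁ : ∀ n D x → (⟦ 2 ⟧ + n) * (D * (n - ⟦ 2 ⟧ * (1ℚ + n))) * (⟦ 2 ⟧ * (m16 * x)) ≡ ⟦ 16 ⟧ * ((⟦ 2 ⟧ + n) * (⟦ 2 ⟧ + n)) * (D * (⟦ 2 ⟧ * x))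
  lemma₁ = solve-∀ ℚ-ring
  lemma₂ : ∀ n f z c → ⟦ 16 ⟧ * ((⟦ 2 ⟧ + n) * (⟦ 2 ⟧ + n)) * (f * z * (n * c)) ≡ ⟦ 8 ⟧ * ((⟦ 2 ⟧ + n) * (⟦ 2 ⟧ + n)) * (f * z) * (⟦ 2 ⟧ * n * c)
  lemma₂ = solve-∀ ℚ-ring
  lemma₃ : ∀ n f z s c → ⟦ 8 ⟧ * (n * n) * (f * z) * (s * c) ≡ n * (⟦ 2 ⟧ * s * f) * (m2 * (m2 * z)) * (n * c)
  lemma₃ = solve-∀ ℚ-ring

2m+1≢2j : ∀ m j → suc (2 ℕ.* m) ≢ 2 ℕ.* j
2m+1≢2j m zero    ()
2m+1≢2j m (suc j) eq with m
... | zero  = contradiction (ℕₚ.suc-injective (≡-trans eq (ℕₚ.*-suc 2 j))) (λ ())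
... | suc m = 2m+1≢2j m j (ℕₚ.suc-injective (ℕₚ.suc-injective
  (≡-trans (cong suc (≡-sym (ℕₚ.*-suc 2 m))) (≡-trans eq (ℕₚ.*-suc 2 j)))))

-- Partial fractions at x = n evaluate the sum over all j ≤ n. It is twice the sum over j ≤ m: under
-- j ↦ n - j both (-1)ʲ and 1 / (n - 2j) change sign, n being odd.
Σ-alternating-gapRecip : ∀ m → let n = suc (2 ℕ.* m) in
  ⟦ n ⟧ * central m * Σ[0≤k≤ m ] (λ j → binom n j * (m1 ^ℚ j * gapRecip n j)) ≡ m16 ^ℚ m
Σ-alternating-gapRecip m = *-cancel-invertible U U⁻¹ U-inverse (begin
  U * (⟦ n ⟧ * central m * H)             ≡⟨ lemma₁ U (⟦ n ⟧ * central m) H ⟩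
  U * (⟦ n ⟧ * central m) * H             ≡⟨ cong (_* H) (descend2-central m) ⟨
  D * (⟦ 2 ⟧ * m16 ^ℚ m) * H              ≡⟨ lemma₂ D (m16 ^ℚ m) H ⟩
  (⟦ 2 ⟧ * H) * D * m16 ^ℚ m              ≡⟨ cong (λ t → t * D * m16 ^ℚ m) full ⟨
  E m1 1 n (gapRecip n) 0 * D * m16 ^ℚ m  ≡⟨ cong (_* m16 ^ℚ m) total ⟩
  U * m16 ^ℚ m                            ∎)
  where
  open ≡-Reasoning
  n : ℕ
  n = suc (2 ℕ.* m)
  t : ℕ → ℚ
  t j = binom n j * (m1 ^ℚ j * gapRecip n j)
  U U⁻¹ D H : ℚ
  U = ⟦ n ! ⟧ * m2 ^ℚ n
  U⁻¹ = recip (n !) * (- recip 2) ^ℚ n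
  D = descend2 n ⟦ n ⟧
  H = Σ[0≤k≤ m ] t
  lemma₁ : ∀ u x y → u * (x * y) ≡ u * x * y
  lemma₁ = solve-∀ ℚ-ring
  lemma₂ : ∀ d x h → d * (⟦ 2 ⟧ * x) * h ≡ (⟦ 2 ⟧ * h) * d * x
  lemma₂ = solve-∀ ℚ-ring
  lemma₃ : ∀ f z g w → (f * z) * (g * w) ≡ (f * g) * (z * w)
  lemma₃ = solve-∀ ℚ-ring
  lemma₄ : ∀ x → x - ⟦ 2 ⟧ * ⟦ 0 ⟧ ≡ x
  lemma₄ = solve-∀ ℚ-ring
  lemma₅ : ∀ b x v → b * (m1 * x * (- v)) ≡ b * (x * v)
  lemma₅ = solve-∀ ℚ-ring
  lemma₆ : ∀ x → x + x ≡ ⟦ 2 ⟧ * x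
  lemma₆ = solve-∀ ℚ-ring
  lemma₇ : ∀ u v → u * v * v ≡ u * (v * v)
  lemma₇ = solve-∀ ℚ-ring
  U-inverse : U * U⁻¹ ≡ 1ℚ
  U-inverse = begin
    U * U⁻¹ ≡⟨ lemma₃ ⟦ n ! ⟧ (m2 ^ℚ n) (recip (n !)) ((- recip 2) ^ℚ n) ⟩
    (⟦ n ! ⟧ * recip (n !)) * (m2 ^ℚ n * (- recip 2) ^ℚ n)
      ≡⟨ cong₂ _*_ (recip-inverse′ (n !) {{n ℕₚ.!≢0}}) (≡-trans (≡-sym (^ℚ-* m2 (- recip 2) n)) (1^ℚ n)) ⟩
    1ℚ ∎
  total : E m1 1 n (gapRecip n) 0 * D ≡ U
  total = ≡-trans (cong (λ x → E m1 1 n (gapRecip n) 0 * descend2 n x) (≡-sym (lemma₄ ⟦ n ⟧)))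
    (E-reciprocal ⟦ n ⟧ (gapRecip n) (λ i → gapRecip-inverse n i (2m+1≢2j m i)) n 0)
  m1^n : m1 ^ℚ n ≡ m1
  m1^n = cong (m1 *_) (m1^-double m)
  m1^-reflect : ∀ j → j ≤ n → m1 ^ℚ (n ∸ j) ≡ m1 * m1 ^ℚ j
  m1^-reflect j j≤n = begin
    m1 ^ℚ (n ∸ j)                          ≡⟨ ℚₚ.*-identityʳ (m1 ^ℚ (n ∸ j)) ⟨
    m1 ^ℚ (n ∸ j) * 1ℚ                     ≡⟨ cong (m1 ^ℚ (n ∸ j) *_) (m1^-involutive j) ⟨
    m1 ^ℚ (n ∸ j) * (m1 ^ℚ j * m1 ^ℚ j)    ≡⟨ lemma₇ (m1 ^ℚ (n ∸ j)) (m1 ^ℚ j) ⟨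
    m1 ^ℚ (n ∸ j) * m1 ^ℚ j * m1 ^ℚ j      ≡⟨ cong (_* m1 ^ℚ j) (^ℚ-+ m1 (n ∸ j) j) ⟨
    m1 ^ℚ (n ∸ j ℕ.+ j) * m1 ^ℚ j          ≡⟨ cong (λ s → m1 ^ℚ s * m1 ^ℚ j) (ℕₚ.m∸n+n≡m j≤n) ⟩
    m1 ^ℚ n * m1 ^ℚ j                      ≡⟨ cong (_* m1 ^ℚ j) m1^n ⟩
    m1 * m1 ^ℚ j                           ∎
  t-reflect : ∀ j → j ≤ n → t (n ∸ j) ≡ t j
  t-reflect j j≤n = begin
    binom n (n ∸ j) * (m1 ^ℚ (n ∸ j) * gapRecip n (n ∸ j))
      ≡⟨ cong₂ _*_ (≡-sym (binom-sym j≤n)) (cong₂ _*_ (m1^-reflect j j≤n) (gapRecip-reflect n j j≤n)) ⟩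
    binom n j * (m1 * m1 ^ℚ j * (- gapRecip n j))
      ≡⟨ lemma₅ (binom n j) (m1 ^ℚ j) (gapRecip n j) ⟩
    t j ∎
  n≡ : suc (m ℕ.+ m) ≡ n
  n≡ = cong (λ s → suc (m ℕ.+ s)) (≡-sym (ℕₚ.+-identityʳ m))
  full : E m1 1 n (gapRecip n) 0 ≡ ⟦ 2 ⟧ * H
  full = begin
    E m1 1 n (gapRecip n) 0
      ≡⟨ E-expand m1 1 n (gapRecip n) 0 ⟩
    Σ[0≤k≤ n ] (λ j → binom n j * (m1 ^ℚ j * gapRecip n (j ℕ.* 1 ℕ.+ 0)))
      ≡⟨ Σ-cong n (λ j _ → cong (λ s → binom n j * (m1 ^ℚ j * gapRecip n s)) (≡-trans (ℕₚ.+-identityʳ (j ℕ.* 1)) (ℕₚ.*-identityʳ j))) ⟩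
    Σ[0≤k≤ n ] t
      ≡⟨ cong (λ s → Σ[0≤k≤ s ] t) n≡ ⟨
    Σ[0≤k≤ suc (m ℕ.+ m) ] t
      ≡⟨ Σ-fold m t ⟩
    H + Σ[0≤k≤ m ] (λ j → t (suc (m ℕ.+ m) ∸ j))
      ≡⟨ cong (λ s → H + s) (Σ-cong m (λ j j≤m → ≡-trans (cong (λ s → t (s ∸ j)) n≡)
           (t-reflect j (ℕₚ.≤-trans j≤m (ℕₚ.m≤n⇒m≤1+n (ℕₚ.m≤m+n m (m ℕ.+ 0))))))) ⟩
    H + H
      ≡⟨ lemma₆ H ⟩
    ⟦ 2 ⟧ * H ∎

-- Consequences of the reflection in odd degree

private
  m2^ : ∀ k → m2 ^ℚ k ≡ m1 ^ℚ k * ⟦ 2 ⟧ ^ℚ k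
  m2^ = ^ℚ-* m1 ⟦ 2 ⟧

self-negative : ∀ x → x ≡ m1 * x → x ≡ 0ℚ
self-negative x eq = *-cancel-suc 1 (≡-trans (lemma₁ x) (≡-trans (cong (λ t → x + t) eq) (lemma₂ x)))
  where
  lemma₁ : ∀ x → ⟦ 2 ⟧ * x ≡ x + x
  lemma₁ = solve-∀ ℚ-ring
  lemma₂ : ∀ x → x + m1 * x ≡ ⟦ 2 ⟧ * 0ℚ
  lemma₂ = solve-∀ ℚ-ring

-- Oddness is stated as (-1)ⁿ = -1, the form in which `reflection` uses it; it is instantiated at n
-- = 2m + 1 for (i) and at n - d for (ii).
module OddReflection (n : ℕ) (odd : m1 ^ℚ n ≡ m1) where
  open ≡-Reasoning

  private
    reflect : ∀ f → Σ[0≤k≤ n ] (λ k → m1 ^ℚ k * F n k * binomialTransform f k) ≡ m1 * Σ[0≤k≤ n ] (λ j → F n j * f j)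
    reflect f = ≡-trans (reflection n f) (cong (_* Σ[0≤k≤ n ] (λ j → F n j * f j)) odd)

  -- The functional is evaluation at 1; its transform is evaluation at 2, and the sign (-1)ᵏ turns
  -- this into -2.
  Σ-F-m2 : Σ[0≤k≤ n ] (λ k → m2 ^ℚ k * F n k) ≡ m1 * Σ[0≤k≤ n ] (F n)
  Σ-F-m2 = begin
    Σ[0≤k≤ n ] (λ k → m2 ^ℚ k * F n k)
      ≡⟨ Σ-cong n (λ k _ → ≡-trans (cong (_* F n k) (m2^ k)) (lemma (m1 ^ℚ k) (⟦ 2 ⟧ ^ℚ k) (F n k))) ⟩
    Σ[0≤k≤ n ] (λ k → m1 ^ℚ k * F n k * ⟦ 2 ⟧ ^ℚ k)
      ≡⟨ Σ-cong n (λ k _ → cong (m1 ^ℚ k * F n k *_) (binomialTransform-power 1ℚ k)) ⟨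
    Σ[0≤k≤ n ] (λ k → m1 ^ℚ k * F n k * binomialTransform (1ℚ ^ℚ_) k)
      ≡⟨ reflect (1ℚ ^ℚ_) ⟩
    m1 * Σ[0≤k≤ n ] (λ j → F n j * 1ℚ ^ℚ j)
      ≡⟨ cong (m1 *_) (Σ-cong n (λ j _ → ≡-trans (cong (F n j *_) (1^ℚ j)) (ℚₚ.*-identityʳ (F n j)))) ⟩
    m1 * Σ[0≤k≤ n ] (F n) ∎
    where
    lemma : ∀ x y z → x * y * z ≡ x * z * y
    lemma = solve-∀ ℚ-ring

  -- The functional is the derivative at 1. Differentiating Q(-1 - x) = -Q(x) gives Q'(-2) = Q'(1);
  -- the factor -2 comes from the x in x Q'(x).
  Σ-kF-m2 : Σ[0≤k≤ n ] (λ k → m2 ^ℚ k * ⟦ k ⟧ * F n k) ≡ m2 * Σ[0≤k≤ n ] (λ k → ⟦ k ⟧ * F n k)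
  Σ-kF-m2 = begin
    Σ[0≤k≤ n ] (λ k → m2 ^ℚ k * ⟦ k ⟧ * F n k)
      ≡⟨ Σ-cong n (λ k _ → term k) ⟩
    Σ[0≤k≤ n ] (λ k → ⟦ 2 ⟧ * (m1 ^ℚ k * F n k * binomialTransform ⟦_⟧ k))
      ≡⟨ Σ-distribˡ n ⟦ 2 ⟧ _ ⟨
    ⟦ 2 ⟧ * Σ[0≤k≤ n ] (λ k → m1 ^ℚ k * F n k * binomialTransform ⟦_⟧ k)
      ≡⟨ cong (⟦ 2 ⟧ *_) (reflect ⟦_⟧) ⟩
    ⟦ 2 ⟧ * (m1 * Σ[0≤k≤ n ] (λ k → F n k * ⟦ k ⟧))
      ≡⟨ lemma₃ (Σ[0≤k≤ n ] (λ k → F n k * ⟦ k ⟧)) ⟩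
    m2 * Σ[0≤k≤ n ] (λ k → F n k * ⟦ k ⟧)
      ≡⟨ cong (m2 *_) (Σ-cong n (λ k _ → ℚₚ.*-comm (F n k) ⟦ k ⟧)) ⟩
    m2 * Σ[0≤k≤ n ] (λ k → ⟦ k ⟧ * F n k) ∎
    where
    lemma₁ : ∀ x y k f → x * y * k * f ≡ x * f * (k * y)
    lemma₁ = solve-∀ ℚ-ring
    lemma₂ : ∀ x b → x * (⟦ 2 ⟧ * b) ≡ ⟦ 2 ⟧ * (x * b)
    lemma₂ = solve-∀ ℚ-ring
    lemma₃ : ∀ s → ⟦ 2 ⟧ * (m1 * s) ≡ m2 * s
    lemma₃ = solve-∀ ℚ-ring
    term : ∀ k → m2 ^ℚ k * ⟦ k ⟧ * F n k ≡ ⟦ 2 ⟧ * (m1 ^ℚ k * F n k * binomialTransform ⟦_⟧ k)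
    term k = begin
      m2 ^ℚ k * ⟦ k ⟧ * F n k                                ≡⟨ cong (λ t → t * ⟦ k ⟧ * F n k) (m2^ k) ⟩
      m1 ^ℚ k * ⟦ 2 ⟧ ^ℚ k * ⟦ k ⟧ * F n k                   ≡⟨ lemma₁ (m1 ^ℚ k) (⟦ 2 ⟧ ^ℚ k) ⟦ k ⟧ (F n k) ⟩
      m1 ^ℚ k * F n k * (⟦ k ⟧ * ⟦ 2 ⟧ ^ℚ k)                 ≡⟨ cong (m1 ^ℚ k * F n k *_) (binomialTransform-id k) ⟨
      m1 ^ℚ k * F n k * (⟦ 2 ⟧ * binomialTransform ⟦_⟧ k)    ≡⟨ lemma₂ (m1 ^ℚ k * F n k) (binomialTransform ⟦_⟧ k) ⟩
      ⟦ 2 ⟧ * (m1 ^ℚ k * F n k * binomialTransform ⟦_⟧ k)    ∎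

  -- This is the integral of Q over [-1, 0], an interval symmetric about the centre -1/2 of an odd
  -- function. The functional with values (-1)ʲ / (j + 1) is that integral, and on (1 + x)ᵏ it takes
  -- the value 1 / (k + 1).
  Σ-F-recip-m1 : Σ[0≤k≤ n ] (λ k → m1 ^ℚ k * F n k * recip (suc k)) ≡ 0ℚ
  Σ-F-recip-m1 = self-negative _ (begin
    Σ[0≤k≤ n ] (λ k → m1 ^ℚ k * F n k * recip (suc k))
      ≡⟨ Σ-cong n (λ k _ → cong (m1 ^ℚ k * F n k *_) (transform k)) ⟨
    Σ[0≤k≤ n ] (λ k → m1 ^ℚ k * F n k * binomialTransform f k)
      ≡⟨ reflect f ⟩
    m1 * Σ[0≤k≤ n ] (λ k → F n k * (recip (suc k) * m1 ^ℚ k))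
      ≡⟨ cong (m1 *_) (Σ-cong n (λ k _ → lemma₁ (F n k) (recip (suc k)) (m1 ^ℚ k))) ⟩
    m1 * Σ[0≤k≤ n ] (λ k → m1 ^ℚ k * F n k * recip (suc k)) ∎)
    where
    f : ℕ → ℚ
    f j = recip (suc j) * m1 ^ℚ j
    lemma₁ : ∀ x y z → x * (y * z) ≡ z * x * y
    lemma₁ = solve-∀ ℚ-ring
    lemma₂ : ∀ s b → s * b ≡ m1 * (s * (m1 * b))
    lemma₂ = solve-∀ ℚ-ring
    -- The factor 0 is 1 + x at x = -1, already evaluated.
    lemma₃ : ∀ x → m1 * (0ℚ * x - 1ℚ) ≡ 1ℚ
    lemma₃ = solve-∀ ℚ-ring
    transform : ∀ k → binomialTransform f k ≡ recip (suc k)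
    transform k = recip-unique (suc k) (binomialTransform f k) (≡-trans (lemma₂ ⟦ suc k ⟧ (binomialTransform f k))
      (≡-trans (cong (m1 *_) (binomialTransform-recip m1 k)) (lemma₃ ((1ℚ + m1) ^ℚ k))))

  -- Integration over [0, 1] takes (1 + x)ᵏ to (2ᵏ⁺¹ - 1) / (k + 1). The part -1 / (k + 1)
  -- contributes the integral over [-1, 0], which is 0.
  Σ-F-recip-m2 : ⟦ 2 ⟧ * Σ[0≤k≤ n ] (λ k → m2 ^ℚ k * recip (suc k) * F n k)
    ≡ m1 * Σ[0≤k≤ n ] (λ k → recip (suc k) * F n k)
  Σ-F-recip-m2 = begin
    ⟦ 2 ⟧ * Σ[0≤k≤ n ] (λ k → m2 ^ℚ k * recip (suc k) * F n k)
      ≡⟨ Σ-distribˡ n ⟦ 2 ⟧ _ ⟩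
    Σ[0≤k≤ n ] (λ k → ⟦ 2 ⟧ * (m2 ^ℚ k * recip (suc k) * F n k))
      ≡⟨ Σ-cong n (λ k _ → term k) ⟩
    Σ[0≤k≤ n ] (λ k → m1 ^ℚ k * F n k * binomialTransform f k + m1 ^ℚ k * F n k * recip (suc k))
      ≡⟨ Σ-+ n _ _ ⟩
    Σ[0≤k≤ n ] (λ k → m1 ^ℚ k * F n k * binomialTransform f k) + Σ[0≤k≤ n ] (λ k → m1 ^ℚ k * F n k * recip (suc k))
      ≡⟨ cong₂ _+_ (reflect f) Σ-F-recip-m1 ⟩
    m1 * Σ[0≤k≤ n ] (λ k → F n k * (recip (suc k) * 1ℚ ^ℚ k)) + 0ℚ
      ≡⟨ ℚₚ.+-identityʳ (m1 * Σ[0≤k≤ n ] (λ k → F n k * (recip (suc k) * 1ℚ ^ℚ k))) ⟩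
    m1 * Σ[0≤k≤ n ] (λ k → F n k * (recip (suc k) * 1ℚ ^ℚ k))
      ≡⟨ cong (m1 *_) (Σ-cong n (λ k _ → ≡-trans (cong (λ t → F n k * (recip (suc k) * t)) (1^ℚ k)) (lemma₁ (F n k) (recip (suc k))))) ⟩
    m1 * Σ[0≤k≤ n ] (λ k → recip (suc k) * F n k) ∎
    where
    f : ℕ → ℚ
    f j = recip (suc j) * 1ℚ ^ℚ j
    lemma₁ : ∀ x r → x * (r * 1ℚ) ≡ r * x
    lemma₁ = solve-∀ ℚ-ring
    lemma₂ : ∀ s b r → s * (b + r) ≡ s * (1ℚ * b) + s * r
    lemma₂ = solve-∀ ℚ-ring
    lemma₃ : ∀ y → ⟦ 2 ⟧ * y - 1ℚ + 1ℚ ≡ 1ℚ * (⟦ 2 ⟧ * y)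
    lemma₃ = solve-∀ ℚ-ring
    lemma₄ : ∀ s r y → s * r * y ≡ s * (r * y)
    lemma₄ = solve-∀ ℚ-ring
    lemma₅ : ∀ x y r f → ⟦ 2 ⟧ * (x * y * r * f) ≡ x * f * (r * (⟦ 2 ⟧ * y))
    lemma₅ = solve-∀ ℚ-ring
    transform : ∀ k → binomialTransform f k + recip (suc k) ≡ recip (suc k) * (⟦ 2 ⟧ * ⟦ 2 ⟧ ^ℚ k)
    transform k = *-cancel-suc k (begin
      ⟦ suc k ⟧ * (binomialTransform f k + recip (suc k))
        ≡⟨ lemma₂ ⟦ suc k ⟧ (binomialTransform f k) (recip (suc k)) ⟩
      ⟦ suc k ⟧ * (1ℚ * binomialTransform f k) + ⟦ suc k ⟧ * recip (suc k)
        ≡⟨ cong₂ _+_ (binomialTransform-recip 1ℚ k) (recip-inverse k) ⟩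
      ⟦ 2 ⟧ * ⟦ 2 ⟧ ^ℚ k - 1ℚ + 1ℚ
        ≡⟨ lemma₃ (⟦ 2 ⟧ ^ℚ k) ⟩
      1ℚ * (⟦ 2 ⟧ * ⟦ 2 ⟧ ^ℚ k)
        ≡⟨ cong (_* (⟦ 2 ⟧ * ⟦ 2 ⟧ ^ℚ k)) (recip-inverse k) ⟨
      ⟦ suc k ⟧ * recip (suc k) * (⟦ 2 ⟧ * ⟦ 2 ⟧ ^ℚ k)
        ≡⟨ lemma₄ ⟦ suc k ⟧ (recip (suc k)) (⟦ 2 ⟧ * ⟦ 2 ⟧ ^ℚ k) ⟩
      ⟦ suc k ⟧ * (recip (suc k) * (⟦ 2 ⟧ * ⟦ 2 ⟧ ^ℚ k)) ∎)
    term : ∀ k → ⟦ 2 ⟧ * (m2 ^ℚ k * recip (suc k) * F n k)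
      ≡ m1 ^ℚ k * F n k * binomialTransform f k + m1 ^ℚ k * F n k * recip (suc k)
    term k = begin
      ⟦ 2 ⟧ * (m2 ^ℚ k * recip (suc k) * F n k)
        ≡⟨ cong (λ t → ⟦ 2 ⟧ * (t * recip (suc k) * F n k)) (m2^ k) ⟩
      ⟦ 2 ⟧ * (m1 ^ℚ k * ⟦ 2 ⟧ ^ℚ k * recip (suc k) * F n k)
        ≡⟨ lemma₅ (m1 ^ℚ k) (⟦ 2 ⟧ ^ℚ k) (recip (suc k)) (F n k) ⟩
      m1 ^ℚ k * F n k * (recip (suc k) * (⟦ 2 ⟧ * ⟦ 2 ⟧ ^ℚ k))
        ≡⟨ cong (m1 ^ℚ k * F n k *_) (transform k) ⟨
      m1 ^ℚ k * F n k * (binomialTransform f k + recip (suc k))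
        ≡⟨ ℚₚ.*-distribˡ-+ (m1 ^ℚ k * F n k) (binomialTransform f k) (recip (suc k)) ⟩
      m1 ^ℚ k * F n k * binomialTransform f k + m1 ^ℚ k * F n k * recip (suc k) ∎

  -- Evaluation at the fixed point -1/2 of x ↦ -1 - x; the sum is Pₙ(0).
  Σ-F-½ : Σ[0≤k≤ n ] (λ k → F n k * (- recip 2) ^ℚ k) ≡ 0ℚ
  Σ-F-½ = self-negative _ (begin
    Σ[0≤k≤ n ] (λ k → F n k * (- recip 2) ^ℚ k)
      ≡⟨ Σ-cong n (λ k _ → ≡-trans (cong (F n k *_) (^ℚ-* m1 (recip 2) k)) (lemma (F n k) (m1 ^ℚ k) (recip 2 ^ℚ k))) ⟩
    Σ[0≤k≤ n ] (λ k → m1 ^ℚ k * F n k * recip 2 ^ℚ k)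
      ≡⟨ Σ-cong n (λ k _ → cong (m1 ^ℚ k * F n k *_) (binomialTransform-power (- recip 2) k)) ⟨
    Σ[0≤k≤ n ] (λ k → m1 ^ℚ k * F n k * binomialTransform ((- recip 2) ^ℚ_) k)
      ≡⟨ reflect ((- recip 2) ^ℚ_) ⟩
    m1 * Σ[0≤k≤ n ] (λ k → F n k * (- recip 2) ^ℚ k) ∎)
    where
    lemma : ∀ x y z → x * (y * z) ≡ y * x * z
    lemma = solve-∀ ℚ-ring

-- Congruences between p-integral rationals

module Congruence (p : ℕ) (p-prime : Prime p) where

  -- Wrapped in a record because the bare condition on the denominator does not determine q for
  -- inference.
  record Integral (q : ℚ) : Set where
    constructor integral
    field ∤-denominator : ¬ (p ∣ ↧ₙ q)

  open Integral

  ∤-* : ∀ {a b} → ¬ (p ∣ a) → ¬ (p ∣ b) → ¬ (p ∣ a ℕ.* b)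
  ∤-* {a} {b} p∤a p∤b p∣ab with euclidsLemma a b p-prime p∣ab
  ... | inj₁ p∣a = p∤a p∣a
  ... | inj₂ p∣b = p∤b p∣b

  ∤-small : ∀ {k} → suc k < p → ¬ (p ∣ suc k)
  ∤-small k<p = >⇒∤ k<p

  private
    -- `nf` is the factor lost when a sum or product is brought to lowest terms, so the reduced
    -- denominator divides the product of denominators.
    denominator-∣ : ∀ q a b nf → ↧ q ℤ.* nf ≡ ↧ a ℤ.* ↧ b → ↧ₙ q ∣ ↧ₙ a ℕ.* ↧ₙ b
    denominator-∣ q a b nf eq = divides ℤ.∣ nf ∣ (begin
      ↧ₙ a ℕ.* ↧ₙ b          ≡⟨ ℤₚ.abs-* (↧ a) (↧ b) ⟨
      ℤ.∣ ↧ a ℤ.* ↧ b ∣      ≡⟨ cong ℤ.∣_∣ eq ⟨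
      ℤ.∣ ↧ q ℤ.* nf ∣       ≡⟨ ℤₚ.abs-* (↧ q) nf ⟩
      ↧ₙ q ℕ.* ℤ.∣ nf ∣      ≡⟨ ℕₚ.*-comm (↧ₙ q) ℤ.∣ nf ∣ ⟩
      ℤ.∣ nf ∣ ℕ.* ↧ₙ q      ∎)
      where open ≡-Reasoning

  integral-+ : ∀ {a b} → Integral a → Integral b → Integral (a + b)
  integral-+ {a} {b} (integral p∤a) (integral p∤b) = integral λ p∣ →
    ∤-* p∤a p∤b (∣-trans p∣ (denominator-∣ (a + b) a b _ (ℚₚ.↧-+ a b)))

  integral-* : ∀ {a b} → Integral a → Integral b → Integral (a * b)
  integral-* {a} {b} (integral p∤a) (integral p∤b) = integral λ p∣ →
    ∤-* p∤a p∤b (∣-trans p∣ (denominator-∣ (a * b) a b _ (ℚₚ.↧-* a b)))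

  integral-neg : ∀ {a} → Integral a → Integral (- a)
  integral-neg {a} (integral p∤a) = integral λ p∣ →
    p∤a (subst (p ∣_) (cong ℤ.∣_∣ (ℚₚ.↧-neg a)) p∣)

  p∤1 : ¬ (p ∣ 1)
  p∤1 p∣1 = ¬prime[1] (subst Prime (∣1⇒≡1 p∣1) p-prime)

  integral-ℕ : ∀ a → Integral ⟦ a ⟧
  integral-ℕ a = integral λ p∣ → p∤1 (subst (λ q → p ∣ ↧ₙ q) (⟦⟧-mkℚ a) p∣)

  integral-recip : ∀ {d} → ¬ (p ∣ d) → Integral (recip d)
  integral-recip {zero}  p∤d = integral-ℕ 0
  integral-recip {suc d} p∤d = integral λ p∣ → p∤d (subst (λ q → p ∣ ↧ₙ q)
    (≡-trans (ℚₚ.*-identityˡ ((+ 1) ℚ./ suc d)) (ℚₚ.↥p/↧p≡p (mkℚ (+ 1) d (1-coprimeTo (suc d))))) p∣)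

  integral-^ : ∀ {a} → Integral a → ∀ k → Integral (a ^ℚ k)
  integral-^ ia zero    = integral-ℕ 1
  integral-^ ia (suc k) = integral-* ia (integral-^ ia k)

  integral-m1 : Integral m1
  integral-m1 = integral-neg (integral-ℕ 1)

  infix 4 _≈_[_]
  -- The quotient that the theorem describes through its denominator is carried here as a witness,
  -- so that sums, multiples and cancellations are computations on witnesses.
  record _≈_[_] (a b : ℚ) (m : ℕ) : Set where
    constructor congruent
    field
      quotient          : ℚ
      quotient-integral : Integral quotient
      difference        : a - b ≡ ⟦ p ^ m ⟧ * quotient

  private
    p^m≢0 : ∀ m → ℕ.NonZero (p ^ m)
    p^m≢0 m = ℕₚ.m^n≢0 p m {{prime⇒nonZero p-prime}}

  ≈⇒mod : ∀ {a b m} → a ≈ b [ m ] → a ≡ b [mod p ^ m ]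
  ≈⇒mod {a} {b} {m} (congruent c ic eq) = subst (λ q → ¬ (p ∣ ↧ₙ q)) (≡-sym quotient≡c) (∤-denominator ic)
    where
    open ≡-Reasoning
    lemma : ∀ x y z → x * y * z ≡ x * z * y
    lemma = solve-∀ ℚ-ring
    quotient≡c : (a - b) ÷ℕ (p ^ m) ≡ c
    quotient≡c = begin
      (a - b) ÷ℕ (p ^ m)               ≡⟨ ÷ℕ-recip (a - b) (p ^ m) ⟩
      (a - b) * recip (p ^ m)          ≡⟨ cong (_* recip (p ^ m)) eq ⟩
      ⟦ p ^ m ⟧ * c * recip (p ^ m)    ≡⟨ lemma ⟦ p ^ m ⟧ c (recip (p ^ m)) ⟩
      ⟦ p ^ m ⟧ * recip (p ^ m) * c    ≡⟨ cong (_* c) (recip-inverse′ (p ^ m) {{p^m≢0 m}}) ⟩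
      1ℚ * c                           ≡⟨ ℚₚ.*-identityˡ c ⟩
      c                                ∎

  ≈-reflexive : ∀ {a b m} → a ≡ b → a ≈ b [ m ]
  ≈-reflexive {a} {_} {m} refl = congruent 0ℚ (integral-ℕ 0) (lemma a ⟦ p ^ m ⟧)
    where
    lemma : ∀ a q → a - a ≡ q * 0ℚ
    lemma = solve-∀ ℚ-ring

  ≈-sym : ∀ {a b m} → a ≈ b [ m ] → b ≈ a [ m ]
  ≈-sym {a} {b} {m} (congruent c ic eq) = congruent (- c) (integral-neg ic)
    (≡-trans (lemma₁ a b) (≡-trans (cong -_ eq) (lemma₂ ⟦ p ^ m ⟧ c)))
    where
    lemma₁ : ∀ a b → b - a ≡ - (a - b)
    lemma₁ = solve-∀ ℚ-ring
    lemma₂ : ∀ q c → - (q * c) ≡ q * (- c)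
    lemma₂ = solve-∀ ℚ-ring

  ≈-trans : ∀ {a b c m} → a ≈ b [ m ] → b ≈ c [ m ] → a ≈ c [ m ]
  ≈-trans {a} {b} {c} {m} (congruent x ix eqx) (congruent y iy eqy) = congruent (x + y) (integral-+ ix iy)
    (≡-trans (lemma a b c) (≡-trans (cong₂ _+_ eqx eqy) (≡-sym (ℚₚ.*-distribˡ-+ ⟦ p ^ m ⟧ x y))))
    where
    lemma : ∀ a b c → a - c ≡ (a - b) + (b - c)
    lemma = solve-∀ ℚ-ring

  ≈-setoid : ℕ → Setoid _ _
  ≈-setoid m = record
    { Carrier = ℚ
    ; _≈_ = _≈_[ m ]
    ; isEquivalence = record { refl = ≈-reflexive refl ; sym = ≈-sym ; trans = ≈-trans }
    }

  ≈-+ : ∀ {a b c d m} → a ≈ b [ m ] → c ≈ d [ m ] → a + c ≈ b + d [ m ]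
  ≈-+ {a} {b} {c} {d} {m} (congruent x ix eqx) (congruent y iy eqy) = congruent (x + y) (integral-+ ix iy)
    (≡-trans (lemma a b c d) (≡-trans (cong₂ _+_ eqx eqy) (≡-sym (ℚₚ.*-distribˡ-+ ⟦ p ^ m ⟧ x y))))
    where
    lemma : ∀ a b c d → a + c - (b + d) ≡ (a - b) + (c - d)
    lemma = solve-∀ ℚ-ring

  ≈-* : ∀ {a b m} c → Integral c → a ≈ b [ m ] → c * a ≈ c * b [ m ]
  ≈-* {a} {b} {m} c ic (congruent x ix eq) = congruent (c * x) (integral-* ic ix)
    (≡-trans (lemma₁ a b c) (≡-trans (cong (c *_) eq) (lemma₂ ⟦ p ^ m ⟧ c x)))
    where
    lemma₁ : ∀ a b c → c * a - c * b ≡ c * (a - b)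
    lemma₁ = solve-∀ ℚ-ring
    lemma₂ : ∀ q c x → c * (q * x) ≡ q * (c * x)
    lemma₂ = solve-∀ ℚ-ring

  ≈-Σ : ∀ {m} n {f g : ℕ → ℚ} → (∀ k → k ≤ n → f k ≈ g k [ m ]) → Σ[0≤k≤ n ] f ≈ Σ[0≤k≤ n ] g [ m ]
  ≈-Σ zero    eq = eq 0 z≤n
  ≈-Σ (suc n) eq = ≈-+ (≈-Σ n (λ k k≤n → eq k (ℕₚ.m≤n⇒m≤1+n k≤n))) (eq (suc n) ℕₚ.≤-refl)

  ≈-multiple : ∀ {a b} c → Integral c → a - b ≡ ⟦ p ⟧ * c → a ≈ b [ 1 ]
  ≈-multiple c ic eq = congruent c ic (≡-trans eq (cong (λ t → ⟦ t ⟧ * c) (≡-sym (ℕₚ.*-identityʳ p))))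

  ≈-multiple² : ∀ {a b} c → Integral c → a - b ≡ ⟦ p ⟧ * ⟦ p ⟧ * c → a ≈ b [ 2 ]
  ≈-multiple² c ic eq = congruent c ic (≡-trans eq (cong (_* c)
    (≡-trans (≡-sym (⟦⟧-* p p)) (cong (λ t → ⟦ p ℕ.* t ⟧) (≡-sym (ℕₚ.*-identityʳ p))))))

  ≈-weaken : ∀ {a b} → a ≈ b [ 2 ] → a ≈ b [ 1 ]
  ≈-weaken {a} {b} (congruent c ic eq) = congruent (⟦ p ^ 1 ⟧ * c) (integral-* (integral-ℕ (p ^ 1)) ic)
    (≡-trans eq (≡-trans (cong (λ t → t * c) (⟦⟧-* p (p ^ 1)))
      (≡-trans (ℚₚ.*-assoc ⟦ p ⟧ ⟦ p ^ 1 ⟧ c) (cong (λ t → ⟦ t ⟧ * (⟦ p ^ 1 ⟧ * c)) (≡-sym (ℕₚ.*-identityʳ p))))))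

  -- The way up to p²: once a factor p is explicit, its cofactor matters only modulo p.
  ≈-p* : ∀ {a b} → a ≈ b [ 1 ] → ⟦ p ⟧ * a ≈ ⟦ p ⟧ * b [ 2 ]
  ≈-p* {a} {b} (congruent c ic eq) = congruent c ic
    (≡-trans (lemma ⟦ p ⟧ a b) (≡-trans (cong (⟦ p ⟧ *_) eq)
      (≡-trans (≡-sym (ℚₚ.*-assoc ⟦ p ⟧ ⟦ p ^ 1 ⟧ c)) (cong (_* c) (≡-sym (⟦⟧-* p (p ^ 1)))))))
    where
    lemma : ∀ q a b → q * a - q * b ≡ q * (a - b)
    lemma = solve-∀ ℚ-ring

  -- What is recorded is the integrality of the inverse, since cancelling u means multiplying by it.
  record Unit (u : ℚ) : Set where
    constructor unit
    field
      inverse          : ℚ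
      inverse-integral : Integral inverse
      inverse-law      : u * inverse ≡ 1ℚ

  unit-ℕ : ∀ {d} → ¬ (p ∣ d) → Unit ⟦ d ⟧
  unit-ℕ {zero}  p∤d = contradiction (divides 0 refl) p∤d
  unit-ℕ {suc d} p∤d = unit (recip (suc d)) (integral-recip p∤d) (recip-inverse d)

  unit-* : ∀ {a b} → Unit a → Unit b → Unit (a * b)
  unit-* {a} {b} (unit u iu au≡1) (unit v iv bv≡1) = unit (u * v) (integral-* iu iv)
    (≡-trans (lemma a b u v) (cong₂ _*_ au≡1 bv≡1))
    where
    lemma : ∀ a b u v → a * b * (u * v) ≡ (a * u) * (b * v)
    lemma = solve-∀ ℚ-ring

  unit-divisor : ∀ a b {c} → Integral a → a * b ≡ c → Unit c → Unit b
  unit-divisor a b ia ab≡c (unit v iv cv≡1) = unit (a * v) (integral-* ia iv)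
    (≡-trans (lemma a b v) (≡-trans (cong (_* v) ab≡c) cv≡1))
    where
    lemma : ∀ a b v → b * (a * v) ≡ a * b * v
    lemma = solve-∀ ℚ-ring

  -- Invertibility excludes d = 0, where `recip` has its default value 0.
  unit-recip : ∀ d → Unit ⟦ d ⟧ → ⟦ d ⟧ * recip d ≡ 1ℚ
  unit-recip zero    (unit v _ 0v≡1) = contradiction (≡-trans (≡-sym 0v≡1) (ℚₚ.*-zeroˡ v)) ℚₚ.1≢0
  unit-recip (suc d) _               = recip-inverse d

  ≈-cancel : ∀ {a b m} u → Unit u → u * a ≈ u * b [ m ] → a ≈ b [ m ]
  ≈-cancel {a} {b} {m} u (unit v iv uv≡1) ua≈ub = begin
    a            ≡⟨ undo a ⟨
    v * (u * a)  ≈⟨ ≈-* v iv ua≈ub ⟩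
    v * (u * b)  ≡⟨ undo b ⟩
    b            ∎
    where
    open SetoidReasoning (≈-setoid m)
    lemma : ∀ u v x → v * (u * x) ≡ u * v * x
    lemma = solve-∀ ℚ-ring
    undo : ∀ x → v * (u * x) ≡ x
    undo x = ≡-trans (lemma u v x) (≡-trans (cong (_* x) uv≡1) (ℚₚ.*-identityˡ x))

-- Congruences for the prime p = 2n + 1

module OddPrime (n : ℕ) (p-prime : Prime (suc (n ℕ.+ n))) where

  p : ℕ
  p = suc (n ℕ.+ n)

  open Congruence p p-prime public

  ⟦p⟧ : ⟦ p ⟧ ≡ 1ℚ + (⟦ n ⟧ + ⟦ n ⟧)
  ⟦p⟧ = ≡-trans (⟦⟧-suc (n ℕ.+ n)) (cong (λ t → 1ℚ + t) (⟦⟧-+ n n))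

  p∤2 : ¬ (p ∣ 2)
  p∤2 = go n p-prime
    where
    go : ∀ n → Prime (suc (n ℕ.+ n)) → ¬ (suc (n ℕ.+ n) ∣ 2)
    -- Here p would be 1; for larger n already p > 2.
    go zero    1-prime _ = ¬prime[1] 1-prime
    go (suc n) _         = >⇒∤ (s≤s (s≤s (subst (1 ≤_) (≡-sym (ℕₚ.+-suc n n)) (s≤s z≤n))))

  p∤4 : ¬ (p ∣ 4)
  p∤4 = ∤-* p∤2 p∤2

  p∤8 : ¬ (p ∣ 8)
  p∤8 = ∤-* p∤2 p∤4

  ∤-^ : ∀ {a} → ¬ (p ∣ a) → ∀ k → ¬ (p ∣ a ^ k)
  ∤-^ p∤a zero    = p∤1
  ∤-^ p∤a (suc k) = ∤-* p∤a (∤-^ p∤a k)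

  p∤suc : ∀ k → suc k ≤ n ℕ.+ n → ¬ (p ∣ suc k)
  p∤suc k k<2n = ∤-small (s≤s k<2n)

  ≤n⇒≤2n : ∀ {k} → k ≤ n → k ≤ n ℕ.+ n
  ≤n⇒≤2n k≤n = ℕₚ.≤-trans k≤n (ℕₚ.m≤m+n n n)

  integral-F : ∀ N k → Integral (F N k)
  integral-F N k = integral-* (integral-ℕ (N C k)) (integral-ℕ ((N ℕ.+ k) C N))

  F-zero : ∀ N → F N 0 ≡ 1ℚ
  F-zero N = cong₂ _*_ (binom-zero N) (≡-trans (cong (λ t → binom t N) (ℕₚ.+-identityʳ N)) (binom-diag N))

  -- C(2k,k)² / (-16)ᵏ. Each of the six sums in (i) carries this with weight 1, k or 1 / (k + 1),
  -- times (-2)ᵏ when the base is 8.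
  summand : ℕ → ℚ
  summand k = m1 ^ℚ k * (central k * central k * recip (16 ^ k))

  summand-suc : ∀ k → ⟦ 4 ⟧ * (⟦ suc k ⟧ * ⟦ suc k ⟧) * summand (suc k)
    ≡ - (⟦ suc (2 ℕ.* k) ⟧ * ⟦ suc (2 ℕ.* k) ⟧) * summand k
  summand-suc k = begin
    ⟦ 4 ⟧ * (s * s) * (m1 * x * (c′ * c′ * recip (16 ^ suc k)))
      ≡⟨ cong (λ t → ⟦ 4 ⟧ * (s * s) * (m1 * x * (c′ * c′ * t))) (recip-* 16 (16 ^ k) {{_}} {{ℕₚ.m^n≢0 16 k}}) ⟩
    ⟦ 4 ⟧ * (s * s) * (m1 * x * (c′ * c′ * (recip 16 * y)))
      ≡⟨ lemma₁ s x c′ y ⟩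
    m1 * recip 4 * (x * y) * ((s * c′) * (s * c′))
      ≡⟨ cong (λ t → m1 * recip 4 * (x * y) * (t * t)) (central-suc k) ⟩
    m1 * recip 4 * (x * y) * ((⟦ 2 ⟧ * u * c) * (⟦ 2 ⟧ * u * c))
      ≡⟨ lemma₂ u x c y ⟩
    - (u * u) * (x * (c * c * y)) ∎
    where
    open ≡-Reasoning
    s u x y c c′ : ℚ
    s = ⟦ suc k ⟧
    u = ⟦ suc (2 ℕ.* k) ⟧
    x = m1 ^ℚ k
    y = recip (16 ^ k)
    c = central k
    c′ = central (suc k)
    lemma₁ : ∀ s x c y → ⟦ 4 ⟧ * (s * s) * (m1 * x * (c * c * (recip 16 * y))) ≡ m1 * recip 4 * (x * y) * ((s * c) * (s * c))
    lemma₁ = solve-∀ ℚ-ring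
    lemma₂ : ∀ u x c y → m1 * recip 4 * (x * y) * ((⟦ 2 ⟧ * u * c) * (⟦ 2 ⟧ * u * c)) ≡ - (u * u) * (x * (c * c * y))
    lemma₂ = solve-∀ ℚ-ring

  F-suc-p : ∀ k → ⟦ 4 ⟧ * (⟦ suc k ⟧ * ⟦ suc k ⟧) * F n (suc k)
    ≡ (⟦ p ⟧ * ⟦ p ⟧ - ⟦ suc (2 ℕ.* k) ⟧ * ⟦ suc (2 ℕ.* k) ⟧) * F n k
  F-suc-p k = begin
    ⟦ 4 ⟧ * (⟦ suc k ⟧ * ⟦ suc k ⟧) * F n (suc k)
      ≡⟨ ℚₚ.*-assoc ⟦ 4 ⟧ (⟦ suc k ⟧ * ⟦ suc k ⟧) (F n (suc k)) ⟩
    ⟦ 4 ⟧ * (⟦ suc k ⟧ * ⟦ suc k ⟧ * F n (suc k))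
      ≡⟨ cong (⟦ 4 ⟧ *_) (F-suc n k) ⟩
    ⟦ 4 ⟧ * ((⟦ n ⟧ - ⟦ k ⟧) * ⟦ suc (n ℕ.+ k) ⟧ * F n k)
      ≡⟨ cong (λ t → ⟦ 4 ⟧ * ((⟦ n ⟧ - ⟦ k ⟧) * t * F n k)) (≡-trans (⟦⟧-suc (n ℕ.+ k)) (cong (λ t → 1ℚ + t) (⟦⟧-+ n k))) ⟩
    ⟦ 4 ⟧ * ((⟦ n ⟧ - ⟦ k ⟧) * (1ℚ + (⟦ n ⟧ + ⟦ k ⟧)) * F n k)
      ≡⟨ lemma ⟦ n ⟧ ⟦ k ⟧ (F n k) ⟩
    ((1ℚ + (⟦ n ⟧ + ⟦ n ⟧)) * (1ℚ + (⟦ n ⟧ + ⟦ n ⟧)) - (1ℚ + ⟦ 2 ⟧ * ⟦ k ⟧) * (1ℚ + ⟦ 2 ⟧ * ⟦ k ⟧)) * F n k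
      ≡⟨ cong₂ (λ s t → (s * s - t * t) * F n k) ⟦p⟧ (≡-trans (⟦⟧-suc (2 ℕ.* k)) (cong (λ t → 1ℚ + t) (⟦⟧-* 2 k))) ⟨
    (⟦ p ⟧ * ⟦ p ⟧ - ⟦ suc (2 ℕ.* k) ⟧ * ⟦ suc (2 ℕ.* k) ⟧) * F n k ∎
    where
    open ≡-Reasoning
    lemma : ∀ n k f → ⟦ 4 ⟧ * ((n - k) * (1ℚ + (n + k)) * f)
      ≡ ((1ℚ + (n + n)) * (1ℚ + (n + n)) - (1ℚ + ⟦ 2 ⟧ * k) * (1ℚ + ⟦ 2 ⟧ * k)) * f
    lemma = solve-∀ ℚ-ring

  -- The recurrences of the two sequences have the same left factor 4(k + 1)², a unit for k + 1 ≤ n,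
  -- and right factors that differ by exactly p².
  summand-≈ : ∀ k → k ≤ n → summand k ≈ F n k [ 2 ]
  summand-≈ zero    _     = ≈-reflexive (≡-sym (F-zero n))
  summand-≈ (suc k) 1+k≤n = ≈-cancel (⟦ 4 ⟧ * (⟦ suc k ⟧ * ⟦ suc k ⟧))
    (unit-* (unit-ℕ p∤4) (unit-* (unit-ℕ p∤1+k) (unit-ℕ p∤1+k))) (begin
    ⟦ 4 ⟧ * (⟦ suc k ⟧ * ⟦ suc k ⟧) * summand (suc k)  ≡⟨ summand-suc k ⟩
    - (u * u) * summand k                              ≈⟨ ≈-* (- (u * u)) (integral-neg (integral-* iu iu)) (summand-≈ k (ℕₚ.<⇒≤ 1+k≤n)) ⟩
    - (u * u) * F n k                                  ≈⟨ ≈-multiple² (- F n k) (integral-neg (integral-F n k)) (lemma ⟦ p ⟧ u (F n k)) ⟩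
    (⟦ p ⟧ * ⟦ p ⟧ - u * u) * F n k                    ≡⟨ F-suc-p k ⟨
    ⟦ 4 ⟧ * (⟦ suc k ⟧ * ⟦ suc k ⟧) * F n (suc k)      ∎)
    where
    open SetoidReasoning (≈-setoid 2)
    u : ℚ
    u = ⟦ suc (2 ℕ.* k) ⟧
    iu : Integral u
    iu = integral-ℕ (suc (2 ℕ.* k))
    p∤1+k : ¬ (p ∣ suc k)
    p∤1+k = p∤suc k (≤n⇒≤2n 1+k≤n)
    lemma : ∀ p u f → - (u * u) * f - (p * p - u * u) * f ≡ p * p * (- f)
    lemma = solve-∀ ℚ-ring

  Σ-summand-≈ : ∀ (a : ℕ → ℚ) → (∀ k → k ≤ n → Integral (a k)) →
    Σ[0≤k≤ n ] (λ k → a k * summand k) ≈ Σ[0≤k≤ n ] (λ k → a k * F n k) [ 2 ]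
  Σ-summand-≈ a ia = ≈-Σ n (λ k k≤n → ≈-* (a k) (ia k k≤n) (summand-≈ k k≤n))

  recip-8^ : ∀ k → recip (8 ^ k) ≡ m2 ^ℚ k * (m1 ^ℚ k * recip (16 ^ k))
  recip-8^ k = begin
    recip (8 ^ k)                             ≡⟨ recip-^ 8 k ⟩
    -- `recip 8` and (-2)(-1)(1/16) evaluate to the same closed rational.
    (m2 * (m1 * recip 16)) ^ℚ k               ≡⟨ ^ℚ-* m2 (m1 * recip 16) k ⟩
    m2 ^ℚ k * (m1 * recip 16) ^ℚ k            ≡⟨ cong (m2 ^ℚ k *_) (^ℚ-* m1 (recip 16) k) ⟩
    m2 ^ℚ k * (m1 ^ℚ k * recip 16 ^ℚ k)       ≡⟨ cong (λ t → m2 ^ℚ k * (m1 ^ℚ k * t)) (recip-^ 16 k) ⟨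
    m2 ^ℚ k * (m1 ^ℚ k * recip (16 ^ k))      ∎
    where open ≡-Reasoning

  -- The sums with C(2k,k+d), for n - d odd

  module Shifted (d : ℕ) (d≤n : d ≤ n) (odd : m1 ^ℚ (n ∸ d) ≡ m1) where

    N : ℕ
    N = n ∸ d

    t u : ℕ → ℚ
    t k = central k * binom (2 ℕ.* k) (k ℕ.+ d) * recip (8 ^ k)
    u i = F N i * (- recip 2) ^ℚ i

    integral-t : ∀ k → Integral (t k)
    integral-t k = integral-* (integral-* (integral-ℕ ((2 ℕ.* k) C k)) (integral-ℕ ((2 ℕ.* k) C (k ℕ.+ d))))
      (integral-recip (∤-^ p∤8 k))

    integral-u : ∀ i → Integral (u i)
    integral-u i = integral-* (integral-F N i) (integral-^ (integral-neg (integral-recip p∤2)) i)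

    -- The left factor vanishes at k + 1 = d, so the recurrence is used downwards, from k + 1 to k,
    -- where (2k + 1)² has to be cancelled.
    t-suc : ∀ k → ⟦ 2 ⟧ * (⟦ suc (k ℕ.+ d) ⟧ * (⟦ suc k ⟧ - ⟦ d ⟧)) * t (suc k)
      ≡ ⟦ suc (2 ℕ.* k) ⟧ * ⟦ suc (2 ℕ.* k) ⟧ * t k
    t-suc k = *-cancel-suc k (begin
      s * (⟦ 2 ⟧ * A * (c′ * b′ * recip (8 ^ suc k)))
        ≡⟨ cong (λ z → s * (⟦ 2 ⟧ * A * (c′ * b′ * z))) (recip-* 8 (8 ^ k) {{_}} {{ℕₚ.m^n≢0 8 k}}) ⟩
      s * (⟦ 2 ⟧ * A * (c′ * b′ * (recip 8 * y)))
        ≡⟨ lemma₁ s A c′ b′ y ⟩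
      recip 4 * y * ((s * c′) * (A * b′))
        ≡⟨ cong₂ (λ x z → recip 4 * y * (x * z)) (central-suc k) (binom-double-suc k d) ⟩
      recip 4 * y * ((⟦ 2 ⟧ * τ * c) * ((⟦ 2 ⟧ * s * τ) * b))
        ≡⟨ lemma₂ s τ c b y ⟩
      s * (τ * τ * (c * b * y)) ∎)
      where
      open ≡-Reasoning
      s τ A c c′ b b′ y : ℚ
      s = ⟦ suc k ⟧
      τ = ⟦ suc (2 ℕ.* k) ⟧
      A = ⟦ suc (k ℕ.+ d) ⟧ * (⟦ suc k ⟧ - ⟦ d ⟧)
      c = central k
      c′ = central (suc k)
      b = binom (2 ℕ.* k) (k ℕ.+ d)
      b′ = binom (2 ℕ.* suc k) (suc k ℕ.+ d)
      y = recip (8 ^ k)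
      lemma₁ : ∀ s A c b y → s * (⟦ 2 ⟧ * A * (c * b * (recip 8 * y))) ≡ recip 4 * y * ((s * c) * (A * b))
      lemma₁ = solve-∀ ℚ-ring
      lemma₂ : ∀ s τ c b y → recip 4 * y * ((⟦ 2 ⟧ * τ * c) * ((⟦ 2 ⟧ * s * τ) * b)) ≡ s * (τ * τ * (c * b * y))
      lemma₂ = solve-∀ ℚ-ring

    u-suc : ∀ i → ⟦ 4 ⟧ * (⟦ suc i ⟧ * ⟦ suc i ⟧) * u (suc i)
      ≡ m2 * ((⟦ N ⟧ - ⟦ i ⟧) * ⟦ suc (N ℕ.+ i) ⟧) * u i
    u-suc i = begin
      ⟦ 4 ⟧ * (s * s) * (F N (suc i) * (- recip 2 * x))
        ≡⟨ lemma₁ s (F N (suc i)) x ⟩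
      m2 * x * (s * s * F N (suc i))
        ≡⟨ cong (m2 * x *_) (F-suc N i) ⟩
      m2 * x * ((⟦ N ⟧ - ⟦ i ⟧) * ⟦ suc (N ℕ.+ i) ⟧ * F N i)
        ≡⟨ lemma₂ ((⟦ N ⟧ - ⟦ i ⟧) * ⟦ suc (N ℕ.+ i) ⟧) (F N i) x ⟩
      m2 * ((⟦ N ⟧ - ⟦ i ⟧) * ⟦ suc (N ℕ.+ i) ⟧) * (F N i * x) ∎
      where
      open ≡-Reasoning
      s x : ℚ
      s = ⟦ suc i ⟧
      x = (- recip 2) ^ℚ i
      lemma₁ : ∀ s f x → ⟦ 4 ⟧ * (s * s) * (f * (- recip 2 * x)) ≡ m2 * x * (s * s * f)
      lemma₁ = solve-∀ ℚ-ring
      lemma₂ : ∀ a f x → m2 * x * (a * f) ≡ m2 * a * (f * x)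
      lemma₂ = solve-∀ ℚ-ring

    -- Counted from the top, the summands are Legendre coefficients of the odd degree N at the centre of symmetry.
    t-≈ : ∀ i k → i ℕ.+ k ≡ n → t k ≈ t n * u i [ 1 ]
    t-≈ zero    k refl = ≈-reflexive (≡-sym (≡-trans (cong (λ z → t n * (z * 1ℚ)) (F-zero N)) (ℚₚ.*-identityʳ (t n))))
    t-≈ (suc i) k eq   = ≈-cancel (⟦ 4 ⟧ * (a * a)) (unit-* (unit-ℕ p∤4) (unit-* (unit-ℕ p∤1+i) (unit-ℕ p∤1+i))) (begin
      ⟦ 4 ⟧ * (a * a) * t k
        -- Since i + 1 + k = n, 2k + 1 = p - 2(i + 1), and the quotient comes from 4a² - (p - 2a)² =
        -- p (4a - p).
        ≈⟨ ≈-multiple ((⟦ 4 ⟧ * a - ⟦ p ⟧) * t k)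
             (integral-* (integral-+ (integral-* (integral-ℕ 4) (integral-ℕ (suc i))) (integral-neg (integral-ℕ p))) (integral-t k))
             (≡-trans (cong (λ z → ⟦ 4 ⟧ * (a * a) * t k - z * z * t k) τ≡) (lemma₁ ⟦ p ⟧ a (t k))) ⟩
      τ * τ * t k
        ≡⟨ t-suc k ⟨
      ⟦ 2 ⟧ * (⟦ suc (k ℕ.+ d) ⟧ * (⟦ suc k ⟧ - ⟦ d ⟧)) * t (suc k)
        ≈⟨ ≈-* (⟦ 2 ⟧ * (⟦ suc (k ℕ.+ d) ⟧ * (⟦ suc k ⟧ - ⟦ d ⟧)))
             (integral-* (integral-ℕ 2) (integral-* (integral-ℕ (suc (k ℕ.+ d))) (integral-+ (integral-ℕ (suc k)) (integral-neg (integral-ℕ d)))))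
             (t-≈ i (suc k) (≡-trans (ℕₚ.+-suc i k) eq)) ⟩
      ⟦ 2 ⟧ * (⟦ suc (k ℕ.+ d) ⟧ * (⟦ suc k ⟧ - ⟦ d ⟧)) * (t n * u i)
        -- Here k + d + 1 = p - (N + i + 1) and k + 1 - d = N - i, so modulo p the coefficient
        -- becomes the one in `u-suc`.
        ≡⟨ cong₂ (λ y z → ⟦ 2 ⟧ * (y * z) * (t n * u i)) high low ⟩
      ⟦ 2 ⟧ * ((⟦ p ⟧ - q) * g) * (t n * u i)
        ≈⟨ ≈-multiple (⟦ 2 ⟧ * g * (t n * u i))
             (integral-* (integral-* (integral-ℕ 2) (integral-+ (integral-ℕ N) (integral-neg (integral-ℕ i)))) (integral-* (integral-t n) (integral-u i)))
             (lemma₂ ⟦ p ⟧ q g (t n) (u i)) ⟩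
      t n * (m2 * (g * q) * u i)
        ≡⟨ cong (t n *_) (u-suc i) ⟨
      t n * (⟦ 4 ⟧ * (a * a) * u (suc i))
        ≡⟨ lemma₃ (t n) (⟦ 4 ⟧ * (a * a)) (u (suc i)) ⟩
      ⟦ 4 ⟧ * (a * a) * (t n * u (suc i)) ∎)
      where
      open SetoidReasoning (≈-setoid 1)
      a τ q g : ℚ
      a = ⟦ suc i ⟧
      τ = ⟦ suc (2 ℕ.* k) ⟧
      q = ⟦ suc (N ℕ.+ i) ⟧
      g = ⟦ N ⟧ - ⟦ i ⟧
      1+i≤n : suc i ≤ n
      1+i≤n = subst (suc i ≤_) eq (ℕₚ.m≤m+n (suc i) k)
      p∤1+i : ¬ (p ∣ suc i)
      p∤1+i = p∤suc i (≤n⇒≤2n 1+i≤n)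
      lemma₁ : ∀ p a x → ⟦ 4 ⟧ * (a * a) * x - (p - ⟦ 2 ⟧ * a) * (p - ⟦ 2 ⟧ * a) * x ≡ p * ((⟦ 4 ⟧ * a - p) * x)
      lemma₁ = solve-∀ ℚ-ring
      lemma₂ : ∀ p q g x y → ⟦ 2 ⟧ * ((p - q) * g) * (x * y) - x * (m2 * (g * q) * y) ≡ p * (⟦ 2 ⟧ * g * (x * y))
      lemma₂ = solve-∀ ℚ-ring
      lemma₃ : ∀ x c y → x * (c * y) ≡ c * (x * y)
      lemma₃ = solve-∀ ℚ-ring
      n≡ : ⟦ n ⟧ ≡ 1ℚ + ⟦ i ⟧ + ⟦ k ⟧
      n≡ = ≡-trans (cong ⟦_⟧ (≡-sym eq)) (≡-trans (⟦⟧-+ (suc i) k) (cong (_+ ⟦ k ⟧) (⟦⟧-suc i)))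
      p≡ : ⟦ p ⟧ ≡ 1ℚ + ((1ℚ + ⟦ i ⟧ + ⟦ k ⟧) + (1ℚ + ⟦ i ⟧ + ⟦ k ⟧))
      p≡ = ≡-trans ⟦p⟧ (cong (λ z → 1ℚ + (z + z)) n≡)
      N≡ : ⟦ N ⟧ ≡ 1ℚ + ⟦ i ⟧ + ⟦ k ⟧ - ⟦ d ⟧
      N≡ = ≡-trans (⟦⟧-∸ d≤n) (cong (_- ⟦ d ⟧) n≡)
      q≡ : q ≡ 1ℚ + (1ℚ + ⟦ i ⟧ + ⟦ k ⟧ - ⟦ d ⟧ + ⟦ i ⟧)
      q≡ = ≡-trans (⟦⟧-suc (N ℕ.+ i)) (cong (λ z → 1ℚ + z) (≡-trans (⟦⟧-+ N i) (cong (_+ ⟦ i ⟧) N≡)))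
      lemma₄ : ∀ i k → 1ℚ + ⟦ 2 ⟧ * k ≡ 1ℚ + ((1ℚ + i + k) + (1ℚ + i + k)) - ⟦ 2 ⟧ * (1ℚ + i)
      lemma₄ = solve-∀ ℚ-ring
      lemma₅ : ∀ i k d → 1ℚ + (k + d) ≡ 1ℚ + ((1ℚ + i + k) + (1ℚ + i + k)) - (1ℚ + (1ℚ + i + k - d + i))
      lemma₅ = solve-∀ ℚ-ring
      lemma₆ : ∀ i k d → 1ℚ + k - d ≡ 1ℚ + i + k - d - i
      lemma₆ = solve-∀ ℚ-ring
      τ≡ : τ ≡ ⟦ p ⟧ - ⟦ 2 ⟧ * a
      τ≡ = ≡-trans (⟦⟧-suc (2 ℕ.* k)) (≡-trans (cong (λ z → 1ℚ + z) (⟦⟧-* 2 k)) (≡-trans (lemma₄ ⟦ i ⟧ ⟦ k ⟧)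
        (cong₂ (λ y z → y - ⟦ 2 ⟧ * z) (≡-sym p≡) (≡-sym (⟦⟧-suc i)))))
      high : ⟦ suc (k ℕ.+ d) ⟧ ≡ ⟦ p ⟧ - q
      high = ≡-trans (⟦⟧-suc (k ℕ.+ d)) (≡-trans (cong (λ z → 1ℚ + z) (⟦⟧-+ k d)) (≡-trans (lemma₅ ⟦ i ⟧ ⟦ k ⟧ ⟦ d ⟧)
        (cong₂ _-_ (≡-sym p≡) (≡-sym q≡))))
      low : ⟦ suc k ⟧ - ⟦ d ⟧ ≡ g
      low = ≡-trans (cong (_- ⟦ d ⟧) (⟦⟧-suc k)) (≡-trans (lemma₆ ⟦ i ⟧ ⟦ k ⟧ ⟦ d ⟧) (cong (_- ⟦ i ⟧) (≡-sym N≡)))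

    -- Modulo p the sum is `t n` times the value at 0 of the Legendre polynomial of odd degree N.
    Σ-t-≈ : Σ[0≤k≤ n ] t ≈ 0ℚ [ 1 ]
    Σ-t-≈ = begin
      Σ[0≤k≤ n ] t                    ≡⟨ Σ-reverse n t ⟩
      Σ[0≤k≤ n ] (λ i → t (n ∸ i))    ≈⟨ ≈-Σ n (λ i i≤n → t-≈ i (n ∸ i) (ℕₚ.m+[n∸m]≡n i≤n)) ⟩
      Σ[0≤k≤ n ] (λ i → t n * u i)    ≡⟨ Σ-distribˡ n (t n) u ⟨
      t n * Σ[0≤k≤ n ] u              ≡⟨ cong (λ s → t n * Σ[0≤k≤ s ] u) (ℕₚ.m+[n∸m]≡n d≤n) ⟨
      t n * Σ[0≤k≤ d ℕ.+ N ] u        ≡⟨ cong (t n *_) (Σ-truncate N d u (λ k N<k → ≡-trans (cong (_* (- recip 2) ^ℚ k) (F-over N<k)) (ℚₚ.*-zeroˡ ((- recip 2) ^ℚ k)))) ⟩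
      t n * Σ[0≤k≤ N ] u              ≡⟨ cong (t n *_) (OddReflection.Σ-F-½ N odd) ⟩
      t n * 0ℚ                        ≡⟨ ℚₚ.*-zeroʳ (t n) ⟩
      0ℚ                              ∎
      where open SetoidReasoning (≈-setoid 1)

  -- Fermat's little theorem for the base 2

  -- In the ratio of consecutive coefficients, p - 1 - k ≡ -(k + 1).
  binom-p-1 : ∀ k → k ≤ n ℕ.+ n → binom (n ℕ.+ n) k ≈ m1 ^ℚ k [ 1 ]
  binom-p-1 zero    _    = ≈-reflexive (binom-zero (n ℕ.+ n))
  binom-p-1 (suc k) k<2n = ≈-cancel ⟦ suc k ⟧ (unit-ℕ (p∤suc k k<2n)) (begin
    ⟦ suc k ⟧ * binom (n ℕ.+ n) (suc k)              ≡⟨ binom-lower (n ℕ.+ n) k ⟩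
    (⟦ n ℕ.+ n ⟧ - ⟦ k ⟧) * binom (n ℕ.+ n) k        ≈⟨ ≈-* (⟦ n ℕ.+ n ⟧ - ⟦ k ⟧) (integral-+ (integral-ℕ (n ℕ.+ n)) (integral-neg (integral-ℕ k))) (binom-p-1 k (ℕₚ.<⇒≤ k<2n)) ⟩
    (⟦ n ℕ.+ n ⟧ - ⟦ k ⟧) * m1 ^ℚ k                  ≈⟨ ≈-multiple (m1 ^ℚ k) (integral-^ integral-m1 k) (≡-trans (lemma ⟦ n ℕ.+ n ⟧ ⟦ k ⟧ (m1 ^ℚ k)) (cong (_* m1 ^ℚ k) (≡-sym (⟦⟧-suc (n ℕ.+ n))))) ⟩
    (1ℚ + ⟦ k ⟧) * (m1 * m1 ^ℚ k)                    ≡⟨ cong (_* (m1 * m1 ^ℚ k)) (⟦⟧-suc k) ⟨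
    ⟦ suc k ⟧ * m1 ^ℚ suc k                          ∎)
    where
    open SetoidReasoning (≈-setoid 1)
    lemma : ∀ n k x → (n - k) * x - (1ℚ + k) * (m1 * x) ≡ (1ℚ + n) * x
    lemma = solve-∀ ℚ-ring

  Σ-m1^ : ∀ r → ⟦ 2 ⟧ * Σ[0≤k≤ r ] (m1 ^ℚ_) ≡ 1ℚ + m1 ^ℚ r
  Σ-m1^ zero    = refl
  Σ-m1^ (suc r) = ≡-trans (ℚₚ.*-distribˡ-+ ⟦ 2 ⟧ (Σ[0≤k≤ r ] (m1 ^ℚ_)) (m1 ^ℚ suc r))
    (≡-trans (cong (_+ ⟦ 2 ⟧ * m1 ^ℚ suc r) (Σ-m1^ r)) (lemma (m1 ^ℚ r)))
    where
    lemma : ∀ x → 1ℚ + x + ⟦ 2 ⟧ * (m1 * x) ≡ 1ℚ + m1 * x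
    lemma = solve-∀ ℚ-ring

  -- Expand (1 + 1)ᵖ⁻¹: modulo p the terms alternate 1, -1, ..., 1, an odd number of them.
  2^[p-1] : ⟦ 2 ⟧ ^ℚ (n ℕ.+ n) ≈ 1ℚ [ 1 ]
  2^[p-1] = begin
    ⟦ 2 ⟧ ^ℚ (n ℕ.+ n)                                          ≡⟨ binomialTransform-power 1ℚ (n ℕ.+ n) ⟨
    binomialTransform (1ℚ ^ℚ_) (n ℕ.+ n)                        ≡⟨ binomialTransform-Σ (1ℚ ^ℚ_) (n ℕ.+ n) (n ℕ.+ n) ℕₚ.≤-refl ⟩
    Σ[0≤k≤ n ℕ.+ n ] (λ k → binom (n ℕ.+ n) k * 1ℚ ^ℚ k)        ≡⟨ Σ-cong (n ℕ.+ n) (λ k _ → ≡-trans (cong (binom (n ℕ.+ n) k *_) (1^ℚ k)) (ℚₚ.*-identityʳ (binom (n ℕ.+ n) k))) ⟩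
    Σ[0≤k≤ n ℕ.+ n ] (binom (n ℕ.+ n))                          ≈⟨ ≈-Σ (n ℕ.+ n) binom-p-1 ⟩
    Σ[0≤k≤ n ℕ.+ n ] (m1 ^ℚ_)                                   ≡⟨ *-cancel-suc 1 (≡-trans (Σ-m1^ (n ℕ.+ n)) (cong (λ t → 1ℚ + t) (≡-trans (^ℚ-+ m1 n n) (m1^-involutive n)))) ⟩
    1ℚ                                                          ∎
    where open SetoidReasoning (≈-setoid 1)

  -- Reduction modulo p

  -- In the recurrence, n + k + 1 ≡ -(n - k), because 2n + 1 = p.
  negbinom-≈ : ∀ k → k ≤ n → negbinom n k ≈ m1 ^ℚ k * binom n k [ 1 ]
  negbinom-≈ zero    _     = ≈-reflexive (≡-trans (cong (λ t → binom t n) (ℕₚ.+-identityʳ n)) (≡-trans (binom-diag n) (≡-sym (cong (1ℚ *_) (binom-zero n)))))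
  negbinom-≈ (suc k) 1+k≤n = ≈-cancel ⟦ suc k ⟧ (unit-ℕ (p∤suc k (≤n⇒≤2n 1+k≤n))) (begin
    ⟦ suc k ⟧ * negbinom n (suc k)
      ≡⟨ negbinom-suc n k ⟩
    ⟦ suc (n ℕ.+ k) ⟧ * negbinom n k
      ≈⟨ ≈-* ⟦ suc (n ℕ.+ k) ⟧ (integral-ℕ (suc (n ℕ.+ k))) (negbinom-≈ k (ℕₚ.<⇒≤ 1+k≤n)) ⟩
    ⟦ suc (n ℕ.+ k) ⟧ * (m1 ^ℚ k * binom n k)
      ≈⟨ ≈-multiple (m1 ^ℚ k * binom n k) (integral-* (integral-^ integral-m1 k) (integral-ℕ (n C k))) difference ⟩
    m1 * m1 ^ℚ k * ((⟦ n ⟧ - ⟦ k ⟧) * binom n k)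
      ≡⟨ cong (m1 * m1 ^ℚ k *_) (binom-lower n k) ⟨
    m1 * m1 ^ℚ k * (⟦ suc k ⟧ * binom n (suc k))
      ≡⟨ lemma₂ (m1 * m1 ^ℚ k) ⟦ suc k ⟧ (binom n (suc k)) ⟩
    ⟦ suc k ⟧ * (m1 ^ℚ suc k * binom n (suc k)) ∎)
    where
    open SetoidReasoning (≈-setoid 1)
    lemma₁ : ∀ n k x b → (1ℚ + (n + k)) * (x * b) - m1 * x * ((n - k) * b) ≡ (1ℚ + (n + n)) * (x * b)
    lemma₁ = solve-∀ ℚ-ring
    lemma₂ : ∀ x s b → x * (s * b) ≡ s * (x * b)
    lemma₂ = solve-∀ ℚ-ring
    difference : ⟦ suc (n ℕ.+ k) ⟧ * (m1 ^ℚ k * binom n k) - m1 * m1 ^ℚ k * ((⟦ n ⟧ - ⟦ k ⟧) * binom n k) ≡ ⟦ p ⟧ * (m1 ^ℚ k * binom n k)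
    difference = ≡-trans (cong (λ s → s * (m1 ^ℚ k * binom n k) - m1 * m1 ^ℚ k * ((⟦ n ⟧ - ⟦ k ⟧) * binom n k))
        (≡-trans (⟦⟧-suc (n ℕ.+ k)) (cong (λ t → 1ℚ + t) (⟦⟧-+ n k))))
      (≡-trans (lemma₁ ⟦ n ⟧ ⟦ k ⟧ (m1 ^ℚ k) (binom n k)) (cong (_* (m1 ^ℚ k * binom n k)) (≡-sym ⟦p⟧)))

  Σ-F-≈ : ∀ (a : ℕ → ℚ) → (∀ k → k ≤ n → Integral (a k)) →
    Σ[0≤k≤ n ] (λ k → a k * F n k) ≈ Σ[0≤k≤ n ] (λ k → a k * binom n k * (m1 ^ℚ k * binom n k)) [ 1 ]
  Σ-F-≈ a ia = ≈-Σ n λ k k≤n → ≈-trans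
    (≈-reflexive (≡-sym (ℚₚ.*-assoc (a k) (binom n k) (negbinom n k))))
    (≈-* (a k * binom n k) (integral-* (ia k k≤n) (integral-ℕ (n C k))) (negbinom-≈ k k≤n))

  -- By the central recurrence (k + 1) C(2k+2,k+1) is a product of units, as 2k + 1 < p; a factor of
  -- a unit with integral cofactor is a unit.
  unit-central : ∀ k → k ≤ n → Unit (central k)
  unit-central zero    _     = unit-ℕ p∤1
  unit-central (suc k) 1+k≤n = unit-divisor ⟦ suc k ⟧ (central (suc k)) (integral-ℕ (suc k)) (central-suc k)
    (unit-* (unit-* (unit-ℕ p∤2) (unit-ℕ (p∤suc (2 ℕ.* k) 1+2k≤2n))) (unit-central k (ℕₚ.<⇒≤ 1+k≤n)))
    where
    1+2k≤2n : suc (2 ℕ.* k) ≤ n ℕ.+ n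
    1+2k≤2n = ℕₚ.+-mono-≤ 1+k≤n (subst (_≤ n) (≡-sym (ℕₚ.+-identityʳ k)) (ℕₚ.<⇒≤ 1+k≤n))

  -- The ratio of consecutive terms is (p + l + 1) / (l + 1) ≡ 1.
  negbinom-p-≈ : ∀ l → l ≤ n → negbinom p l ≈ 1ℚ [ 1 ]
  negbinom-p-≈ zero    _     = ≈-reflexive (≡-trans (cong (λ t → binom t p) (ℕₚ.+-identityʳ p)) (binom-diag p))
  negbinom-p-≈ (suc l) 1+l≤n = ≈-cancel ⟦ suc l ⟧ (unit-ℕ (p∤suc l (≤n⇒≤2n 1+l≤n))) (begin
    ⟦ suc l ⟧ * negbinom p (suc l)      ≡⟨ negbinom-suc p l ⟩
    ⟦ suc (p ℕ.+ l) ⟧ * negbinom p l    ≈⟨ ≈-* ⟦ suc (p ℕ.+ l) ⟧ (integral-ℕ (suc (p ℕ.+ l))) (negbinom-p-≈ l (ℕₚ.<⇒≤ 1+l≤n)) ⟩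
    ⟦ suc (p ℕ.+ l) ⟧ * 1ℚ              ≈⟨ ≈-multiple 1ℚ (integral-ℕ 1) (≡-trans (cong (λ t → t * 1ℚ - ⟦ suc l ⟧ * 1ℚ) (≡-trans (cong ⟦_⟧ (≡-sym (ℕₚ.+-suc p l))) (⟦⟧-+ p (suc l)))) (lemma ⟦ p ⟧ ⟦ suc l ⟧)) ⟩
    ⟦ suc l ⟧ * 1ℚ                      ∎)
    where
    open SetoidReasoning (≈-setoid 1)
    lemma : ∀ p l → (p + l) * 1ℚ - l * 1ℚ ≡ p * 1ℚ
    lemma = solve-∀ ℚ-ring

  -- The factor p in the coefficients of (1 - x)⁻ᵖ past the constant one: (l + 1) C(2n+l+1,2n) = p
  -- C(p+l,p), and the last binomial is needed only modulo p.
  negbinom-2n-≈ : ∀ l → suc l ≤ n → negbinom (n ℕ.+ n) (suc l) ≈ ⟦ p ⟧ * recip (suc l) [ 2 ]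
  negbinom-2n-≈ l 1+l≤n = ≈-cancel ⟦ suc l ⟧ (unit-ℕ (p∤suc l (≤n⇒≤2n 1+l≤n))) (begin
    ⟦ suc l ⟧ * negbinom (n ℕ.+ n) (suc l)
      ≡⟨ cong (_* negbinom (n ℕ.+ n) (suc l)) (≡-trans (lemma₁ ⟦ n ℕ.+ n ⟧ ⟦ suc l ⟧) (cong (_- ⟦ n ℕ.+ n ⟧) (≡-sym (⟦⟧-+ (n ℕ.+ n) (suc l))))) ⟩
    (⟦ n ℕ.+ n ℕ.+ suc l ⟧ - ⟦ n ℕ.+ n ⟧) * binom (n ℕ.+ n ℕ.+ suc l) (n ℕ.+ n)
      ≡⟨ binom-lower (n ℕ.+ n ℕ.+ suc l) (n ℕ.+ n) ⟨
    ⟦ p ⟧ * binom (n ℕ.+ n ℕ.+ suc l) p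
      ≡⟨ cong (λ t → ⟦ p ⟧ * binom t p) (ℕₚ.+-suc (n ℕ.+ n) l) ⟩
    ⟦ p ⟧ * negbinom p l
      ≈⟨ ≈-p* (negbinom-p-≈ l (ℕₚ.<⇒≤ 1+l≤n)) ⟩
    ⟦ p ⟧ * 1ℚ
      ≡⟨ cong (⟦ p ⟧ *_) (recip-inverse l) ⟨
    ⟦ p ⟧ * (⟦ suc l ⟧ * recip (suc l))
      ≡⟨ lemma₂ ⟦ p ⟧ ⟦ suc l ⟧ (recip (suc l)) ⟩
    ⟦ suc l ⟧ * (⟦ p ⟧ * recip (suc l)) ∎)
    where
    open SetoidReasoning (≈-setoid 2)
    lemma₁ : ∀ n l → l ≡ n + l - n
    lemma₁ = solve-∀ ℚ-ring
    lemma₂ : ∀ x s b → x * (s * b) ≡ s * (x * b)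
    lemma₂ = solve-∀ ℚ-ring

-- Evaluation of the sums for p = 4m + 3

module ThreeModFour (m : ℕ) (p-prime : Prime (suc (suc (2 ℕ.* m) ℕ.+ suc (2 ℕ.* m)))) where

  n : ℕ
  n = suc (2 ℕ.* m)

  open OddPrime n p-prime

  private
    m1^n : m1 ^ℚ n ≡ m1
    m1^n = cong (m1 *_) (m1^-double m)

  open OddReflection n m1^n

  private
    m≤2m : m ≤ 2 ℕ.* m
    m≤2m = ℕₚ.m≤m+n m (m ℕ.+ 0)

    2m≡m*2 : 2 ℕ.* m ≡ m ℕ.* 2
    2m≡m*2 = ℕₚ.*-comm 2 m

  -- k + 1 ≤ n + 1 ≤ 2n < p, where n ≥ 1 because n = 2m + 1.
  integral-recip-suc : ∀ k → k ≤ n → Integral (recip (suc k))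
  integral-recip-suc k k≤n = integral-recip (p∤suc k (ℕₚ.≤-trans (s≤s k≤n) (subst (_≤ n ℕ.+ n) (ℕₚ.+-comm n 1) (ℕₚ.+-monoʳ-≤ n (s≤s z≤n)))))

  integral-m2^ : ∀ k → Integral (m2 ^ℚ k)
  integral-m2^ = integral-^ (integral-neg (integral-ℕ 2))

  integral-Σ : ∀ r {f : ℕ → ℚ} → (∀ k → k ≤ r → Integral (f k)) → Integral (Σ[0≤k≤ r ] f)
  integral-Σ zero    i = i 0 z≤n
  integral-Σ (suc r) i = integral-+ (integral-Σ r (λ k k≤r → i k (ℕₚ.m≤n⇒m≤1+n k≤r))) (i (suc r) ℕₚ.≤-refl)

  -- The first four sums of (i) with `summand` replaced by `F n`; all members of the first chain are
  -- shown congruent to `target`.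
  s₁ s₂ s₃ s₄ target : ℚ
  s₁ = Σ[0≤k≤ n ] (λ k → m2 ^ℚ k * recip (suc k) * F n k)
  s₂ = Σ[0≤k≤ n ] (λ k → m2 ^ℚ k * ⟦ k ⟧ * F n k)
  s₃ = Σ[0≤k≤ n ] (λ k → recip (suc k) * F n k)
  s₄ = Σ[0≤k≤ n ] (λ k → ⟦ k ⟧ * F n k)
  target = m1 ^ℚ suc m * central (suc m) * recip 2

  central-half : central (suc m) ≡ ⟦ 2 ⟧ * binom n m
  central-half = begin
    binom (2 ℕ.* suc m) (suc m)                  ≡⟨ cong (λ t → binom t (suc m)) (ℕₚ.*-suc 2 m) ⟩
    binom (suc n) (suc m)                        ≡⟨ pascal n m ⟩
    binom n m + binom n (suc m)                  ≡⟨ cong (λ t → binom n m + t) symmetric ⟨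
    binom n m + binom n m                        ≡⟨ lemma (binom n m) ⟩
    ⟦ 2 ⟧ * binom n m                            ∎
    where
    open ≡-Reasoning
    lemma : ∀ x → x + x ≡ ⟦ 2 ⟧ * x
    lemma = solve-∀ ℚ-ring
    n≡ : m ℕ.+ suc m ≡ n
    n≡ = ≡-trans (ℕₚ.+-suc m m) (cong (λ t → suc (m ℕ.+ t)) (≡-sym (ℕₚ.+-identityʳ m)))
    symmetric : binom n m ≡ binom n (suc m)
    symmetric = subst (λ t → binom t m ≡ binom t (suc m)) n≡ (binom-sym-+ m (suc m))

  -- Used below in the form 4(m + 1) ≡ 1 modulo p.
  ⟦p⟧-m : ⟦ p ⟧ ≡ ⟦ 4 ⟧ * ⟦ suc m ⟧ - 1ℚ
  ⟦p⟧-m = begin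
    ⟦ p ⟧                                                          ≡⟨ ⟦p⟧ ⟩
    1ℚ + (⟦ n ⟧ + ⟦ n ⟧)                                           ≡⟨ cong (λ t → 1ℚ + (t + t)) (≡-trans (⟦⟧-suc (2 ℕ.* m)) (cong (λ t → 1ℚ + t) (⟦⟧-* 2 m))) ⟩
    1ℚ + ((1ℚ + ⟦ 2 ⟧ * ⟦ m ⟧) + (1ℚ + ⟦ 2 ⟧ * ⟦ m ⟧))             ≡⟨ lemma ⟦ m ⟧ ⟩
    ⟦ 4 ⟧ * (1ℚ + ⟦ m ⟧) - 1ℚ                                      ≡⟨ cong (λ t → ⟦ 4 ⟧ * t - 1ℚ) (⟦⟧-suc m) ⟨
    ⟦ 4 ⟧ * ⟦ suc m ⟧ - 1ℚ                                         ∎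
    where
    open ≡-Reasoning
    lemma : ∀ m → 1ℚ + ((1ℚ + ⟦ 2 ⟧ * m) + (1ℚ + ⟦ 2 ⟧ * m)) ≡ ⟦ 4 ⟧ * (1ℚ + m) - 1ℚ
    lemma = solve-∀ ℚ-ring

  p∤1+m : ¬ (p ∣ suc m)
  p∤1+m = p∤suc m (≤n⇒≤2n (s≤s m≤2m))

  -- The factor n + 1 absorbs 1 / (k + 1): (n + 1) C(n,k) / (k + 1) = C(n+1,k+1), which gives the
  -- adjacent-row sum with r = n.
  s₃-≈ : ⟦ suc n ⟧ * s₃ ≈ binom n m * m1 ^ℚ m [ 1 ]
  s₃-≈ = begin
    ⟦ suc n ⟧ * s₃
      ≈⟨ ≈-* ⟦ suc n ⟧ (integral-ℕ (suc n)) (Σ-F-≈ (λ k → recip (suc k)) integral-recip-suc) ⟩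
    ⟦ suc n ⟧ * Σ[0≤k≤ n ] (λ k → recip (suc k) * binom n k * (m1 ^ℚ k * binom n k))
      ≡⟨ Σ-distribˡ n ⟦ suc n ⟧ (λ k → recip (suc k) * binom n k * (m1 ^ℚ k * binom n k)) ⟩
    Σ[0≤k≤ n ] (λ k → ⟦ suc n ⟧ * (recip (suc k) * binom n k * (m1 ^ℚ k * binom n k)))
      ≡⟨ Σ-cong n (λ k _ → term k) ⟩
    Σ[0≤k≤ n ] (λ k → binom n k * (m1 ^ℚ k * binom (suc n) (suc k)))
      ≡⟨ Σ-alternating-adjacent m n (subst (_≤ n) 2m≡m*2 (ℕₚ.n≤1+n (2 ℕ.* m))) (s≤s (ℕₚ.≤-reflexive 2m≡m*2)) ⟩
    binom n m * m1 ^ℚ m ∎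
    where
    open SetoidReasoning (≈-setoid 1)
    lemma₁ : ∀ s r b x → s * (r * b * (x * b)) ≡ r * (b * x) * (s * b)
    lemma₁ = solve-∀ ℚ-ring
    lemma₂ : ∀ s r b x c → r * (b * x) * (s * c) ≡ s * r * (b * (x * c))
    lemma₂ = solve-∀ ℚ-ring
    term : ∀ k → ⟦ suc n ⟧ * (recip (suc k) * binom n k * (m1 ^ℚ k * binom n k)) ≡ binom n k * (m1 ^ℚ k * binom (suc n) (suc k))
    term k = ≡-trans (lemma₁ ⟦ suc n ⟧ (recip (suc k)) (binom n k) (m1 ^ℚ k))
      (≡-trans (cong (recip (suc k) * (binom n k * m1 ^ℚ k) *_) (≡-sym (absorption n k)))
      (≡-trans (lemma₂ ⟦ suc k ⟧ (recip (suc k)) (binom n k) (m1 ^ℚ k) (binom (suc n) (suc k)))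
      (≡-trans (cong (_* (binom n k * (m1 ^ℚ k * binom (suc n) (suc k)))) (recip-inverse k))
        (ℚₚ.*-identityˡ (binom n k * (m1 ^ℚ k * binom (suc n) (suc k)))))))

  -- Since 2(n + 1) = p + 1, the factor 1/2 is n + 1 modulo p.
  s₃-target : m1 * s₃ * recip 2 ≈ target [ 1 ]
  s₃-target = begin
    m1 * s₃ * recip 2
      ≈⟨ ≈-multiple (s₃ * recip 2)
           (integral-* (integral-Σ n (λ k k≤n → integral-* (integral-recip-suc k k≤n) (integral-F n k))) (integral-recip p∤2))
           (≡-trans (cong (λ t → m1 * s₃ * recip 2 - m1 * (t * s₃)) (⟦⟧-suc n)) (≡-trans (lemma₁ ⟦ n ⟧ s₃) (cong (_* (s₃ * recip 2)) (≡-sym ⟦p⟧)))) ⟩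
    m1 * (⟦ suc n ⟧ * s₃)
      ≈⟨ ≈-* m1 integral-m1 s₃-≈ ⟩
    m1 * (binom n m * m1 ^ℚ m)
      ≡⟨ lemma₂ (m1 ^ℚ m) (binom n m) ⟩
    m1 ^ℚ suc m * (⟦ 2 ⟧ * binom n m) * recip 2
      ≡⟨ cong (λ t → m1 ^ℚ suc m * t * recip 2) central-half ⟨
    target ∎
    where
    open SetoidReasoning (≈-setoid 1)
    lemma₁ : ∀ n s → m1 * s * recip 2 - m1 * ((1ℚ + n) * s) ≡ (1ℚ + (n + n)) * (s * recip 2)
    lemma₁ = solve-∀ ℚ-ring
    lemma₂ : ∀ x b → m1 * (b * x) ≡ m1 * x * (⟦ 2 ⟧ * b) * recip 2
    lemma₂ = solve-∀ ℚ-ring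

  -- The weight is absorbed by k C(n,k) = n C(n-1,k-1), giving the adjacent-row sum with r = n - 1 =
  -- 2m; the index shift costs a sign.
  s₄-≈ : s₄ ≈ m1 * ⟦ n ⟧ * (central m * m1 ^ℚ m) [ 1 ]
  s₄-≈ = begin
    s₄
      ≈⟨ Σ-F-≈ ⟦_⟧ (λ k _ → integral-ℕ k) ⟩
    Σ[0≤k≤ n ] (λ k → ⟦ k ⟧ * binom n k * (m1 ^ℚ k * binom n k))
      ≡⟨ Σ-head (2 ℕ.* m) (λ k → ⟦ k ⟧ * binom n k * (m1 ^ℚ k * binom n k)) ⟩
    ⟦ 0 ⟧ * binom n 0 * (m1 ^ℚ 0 * binom n 0) + Σ[0≤k≤ 2 ℕ.* m ] (λ i → ⟦ suc i ⟧ * binom n (suc i) * (m1 ^ℚ suc i * binom n (suc i)))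
      ≡⟨ cong₂ _+_ (lemma₀ (binom n 0)) (Σ-cong (2 ℕ.* m) (λ i _ → term i)) ⟩
    0ℚ + Σ[0≤k≤ 2 ℕ.* m ] (λ i → m1 * ⟦ n ⟧ * (binom (2 ℕ.* m) i * (m1 ^ℚ i * binom n (suc i))))
      ≡⟨ ℚₚ.+-identityˡ (Σ[0≤k≤ 2 ℕ.* m ] (λ i → m1 * ⟦ n ⟧ * (binom (2 ℕ.* m) i * (m1 ^ℚ i * binom n (suc i))))) ⟩
    Σ[0≤k≤ 2 ℕ.* m ] (λ i → m1 * ⟦ n ⟧ * (binom (2 ℕ.* m) i * (m1 ^ℚ i * binom n (suc i))))
      ≡⟨ Σ-distribˡ (2 ℕ.* m) (m1 * ⟦ n ⟧) (λ i → binom (2 ℕ.* m) i * (m1 ^ℚ i * binom n (suc i))) ⟨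
    m1 * ⟦ n ⟧ * Σ[0≤k≤ 2 ℕ.* m ] (λ i → binom (2 ℕ.* m) i * (m1 ^ℚ i * binom n (suc i)))
      ≡⟨ cong (m1 * ⟦ n ⟧ *_) (Σ-alternating-adjacent m (2 ℕ.* m) (ℕₚ.≤-reflexive (≡-sym 2m≡m*2)) (ℕₚ.m≤n⇒m≤1+n (ℕₚ.≤-reflexive 2m≡m*2))) ⟩
    m1 * ⟦ n ⟧ * (central m * m1 ^ℚ m) ∎
    where
    open SetoidReasoning (≈-setoid 1)
    lemma₀ : ∀ b → 0ℚ * b * (1ℚ * b) ≡ 0ℚ
    lemma₀ = solve-∀ ℚ-ring
    lemma₁ : ∀ s c x → s * c * (m1 * x * c) ≡ m1 * x * c * (s * c)
    lemma₁ = solve-∀ ℚ-ring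
    lemma₂ : ∀ n b x c → m1 * x * c * (n * b) ≡ m1 * n * (b * (x * c))
    lemma₂ = solve-∀ ℚ-ring
    term : ∀ i → ⟦ suc i ⟧ * binom n (suc i) * (m1 ^ℚ suc i * binom n (suc i)) ≡ m1 * ⟦ n ⟧ * (binom (2 ℕ.* m) i * (m1 ^ℚ i * binom n (suc i)))
    term i = ≡-trans (lemma₁ ⟦ suc i ⟧ (binom n (suc i)) (m1 ^ℚ i))
      (≡-trans (cong (m1 * m1 ^ℚ i * binom n (suc i) *_) (absorption (2 ℕ.* m) i))
        (lemma₂ ⟦ n ⟧ (binom (2 ℕ.* m) i) (m1 ^ℚ i) (binom n (suc i))))

  -- After multiplication by m + 1 the factor 4(m + 1) ≡ 1 disappears, and (m + 1) C(2m+2,m+1) = 2n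
  -- C(2m,m) identifies the result.
  s₄-target : ⟦ 4 ⟧ * s₄ ≈ target [ 1 ]
  s₄-target = ≈-cancel ⟦ suc m ⟧ (unit-ℕ p∤1+m) (begin
    ⟦ suc m ⟧ * (⟦ 4 ⟧ * s₄)
      ≈⟨ ≈-* ⟦ suc m ⟧ (integral-ℕ (suc m)) (≈-* ⟦ 4 ⟧ (integral-ℕ 4) s₄-≈) ⟩
    ⟦ suc m ⟧ * (⟦ 4 ⟧ * (m1 * ⟦ n ⟧ * (central m * m1 ^ℚ m)))
      ≈⟨ ≈-multiple (m1 * ⟦ n ⟧ * (central m * m1 ^ℚ m))
           (integral-* (integral-* integral-m1 (integral-ℕ n)) (integral-* (integral-ℕ ((2 ℕ.* m) C m)) (integral-^ integral-m1 m)))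
           (≡-trans (lemma₁ ⟦ suc m ⟧ (m1 * ⟦ n ⟧ * (central m * m1 ^ℚ m))) (cong (_* (m1 * ⟦ n ⟧ * (central m * m1 ^ℚ m))) (≡-sym ⟦p⟧-m))) ⟩
    m1 * ⟦ n ⟧ * (central m * m1 ^ℚ m)
      ≡⟨ lemma₂ ⟦ n ⟧ (central m) (m1 ^ℚ m) ⟩
    m1 * m1 ^ℚ m * recip 2 * (⟦ 2 ⟧ * ⟦ n ⟧ * central m)
      ≡⟨ cong (m1 * m1 ^ℚ m * recip 2 *_) (central-suc m) ⟨
    m1 * m1 ^ℚ m * recip 2 * (⟦ suc m ⟧ * central (suc m))
      ≡⟨ lemma₃ (m1 ^ℚ suc m) (recip 2) ⟦ suc m ⟧ (central (suc m)) ⟩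
    ⟦ suc m ⟧ * target ∎)
    where
    open SetoidReasoning (≈-setoid 1)
    lemma₁ : ∀ s x → s * (⟦ 4 ⟧ * x) - x ≡ (⟦ 4 ⟧ * s - 1ℚ) * x
    lemma₁ = solve-∀ ℚ-ring
    lemma₂ : ∀ n c x → m1 * n * (c * x) ≡ m1 * x * recip 2 * (⟦ 2 ⟧ * n * c)
    lemma₂ = solve-∀ ℚ-ring
    lemma₃ : ∀ x h s c → x * h * (s * c) ≡ s * (x * c * h)
    lemma₃ = solve-∀ ℚ-ring

  s₁-exact : s₁ ≡ m1 * s₃ * recip 2
  s₁-exact = *-cancel-suc 1 (≡-trans Σ-F-recip-m2 (lemma s₃))
    where
    lemma : ∀ s → m1 * s ≡ ⟦ 2 ⟧ * (m1 * s * recip 2)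
    lemma = solve-∀ ℚ-ring

  s₂-exact : m1 * (⟦ 2 ⟧ * s₂) ≡ ⟦ 4 ⟧ * s₄
  s₂-exact = ≡-trans (cong (λ t → m1 * (⟦ 2 ⟧ * t)) Σ-kF-m2) (lemma s₄)
    where
    lemma : ∀ s → m1 * (⟦ 2 ⟧ * (m2 * s)) ≡ ⟦ 4 ⟧ * s
    lemma = solve-∀ ℚ-ring

  H : ℚ
  H = Σ[0≤k≤ m ] (λ j → binom n j * (m1 ^ℚ j * gapRecip n j))

  -- As n is odd, n - 2j is never 0: the constant coefficient of (1 - x)⁻ᵖ, the only one in this
  -- range without a factor p, does not occur. For j > m the exponent n - 2j is negative.
  Σ-F-≈-H : Σ[0≤k≤ n ] (F n) ≈ ⟦ p ⟧ * H [ 2 ]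
  Σ-F-≈-H = begin
    Σ[0≤k≤ n ] (F n)
      ≡⟨ Σ-F n ⟩
    Σ[0≤k≤ n ] T
      ≡⟨ cong (λ t → Σ[0≤k≤ t ] T) n≡ ⟨
    Σ[0≤k≤ suc m ℕ.+ m ] T
      ≡⟨ Σ-truncate m (suc m) T T-over ⟩
    Σ[0≤k≤ m ] T
      ≈⟨ ≈-Σ m term ⟩
    Σ[0≤k≤ m ] (λ j → ⟦ p ⟧ * (binom n j * (m1 ^ℚ j * gapRecip n j)))
      ≡⟨ Σ-distribˡ m ⟦ p ⟧ (λ j → binom n j * (m1 ^ℚ j * gapRecip n j)) ⟨
    ⟦ p ⟧ * H ∎
    where
    open SetoidReasoning (≈-setoid 2)
    T : ℕ → ℚ
    T j = binom n j * (m1 ^ℚ j * down (negbinom (n ℕ.+ n)) n (j ℕ.* 2 ℕ.+ 0))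
    n≡ : suc m ℕ.+ m ≡ n
    n≡ = cong (λ t → suc (m ℕ.+ t)) (≡-sym (ℕₚ.+-identityʳ m))
    index : ∀ j → j ℕ.* 2 ℕ.+ 0 ≡ 2 ℕ.* j
    index j = ≡-trans (ℕₚ.+-identityʳ (j ℕ.* 2)) (ℕₚ.*-comm j 2)
    lemma₀ : ∀ x y → x * (y * 0ℚ) ≡ 0ℚ
    lemma₀ = solve-∀ ℚ-ring
    lemma₁ : ∀ p b x v → b * (x * (p * v)) ≡ p * (b * (x * v))
    lemma₁ = solve-∀ ℚ-ring
    lemma₂ : ∀ b x y → b * (x * y) ≡ b * x * y
    lemma₂ = solve-∀ ℚ-ring
    lemma₃ : ∀ x → x ≡ x - 0ℚ
    lemma₃ = solve-∀ ℚ-ring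
    T-over : ∀ j → m < j → T j ≡ 0ℚ
    T-over j m<j = ≡-trans (cong (λ t → binom n j * (m1 ^ℚ j * t)) (≡-trans (cong (down (negbinom (n ℕ.+ n)) n) (index j))
      (down-> (negbinom (n ℕ.+ n)) n (2 ℕ.* j) (subst (_≤ 2 ℕ.* j) (ℕₚ.*-suc 2 m) (ℕₚ.*-monoʳ-≤ 2 m<j))))) (lemma₀ (binom n j) (m1 ^ℚ j))
    entry : ∀ j → j ≤ m → down (negbinom (n ℕ.+ n)) n (j ℕ.* 2 ℕ.+ 0) ≈ ⟦ p ⟧ * gapRecip n j [ 2 ]
    entry j j≤m = begin
      down (negbinom (n ℕ.+ n)) n (j ℕ.* 2 ℕ.+ 0)
        ≡⟨ cong (down (negbinom (n ℕ.+ n)) n) (index j) ⟩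
      down (negbinom (n ℕ.+ n)) n (2 ℕ.* j)
        ≡⟨ down-≤ (negbinom (n ℕ.+ n)) n (2 ℕ.* j) 2j≤n ⟩
      negbinom (n ℕ.+ n) (n ∸ 2 ℕ.* j)
        ≡⟨ cong (negbinom (n ℕ.+ n)) gap ⟩
      negbinom (n ℕ.+ n) (suc l)
        ≈⟨ negbinom-2n-≈ l (s≤s (ℕₚ.m∸n≤m (2 ℕ.* m) (2 ℕ.* j))) ⟩
      ⟦ p ⟧ * recip (suc l)
        ≡⟨ cong (⟦ p ⟧ *_) (≡-trans (lemma₃ (recip (suc l))) (cong₂ (λ s t → recip s - recip t) (≡-sym gap) (≡-sym (ℕₚ.m≤n⇒m∸n≡0 2j≤n)))) ⟩
      ⟦ p ⟧ * gapRecip n j ∎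
      where
      l : ℕ
      l = 2 ℕ.* m ∸ 2 ℕ.* j
      2j≤2m : 2 ℕ.* j ≤ 2 ℕ.* m
      2j≤2m = ℕₚ.*-monoʳ-≤ 2 j≤m
      2j≤n : 2 ℕ.* j ≤ n
      2j≤n = ℕₚ.m≤n⇒m≤1+n 2j≤2m
      gap : n ∸ 2 ℕ.* j ≡ suc l
      gap = ℕₚ.+-∸-assoc 1 2j≤2m
    term : ∀ j → j ≤ m → T j ≈ ⟦ p ⟧ * (binom n j * (m1 ^ℚ j * gapRecip n j)) [ 2 ]
    term j j≤m = begin
      T j
        ≡⟨ lemma₂ (binom n j) (m1 ^ℚ j) (down (negbinom (n ℕ.+ n)) n (j ℕ.* 2 ℕ.+ 0)) ⟩
      binom n j * m1 ^ℚ j * down (negbinom (n ℕ.+ n)) n (j ℕ.* 2 ℕ.+ 0)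
        ≈⟨ ≈-* (binom n j * m1 ^ℚ j) (integral-* (integral-ℕ (n C j)) (integral-^ integral-m1 j)) (entry j j≤m) ⟩
      binom n j * m1 ^ℚ j * (⟦ p ⟧ * gapRecip n j)
        ≡⟨ lemma₂ (binom n j) (m1 ^ℚ j) (⟦ p ⟧ * gapRecip n j) ⟨
      binom n j * (m1 ^ℚ j * (⟦ p ⟧ * gapRecip n j))
        ≡⟨ lemma₁ ⟦ p ⟧ (binom n j) (m1 ^ℚ j) (gapRecip n j) ⟩
      ⟦ p ⟧ * (binom n j * (m1 ^ℚ j * gapRecip n j)) ∎

  -- 4 · 16ᵐ = 2ᵖ⁻¹, and both 2ᵖ⁻¹ and 4(m + 1) = p + 1 are 1 modulo p.
  16^m-≈ : ⟦ 16 ⟧ ^ℚ m ≈ ⟦ suc m ⟧ [ 1 ]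
  16^m-≈ = ≈-cancel ⟦ 4 ⟧ (unit-ℕ p∤4) (begin
    ⟦ 4 ⟧ * ⟦ 16 ⟧ ^ℚ m              ≡⟨ cong (⟦ 4 ⟧ *_) (≡-trans (^ℚ-* ⟦ 4 ⟧ ⟦ 4 ⟧ m) (cong₂ _*_ (^ℚ-* ⟦ 2 ⟧ ⟦ 2 ⟧ m) (^ℚ-* ⟦ 2 ⟧ ⟦ 2 ⟧ m))) ⟩
    ⟦ 4 ⟧ * ((x * x) * (x * x))      ≡⟨ lemma₁ x ⟩
    (⟦ 2 ⟧ * (x * x)) * (⟦ 2 ⟧ * (x * x)) ≡⟨ cong (λ t → (⟦ 2 ⟧ * t) * (⟦ 2 ⟧ * t)) (≡-trans (cong (⟦ 2 ⟧ ^ℚ_) (cong (m ℕ.+_) (ℕₚ.+-identityʳ m))) (^ℚ-+ ⟦ 2 ⟧ m m)) ⟨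
    ⟦ 2 ⟧ ^ℚ n * ⟦ 2 ⟧ ^ℚ n          ≡⟨ ^ℚ-+ ⟦ 2 ⟧ n n ⟨
    ⟦ 2 ⟧ ^ℚ (n ℕ.+ n)               ≈⟨ 2^[p-1] ⟩
    1ℚ                               ≈⟨ ≈-sym (≈-multiple 1ℚ (integral-ℕ 1) (≡-trans (≡-sym ⟦p⟧-m) (≡-sym (ℚₚ.*-identityʳ ⟦ p ⟧)))) ⟩
    ⟦ 4 ⟧ * ⟦ suc m ⟧                ∎)
    where
    open SetoidReasoning (≈-setoid 1)
    x : ℚ
    x = ⟦ 2 ⟧ ^ℚ m
    lemma₁ : ∀ x → ⟦ 4 ⟧ * ((x * x) * (x * x)) ≡ (⟦ 2 ⟧ * (x * x)) * (⟦ 2 ⟧ * (x * x))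
    lemma₁ = solve-∀ ℚ-ring

  B : ℕ
  B = (2 ℕ.* suc m) C suc m

  -- H is (-16)ᵐ / (n C(2m,m)) exactly. With 16ᵐ ≡ m + 1, the relation (m + 1) B = 2n C(2m,m) turns
  -- this into a multiple of 1 / B.
  H-≈ : H ≈ ⟦ 2 ⟧ * (m1 ^ℚ m * recip B) [ 1 ]
  H-≈ = ≈-cancel (⟦ n ⟧ * central m)
    (unit-* (unit-ℕ (p∤suc (2 ℕ.* m) (ℕₚ.m≤m+n n n))) (unit-central m (ℕₚ.m≤n⇒m≤1+n m≤2m))) (begin
    ⟦ n ⟧ * central m * H
      ≡⟨ Σ-alternating-gapRecip m ⟩
    m16 ^ℚ m
      ≡⟨ ^ℚ-* m1 ⟦ 16 ⟧ m ⟩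
    m1 ^ℚ m * ⟦ 16 ⟧ ^ℚ m
      ≈⟨ ≈-* (m1 ^ℚ m) (integral-^ integral-m1 m) 16^m-≈ ⟩
    m1 ^ℚ m * ⟦ suc m ⟧
      ≡⟨ ℚₚ.*-identityʳ (m1 ^ℚ m * ⟦ suc m ⟧) ⟨
    m1 ^ℚ m * ⟦ suc m ⟧ * 1ℚ
      ≡⟨ cong (m1 ^ℚ m * ⟦ suc m ⟧ *_) (unit-recip B (unit-central (suc m) (s≤s m≤2m))) ⟨
    m1 ^ℚ m * ⟦ suc m ⟧ * (central (suc m) * recip B)
      ≡⟨ lemma₁ (m1 ^ℚ m) ⟦ suc m ⟧ (central (suc m)) (recip B) ⟩
    m1 ^ℚ m * recip B * (⟦ suc m ⟧ * central (suc m))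
      ≡⟨ cong (m1 ^ℚ m * recip B *_) (central-suc m) ⟩
    m1 ^ℚ m * recip B * (⟦ 2 ⟧ * ⟦ n ⟧ * central m)
      ≡⟨ lemma₂ (m1 ^ℚ m * recip B) ⟦ n ⟧ (central m) ⟩
    ⟦ n ⟧ * central m * (⟦ 2 ⟧ * (m1 ^ℚ m * recip B)) ∎)
    where
    open SetoidReasoning (≈-setoid 1)
    lemma₁ : ∀ x s c r → x * s * (c * r) ≡ x * r * (s * c)
    lemma₁ = solve-∀ ℚ-ring
    lemma₂ : ∀ x n c → x * (⟦ 2 ⟧ * n * c) ≡ n * c * (⟦ 2 ⟧ * x)
    lemma₂ = solve-∀ ℚ-ring

  -- H is known only modulo p, but it enters multiplied by p.
  Σ-F-target : m1 * Σ[0≤k≤ n ] (F n) ≈ ⟦ 2 ℕ.* p ⟧ * m1 ^ℚ suc m * recip B [ 2 ]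
  Σ-F-target = begin
    m1 * Σ[0≤k≤ n ] (F n)
      ≈⟨ ≈-* m1 integral-m1 Σ-F-≈-H ⟩
    m1 * (⟦ p ⟧ * H)
      ≈⟨ ≈-* m1 integral-m1 (≈-p* H-≈) ⟩
    m1 * (⟦ p ⟧ * (⟦ 2 ⟧ * (m1 ^ℚ m * recip B)))
      ≡⟨ lemma ⟦ p ⟧ (m1 ^ℚ m) (recip B) ⟩
    ⟦ 2 ⟧ * ⟦ p ⟧ * (m1 * m1 ^ℚ m) * recip B
      ≡⟨ cong (λ t → t * (m1 * m1 ^ℚ m) * recip B) (⟦⟧-* 2 p) ⟨
    ⟦ 2 ℕ.* p ⟧ * m1 ^ℚ suc m * recip B ∎
    where
    open SetoidReasoning (≈-setoid 2)
    lemma : ∀ p x r → m1 * (p * (⟦ 2 ⟧ * (x * r))) ≡ ⟦ 2 ⟧ * p * (m1 * x) * r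
    lemma = solve-∀ ℚ-ring

-- Assembly of part (i)

S₁ S₂ S₃ S₄ T₁ T₂ : ℕ → ℚ
S₁ n = Σ[0≤k≤ n ] (λ k → (binom (2 ℕ.* k) k * catalan k) ÷ℕ (8 ^ k))
S₂ n = Σ[0≤k≤ n ] (λ k → (⟦ k ⟧ * (binom (2 ℕ.* k) k * binom (2 ℕ.* k) k)) ÷ℕ (8 ^ k))
S₃ n = Σ[0≤k≤ n ] (λ k → (m1 ^ℚ k) * ((binom (2 ℕ.* k) k * catalan k) ÷ℕ (16 ^ k)))
S₄ n = Σ[0≤k≤ n ] (λ k → (m1 ^ℚ k) * ((⟦ k ⟧ * (binom (2 ℕ.* k) k * binom (2 ℕ.* k) k)) ÷ℕ (16 ^ k)))
T₁ n = Σ[0≤k≤ n ] (λ k → (binom (2 ℕ.* k) k * binom (2 ℕ.* k) k) ÷ℕ (8 ^ k))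
T₂ n = Σ[0≤k≤ n ] (λ k → (m1 ^ℚ k) * ((binom (2 ℕ.* k) k * binom (2 ℕ.* k) k) ÷ℕ (16 ^ k)))

PartI : (p n e h : ℕ) → Set
PartI p n e h =
  (S₁ n ≡ m1 * (⟦ 2 ⟧ * S₂ n) [mod p ^ 1 ]
  × m1 * (⟦ 2 ⟧ * S₂ n) ≡ (m1 * S₃ n) ÷ℕ 2 [mod p ^ 1 ]
  × (m1 * S₃ n) ÷ℕ 2 ≡ ⟦ 4 ⟧ * S₄ n [mod p ^ 1 ]
  × ⟦ 4 ⟧ * S₄ n ≡ (m1 ^ℚ e * ⟦ h C e ⟧) ÷ℕ 2 [mod p ^ 1 ])
  × (T₁ n ≡ m1 * T₂ n [mod p ^ 2 ]
  × m1 * T₂ n ≡ (⟦ 2 ℕ.* p ⟧ * m1 ^ℚ e) ÷ℕ (h C e) [mod p ^ 2 ])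

-- The quotients (p - 1)/2, (p + 1)/4 and (p + 1)/2 enter as variables with equations, so that they
-- can be replaced by expressions in m.
partI : ∀ m {p n e h} → Prime p → p ≡ suc (n ℕ.+ n) → n ≡ suc (2 ℕ.* m) → e ≡ suc m → h ≡ 2 ℕ.* suc m → PartI p n e h
partI m p-prime refl refl refl refl =
  ( ≈⇒mod (≈-trans S₁-target (≈-sym S₂-target))
  , ≈⇒mod (≈-trans S₂-target (≈-sym S₃-target))
  , ≈⇒mod (≈-trans S₃-target (≈-sym S₄-target))
  , ≈⇒mod (≈-trans S₄-target (≈-reflexive (≡-sym (÷ℕ-recip (m1 ^ℚ suc m * central (suc m)) 2))))
  ) ,
  ( ≈⇒mod (≈-trans T₁-≈ (≈-sym T₂-≈))
  , ≈⇒mod (≈-trans T₂-≈ (≈-trans Σ-F-target (≈-reflexive (≡-sym (÷ℕ-recip (⟦ 2 ℕ.* p ⟧ * m1 ^ℚ suc m) B)))))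
  )
  where
  open ThreeModFour m p-prime
  open OddPrime n p-prime
  open OddReflection n (cong (m1 *_) (m1^-double m))

  eighth : ∀ k x → x ÷ℕ (8 ^ k) ≡ m2 ^ℚ k * (m1 ^ℚ k * (x * recip (16 ^ k)))
  eighth k x = ≡-trans (÷ℕ-recip x (8 ^ k)) (≡-trans (cong (x *_) (recip-8^ k)) (lemma x (m2 ^ℚ k) (m1 ^ℚ k) (recip (16 ^ k))))
    where
    lemma : ∀ x a b c → x * (a * (b * c)) ≡ a * (b * (x * c))
    lemma = solve-∀ ℚ-ring

  sixteenth : ∀ k x → m1 ^ℚ k * (x ÷ℕ (16 ^ k)) ≡ m1 ^ℚ k * (x * recip (16 ^ k))
  sixteenth k x = cong (m1 ^ℚ k *_) (÷ℕ-recip x (16 ^ k))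

  catalan-summand : ∀ k → m1 ^ℚ k * (central k * catalan k * recip (16 ^ k)) ≡ recip (suc k) * summand k
  catalan-summand k = ≡-trans (cong (λ t → m1 ^ℚ k * (central k * t * recip (16 ^ k))) (÷ℕ-recip (central k) (suc k)))
    (lemma (m1 ^ℚ k) (central k) (recip (suc k)) (recip (16 ^ k)))
    where
    lemma : ∀ x c r y → x * (c * (c * r) * y) ≡ r * (x * (c * c * y))
    lemma = solve-∀ ℚ-ring

  scaled-summand : ∀ k → m1 ^ℚ k * (⟦ k ⟧ * (central k * central k) * recip (16 ^ k)) ≡ ⟦ k ⟧ * summand k
  scaled-summand k = lemma (m1 ^ℚ k) ⟦ k ⟧ (central k * central k) (recip (16 ^ k))
    where
    lemma : ∀ x s c y → x * (s * c * y) ≡ s * (x * (c * y))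
    lemma = solve-∀ ℚ-ring

  S₁-≈ : S₁ n ≈ s₁ [ 1 ]
  S₁-≈ = ≈-trans
    (≈-reflexive (Σ-cong n (λ k _ → ≡-trans (eighth k (central k * catalan k))
      (≡-trans (cong (m2 ^ℚ k *_) (catalan-summand k)) (≡-sym (ℚₚ.*-assoc (m2 ^ℚ k) (recip (suc k)) (summand k)))))))
    (≈-weaken (Σ-summand-≈ (λ k → m2 ^ℚ k * recip (suc k)) (λ k k≤n → integral-* (integral-m2^ k) (integral-recip-suc k k≤n))))

  S₂-≈ : S₂ n ≈ s₂ [ 1 ]
  S₂-≈ = ≈-trans
    (≈-reflexive (Σ-cong n (λ k _ → ≡-trans (eighth k (⟦ k ⟧ * (central k * central k)))
      (≡-trans (cong (m2 ^ℚ k *_) (scaled-summand k)) (≡-sym (ℚₚ.*-assoc (m2 ^ℚ k) ⟦ k ⟧ (summand k)))))))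
    (≈-weaken (Σ-summand-≈ (λ k → m2 ^ℚ k * ⟦ k ⟧) (λ k _ → integral-* (integral-m2^ k) (integral-ℕ k))))

  S₃-≈ : S₃ n ≈ s₃ [ 1 ]
  S₃-≈ = ≈-trans
    (≈-reflexive (Σ-cong n (λ k _ → ≡-trans (sixteenth k (central k * catalan k)) (catalan-summand k))))
    (≈-weaken (Σ-summand-≈ (λ k → recip (suc k)) integral-recip-suc))

  S₄-≈ : S₄ n ≈ s₄ [ 1 ]
  S₄-≈ = ≈-trans
    (≈-reflexive (Σ-cong n (λ k _ → ≡-trans (sixteenth k (⟦ k ⟧ * (central k * central k))) (scaled-summand k))))
    (≈-weaken (Σ-summand-≈ ⟦_⟧ (λ k _ → integral-ℕ k)))

  S₁-target : S₁ n ≈ target [ 1 ]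
  S₁-target = ≈-trans S₁-≈ (≈-trans (≈-reflexive s₁-exact) s₃-target)

  S₂-target : m1 * (⟦ 2 ⟧ * S₂ n) ≈ target [ 1 ]
  S₂-target = ≈-trans (≈-* m1 integral-m1 (≈-* ⟦ 2 ⟧ (integral-ℕ 2) S₂-≈)) (≈-trans (≈-reflexive s₂-exact) s₄-target)

  S₃-target : (m1 * S₃ n) ÷ℕ 2 ≈ target [ 1 ]
  S₃-target = ≈-trans (≈-reflexive (≡-trans (÷ℕ-recip (m1 * S₃ n) 2) (lemma (S₃ n))))
    (≈-trans (≈-* (m1 * recip 2) (integral-* integral-m1 (integral-recip p∤2)) S₃-≈)
    (≈-trans (≈-reflexive (≡-sym (lemma s₃))) s₃-target))
    where
    lemma : ∀ s → m1 * s * recip 2 ≡ m1 * recip 2 * s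
    lemma = solve-∀ ℚ-ring

  S₄-target : ⟦ 4 ⟧ * S₄ n ≈ target [ 1 ]
  S₄-target = ≈-trans (≈-* ⟦ 4 ⟧ (integral-ℕ 4) S₄-≈) s₄-target

  T₁-≈ : T₁ n ≈ m1 * Σ[0≤k≤ n ] (F n) [ 2 ]
  T₁-≈ = ≈-trans (≈-reflexive (Σ-cong n (λ k _ → eighth k (central k * central k))))
    (≈-trans (Σ-summand-≈ (m2 ^ℚ_) (λ k _ → integral-m2^ k)) (≈-reflexive Σ-F-m2))

  T₂-≈ : m1 * T₂ n ≈ m1 * Σ[0≤k≤ n ] (F n) [ 2 ]
  T₂-≈ = ≈-* m1 integral-m1 (≈-trans
    (≈-reflexive (Σ-cong n (λ k _ → sixteenth k (central k * central k))))
    (≈-Σ n summand-≈))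

-- Parity and assembly of part (ii)

PartII : (p n h : ℕ) → Set
PartII p n h = (d : ℕ) → d ≤ n → d % 2 ≡ h % 2 →
  (Σ[0≤k≤ n ] (λ k → (binom (2 ℕ.* k) k * binom (2 ℕ.* k) (k ℕ.+ d)) ÷ℕ (8 ^ k))) ≡ ⟦ 0 ⟧ [mod p ^ 1 ]

m1^-% : ∀ k → m1 ^ℚ k ≡ m1 ^ℚ (k % 2)
m1^-% k = begin
  m1 ^ℚ k                                     ≡⟨ cong (m1 ^ℚ_) (m≡m%n+[m/n]*n k 2) ⟩
  m1 ^ℚ (k % 2 ℕ.+ k / 2 ℕ.* 2)               ≡⟨ ^ℚ-+ m1 (k % 2) (k / 2 ℕ.* 2) ⟩
  m1 ^ℚ (k % 2) * m1 ^ℚ (k / 2 ℕ.* 2)         ≡⟨ cong (m1 ^ℚ (k % 2) *_) (≡-trans (cong (m1 ^ℚ_) (ℕₚ.*-comm (k / 2) 2)) (m1^-double (k / 2))) ⟩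
  m1 ^ℚ (k % 2) * 1ℚ                          ≡⟨ ℚₚ.*-identityʳ (m1 ^ℚ (k % 2)) ⟩
  m1 ^ℚ (k % 2)                               ∎
  where open ≡-Reasoning

-- Parities are compared through signs: (-1)ᵈ (-1)ⁿ⁻ᵈ = (-1)ⁿ = -(-1)ⁿ⁺¹ = -(-1)ᵈ.
odd-complement : ∀ n d → d ≤ n → d % 2 ≡ suc n % 2 → m1 ^ℚ (n ∸ d) ≡ m1
odd-complement n d d≤n parity = *-cancel-invertible (m1 ^ℚ d) (m1 ^ℚ d) (m1^-involutive d) (begin
  m1 ^ℚ d * m1 ^ℚ (n ∸ d)   ≡⟨ ^ℚ-+ m1 d (n ∸ d) ⟨
  m1 ^ℚ (d ℕ.+ (n ∸ d))     ≡⟨ cong (m1 ^ℚ_) (ℕₚ.m+[n∸m]≡n d≤n) ⟩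
  m1 ^ℚ n                   ≡⟨ lemma (m1 ^ℚ n) ⟩
  m1 ^ℚ suc n * m1          ≡⟨ cong (_* m1) (m1^-% (suc n)) ⟩
  m1 ^ℚ (suc n % 2) * m1    ≡⟨ cong (λ t → m1 ^ℚ t * m1) parity ⟨
  m1 ^ℚ (d % 2) * m1        ≡⟨ cong (_* m1) (m1^-% d) ⟨
  m1 ^ℚ d * m1              ∎)
  where
  open ≡-Reasoning
  lemma : ∀ x → x ≡ m1 * x * m1
  lemma = solve-∀ ℚ-ring

partII : ∀ {p n h} → Prime p → p ≡ suc (n ℕ.+ n) → h ≡ suc n → PartII p n h
partII {n = n} p-prime refl refl d d≤n parity = ≈⇒mod (≈-trans
  (≈-reflexive (Σ-cong n (λ k _ → ÷ℕ-recip (central k * binom (2 ℕ.* k) (k ℕ.+ d)) (8 ^ k))))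
  (Shifted.Σ-t-≈ d d≤n (odd-complement n d d≤n parity)))
  where open OddPrime n p-prime

*2≡double : ∀ q → q ℕ.* 2 ≡ q ℕ.+ q
*2≡double q = ≡-trans (ℕₚ.*-comm q 2) (cong (q ℕ.+_) (ℕₚ.+-identityʳ q))

theorem1p3 : (p : ℕ) → Prime p → p % 2 ≡ 1 →
    let n = (p ∸ 1) / 2
        e = (p ℕ.+ 1) / 4
        sgn = (-[1+ 0 ] ℚ./ 1) ^ℚ e
        B = ((p ℕ.+ 1) / 2) C e
        m1 = -[1+ 0 ] ℚ./ 1
        S1 = Σ[0≤k≤ n ] (λ k → (binom (2 ℕ.* k) k ℚ.* catalan k) ÷ℕ (8 ^ k))
        S2 = Σ[0≤k≤ n ] (λ k → (⟦ k ⟧ ℚ.* (binom (2 ℕ.* k) k ℚ.* binom (2 ℕ.* k) k)) ÷ℕ (8 ^ k))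
        -2S2 = m1 ℚ.* (⟦ 2 ⟧ ℚ.* S2)
        S3 = Σ[0≤k≤ n ] (λ k → (m1 ^ℚ k) ℚ.* ((binom (2 ℕ.* k) k ℚ.* catalan k) ÷ℕ (16 ^ k)))
        S4 = Σ[0≤k≤ n ] (λ k → (m1 ^ℚ k) ℚ.* ((⟦ k ⟧ ℚ.* (binom (2 ℕ.* k) k ℚ.* binom (2 ℕ.* k) k)) ÷ℕ (16 ^ k)))
        T1 = Σ[0≤k≤ n ] (λ k → (binom (2 ℕ.* k) k ℚ.* binom (2 ℕ.* k) k) ÷ℕ (8 ^ k))
        T2 = Σ[0≤k≤ n ] (λ k → (m1 ^ℚ k) ℚ.* ((binom (2 ℕ.* k) k ℚ.* binom (2 ℕ.* k) k) ÷ℕ (16 ^ k)))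
    in (p % 4 ≡ 3 →
          (S1 ≡ -2S2 [mod p ^ 1 ]
          × -2S2 ≡ ((m1 ℚ.* S3) ÷ℕ 2) [mod p ^ 1 ]
          × ((m1 ℚ.* S3) ÷ℕ 2) ≡ ⟦ 4 ⟧ ℚ.* S4 [mod p ^ 1 ]
          × ⟦ 4 ⟧ ℚ.* S4 ≡ (sgn ℚ.* ⟦ B ⟧) ÷ℕ 2 [mod p ^ 1 ])
        × (T1 ≡ m1 ℚ.* T2 [mod p ^ 2 ]
          × m1 ℚ.* T2 ≡ (⟦ 2 ℕ.* p ⟧ ℚ.* sgn) ÷ℕ B [mod p ^ 2 ]))
     × ((d : ℕ) → d ≤ n → d % 2 ≡ ((p ℕ.+ 1) / 2) % 2 →
          (Σ[0≤k≤ n ] (λ k → (binom (2 ℕ.* k) k ℚ.* binom (2 ℕ.* k) (k ℕ.+ d)) ÷ℕ (8 ^ k)))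
            ≡ ⟦ 0 ⟧ [mod p ^ 1 ])
theorem1p3 p p-prime p%2≡1 = three-mod-four , partII p-prime p≡ h≡
  where
  q : ℕ
  q = p / 2
  p≡1+q*2 : p ≡ 1 ℕ.+ q ℕ.* 2
  p≡1+q*2 = ≡-trans (m≡m%n+[m/n]*n p 2) (cong (ℕ._+ q ℕ.* 2) p%2≡1)
  n≡q : (p ∸ 1) / 2 ≡ q
  n≡q = ≡-trans (cong (λ t → (t ∸ 1) / 2) p≡1+q*2) (m*n/n≡m q 2)
  p≡ : p ≡ suc ((p ∸ 1) / 2 ℕ.+ (p ∸ 1) / 2)
  p≡ = ≡-trans p≡1+q*2 (cong suc (≡-trans (*2≡double q) (cong (λ t → t ℕ.+ t) (≡-sym n≡q))))
  h≡ : (p ℕ.+ 1) / 2 ≡ suc ((p ∸ 1) / 2)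
  h≡ = ≡-trans (cong (_/ 2) (≡-trans (ℕₚ.+-comm p 1) (cong suc p≡1+q*2)))
    (≡-trans (m*n/n≡m (suc q) 2) (cong suc (≡-sym n≡q)))
  three-mod-four : p % 4 ≡ 3 → PartI p ((p ∸ 1) / 2) ((p ℕ.+ 1) / 4) ((p ℕ.+ 1) / 2)
  three-mod-four p%4≡3 = partI m p-prime p≡ n≡
    (≡-trans (cong (_/ 4) (≡-trans (ℕₚ.+-comm p 1) (cong suc p≡3+m*4))) (m*n/n≡m (suc m) 4))
    (≡-trans h≡ (≡-trans (cong suc n≡) (≡-sym (ℕₚ.*-suc 2 m))))
    where
    m : ℕ
    m = p / 4
    p≡3+m*4 : p ≡ 3 ℕ.+ m ℕ.* 4
    p≡3+m*4 = ≡-trans (m≡m%n+[m/n]*n p 4) (cong (ℕ._+ m ℕ.* 4) p%4≡3)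
    4m : m ℕ.* 4 ≡ 2 ℕ.* m ℕ.* 2
    4m = ≡-trans (≡-sym (ℕₚ.*-assoc m 2 2)) (cong (ℕ._* 2) (ℕₚ.*-comm m 2))
    n≡ : (p ∸ 1) / 2 ≡ suc (2 ℕ.* m)
    n≡ = ≡-trans (cong (λ t → (t ∸ 1) / 2) p≡3+m*4)
      (≡-trans (cong (λ t → (2 ℕ.+ t) / 2) 4m) (m*n/n≡m (suc (2 ℕ.* m)) 2))
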